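{- For a positive integer $n$, let $f^{\ast}(n)$ denote the maximum number of edges in a simple graph on $n$ vertices in which no two cycles have the same length. Let $M_n$ be the set of simple graphs on $n$ vertices with exactly $f^{\ast}(n)$ edges in which no two cycles have the same length, and let $mc(n)$ be the maximum, over all $G \in M_n$, of the length of a longest cycle in $G$. Then there exists $N$ such that for all $n \geq N$, $$mc(n) \leq \frac{15}{16} n.$$
   Context: All graphs are finite and simple. "Any two cycles are of different lengths" means that distinct cycles of the graph have distinct lengths (numbers of edges). -}

module Defs where

open import Data.Nat using (ℕ; zero; suc; _+_; _*_; _≤_; _<_; _<?_)
open import Data.Bool using (Bool; true; false; if_then_else_; _∧_)
open import Data.Fin using (Fin; toℕ; fromℕ<)
import Data.Fin as F
open import Data.List using (List; map; allFin)
open import Data.Nat.ListAction using (sum)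
open import Data.Product using (Σ; ∃; ∃-syntax; _×_; _,_)
open import Data.Sum using (_⊎_)
open import Function.Definitions using (Injective)
open import Function.Bundles using (_⇔_)
open import Relation.Nullary using (yes; no)
open import Relation.Nullary.Decidable using (⌊_⌋)
open import Relation.Binary.PropositionalEquality using (_≡_)

record Graph (n : ℕ) : Set where
  field
    adj    : Fin n → Fin n → Bool
    sym    : ∀ i j → adj i j ≡ adj j i
    irrefl : ∀ i → adj i i ≡ false
open Graph public

edgeCount : ∀ {n} → Graph n → ℕ
edgeCount {n} G =
  sum (map (λ i → sum (map (λ j →
    if adj G i j ∧ ⌊ toℕ i <? toℕ j ⌋ then 1 else 0) (allFin n))) (allFin n))

cnext : ∀ {k} → Fin (suc k) → Fin (suc k)
cnext {k} i with suc (toℕ i) <? suc k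
... | yes p = fromℕ< p
... | no _  = F.zero

record Cycle {n : ℕ} (G : Graph n) (m : ℕ) : Set where
  field
    vtx      : Fin (3 + m) → Fin n
    distinct : Injective _≡_ _≡_ vtx
    closed   : ∀ i → adj G (vtx i) (vtx (cnext i)) ≡ true
open Cycle public

cycleLength : ∀ {n} {G : Graph n} {m : ℕ} → Cycle G m → ℕ
cycleLength {m = m} _ = 3 + m

CycleEdge : ∀ {n} {G : Graph n} {m} → Cycle G m → Fin n → Fin n → Set
CycleEdge c u v = ∃[ i ] ((vtx c i ≡ u × vtx c (cnext i) ≡ v)
                       ⊎ (vtx c i ≡ v × vtx c (cnext i) ≡ u))

SameCycle : ∀ {n} {G : Graph n} {m m'} → Cycle G m → Cycle G m' → Set
SameCycle c d = ∀ u v → CycleEdge c u v ⇔ CycleEdge d u v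

DistinctCycleLengths : ∀ {n} → Graph n → Set
DistinctCycleLengths G = ∀ m (c d : Cycle G m) → SameCycle c d

IsFStar : ℕ → ℕ → Set
IsFStar n f = (∃[ G ] (DistinctCycleLengths {n} G × edgeCount G ≡ f))
            × (∀ (H : Graph n) → DistinctCycleLengths H → edgeCount H ≤ f)

InM : ∀ {n} → Graph n → Set
InM {n} G = DistinctCycleLengths G × IsFStar n (edgeCount G)

-- mc(n) = L : the maximum, over G ∈ M_n, of the length of a longest cycle in G
-- (with the convention 0 if there are no cycles at all).
IsMC : ℕ → ℕ → Set
IsMC n L = (∀ (G : Graph n) → InM G → ∀ m (c : Cycle G m) → cycleLength c ≤ L)
         × (L ≡ 0 ⊎ ∃[ G ] (InM {n} G × ∃[ m ] (Cycle G m × 3 + m ≡ L)))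

{-# OPTIONS --safe #-}
module Submission where

-- Glueing three-armed spiders and pendant edges at a hub, with all pairwise sums of arm lengths of a spider
-- distinct across spiders, gives n + (1 - o(1)) √(20n/9) edges. Let an optimal graph have a cycle C of length
-- L > 15n/16. The cycles among any E edges off C have distinct lengths, so averaging yields about 2√E edges
-- that meet all of them; taking E ≈ n/16 + √(20n/9) and removing these leaves a forest, in which k branches
-- join C to C, with k still larger than (1 + ε)√L. Fix one branch as base. For two further ones, either some cycle
-- uses exactly these three branches, or their positions along C differ by about the length of a cycle through
-- both of them. Cycles using different sets of branches are different, so the first case occurs for at
-- most n + 1 triples; hence for some base the positions of the branches form an almost-Sidon set in an interval of
-- length L, and the Erdős–Turán bound k ≤ (1 + o(1))√L is contradicted.

open import Defs hiding (sym)
open import Data.Bool using (Bool; true; false; not; _∧_; _∨_; if_then_else_)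
import Data.Bool.Properties as 𝔹
open import Data.Bool.ListAction using (any)
open import Data.Empty using (⊥; ⊥-elim)
open import Data.Fin as F using (Fin; toℕ; fromℕ<; inject≤; cast; _↑ˡ_; _↑ʳ_)
import Data.Fin.Properties as FP
open import Data.List using (List; []; _∷_; _++_; [_]; map; length; filter; cartesianProduct; allFin; upTo; take; reverse; lookup)
open import Data.List.Properties using (length-++; length-map; length-upTo; length-tabulate; length-reverse; length-take; upTo-∷ʳ; ++-assoc; ++-cancelʳ; ++-identityʳ; unfold-reverse; reverse-++)
open import Data.List.Membership.Propositional using (_∈_; _∉_)
open import Data.List.Membership.Propositional.Properties
open import Data.List.Relation.Unary.All as All using (All; []; _∷_)
open import Data.List.Relation.Unary.AllPairs using ([]; _∷_)
open import Data.List.Relation.Unary.Any using (here; there; any?; index)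
import Data.List.Relation.Unary.Any.Properties as AnyP
open import Data.List.Relation.Unary.Unique.Propositional using (Unique)
import Data.List.Relation.Unary.Unique.Propositional.Properties as Uniq
open import Data.Nat
open import Data.Nat.Induction using (<-wellFounded)
open import Data.Nat.ListAction using (sum)
open import Data.Nat.Properties
open import Data.Nat.Tactic.RingSolver using (solve-∀)
open import Data.Product using (Σ; ∃-syntax; _×_; _,_; proj₁; proj₂)
open import Data.Product.Properties using (,-injective; ≡-dec)
open import Data.Sum using (_⊎_; inj₁; inj₂; [_,_]′; swap)
open import Data.Unit using (tt)
open import Function using (_∘_; id)
open import Function.Bundles using (mk⇔; module Equivalence)
open import Induction.WellFounded using (Acc; acc)
open import Relation.Binary.Definitions using (tri<; tri≈; tri>)
open import Relation.Binary.PropositionalEquality hiding ([_]; J)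
open import Relation.Nullary using (¬_; Dec; yes; no; _×-dec_)
open import Relation.Nullary.Decidable using (⌊_⌋; ¬?; _⊎-dec_; decidable-stable; ¬¬-excluded-middle)
open import Relation.Unary using (Decidable)

-- All sizes are measured by a number `a` with n about 103680 a². The glued graph then has at least
-- n + 480a - 5 edges. For z = n - L at most n/16, which is about 6480 a², the cover takes 80a + x
-- edges, where x is at most about z / (80a), and k is about 400a - x. At z = 6480 a² this is 319a
-- against √L of about 312a, and the gap widens as z decreases; this balance is behind 15/16. The
-- obstacle is the part of a branch in the forest. A cycle through two branches exceeds the
-- difference of their positions by the lengths of two tree paths, and a single such path may be
-- long. Two paths that meet, however, give a cycle through all three branches. Where such pairs are
-- few, every vertex lies on few paths, and the total length of the paths is under control. A large
-- constant number of bases makes these pairs so rare that windows of length proportional to n,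
-- longer than usual for Sidon sets, absorb the error. Which cycles lie inside a set of edges is
-- never decided, so the upper bound is proved under double negation.

private
  variable
    𝒜 ℬ : Set

-- Reduces an inequality to an identity for the ring solver: the surplus `s` is written out and the
-- known inequality enters crosswise. With `P = 0` the identity alone does the work.
≤-from-excess : ∀ {A B P Q : ℕ} s → P ≤ Q → A + Q + s ≡ B + P → A ≤ B
≤-from-excess {A} {B} {P} {Q} s P≤Q eq = +-cancelʳ-≤ Q A B (begin
  A + Q     ≤⟨ m≤m+n (A + Q) s ⟩
  A + Q + s ≡⟨ eq ⟩
  B + P     ≤⟨ +-monoʳ-≤ B P≤Q ⟩
  B + Q     ∎)
  where open ≤-Reasoning

-- Finite sums over lists.

ι : Bool → ℕ
ι true  = 1
ι false = 0

ι≤1 : ∀ b → ι b ≤ 1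
ι≤1 true  = ≤-refl
ι≤1 false = z≤n

sumOf : (𝒜 → ℕ) → List 𝒜 → ℕ
sumOf f []       = 0
sumOf f (x ∷ xs) = f x + sumOf f xs

sumOf-mono : ∀ {f g : 𝒜 → ℕ} xs → (∀ {x} → x ∈ xs → f x ≤ g x) → sumOf f xs ≤ sumOf g xs
sumOf-mono []       h = z≤n
sumOf-mono (x ∷ xs) h = +-mono-≤ (h (here refl)) (sumOf-mono xs (h ∘ there))

sumOf-cong : ∀ {f g : 𝒜 → ℕ} xs → (∀ {x} → x ∈ xs → f x ≡ g x) → sumOf f xs ≡ sumOf g xs
sumOf-cong []       h = refl
sumOf-cong (x ∷ xs) h = cong₂ _+_ (h (here refl)) (sumOf-cong xs (h ∘ there))

sumOf-+ : ∀ (f g : 𝒜 → ℕ) xs → sumOf (λ x → f x + g x) xs ≡ sumOf f xs + sumOf g xs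
sumOf-+ f g []       = refl
sumOf-+ f g (x ∷ xs) rewrite sumOf-+ f g xs = interchange (f x) (g x) (sumOf f xs) (sumOf g xs)
  where
  interchange : ∀ a b c d → a + b + (c + d) ≡ a + c + (b + d)
  interchange = solve-∀

sumOf-*ˡ : ∀ c (f : 𝒜 → ℕ) xs → sumOf (λ x → c * f x) xs ≡ c * sumOf f xs
sumOf-*ˡ c f []       = sym (*-zeroʳ c)
sumOf-*ˡ c f (x ∷ xs) rewrite sumOf-*ˡ c f xs = sym (*-distribˡ-+ c (f x) (sumOf f xs))

sumOf-const : ∀ c (xs : List 𝒜) → sumOf (λ _ → c) xs ≡ length xs * c
sumOf-const c []       = refl
sumOf-const c (x ∷ xs) = cong (c +_) (sumOf-const c xs)

sumOf-≤-const : ∀ {f : 𝒜 → ℕ} {c} xs → (∀ {x} → x ∈ xs → f x ≤ c) → sumOf f xs ≤ length xs * c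
sumOf-≤-const {c = c} xs h = ≤-trans (sumOf-mono xs h) (≤-reflexive (sumOf-const c xs))

sumOf-++ : ∀ (f : 𝒜 → ℕ) xs ys → sumOf f (xs ++ ys) ≡ sumOf f xs + sumOf f ys
sumOf-++ f []       ys = refl
sumOf-++ f (x ∷ xs) ys = trans (cong (f x +_) (sumOf-++ f xs ys)) (sym (+-assoc (f x) _ _))

sumOf-map : ∀ (f : ℬ → ℕ) (g : 𝒜 → ℬ) xs → sumOf f (map g xs) ≡ sumOf (f ∘ g) xs
sumOf-map f g []       = refl
sumOf-map f g (x ∷ xs) = cong (f (g x) +_) (sumOf-map f g xs)

sumOf-swap : ∀ (f : 𝒜 → ℬ → ℕ) xs ys →
  sumOf (λ x → sumOf (f x) ys) xs ≡ sumOf (λ y → sumOf (λ x → f x y) xs) ys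
sumOf-swap f []       ys = sym (trans (sumOf-const 0 ys) (*-zeroʳ (length ys)))
sumOf-swap f (x ∷ xs) ys = trans (cong (sumOf (f x) ys +_) (sumOf-swap f xs ys))
  (sym (sumOf-+ (f x) (λ y → sumOf (λ x → f x y) xs) ys))

sumOf-× : ∀ (f : 𝒜 × ℬ → ℕ) xs ys →
  sumOf f (cartesianProduct xs ys) ≡ sumOf (λ x → sumOf (λ y → f (x , y)) ys) xs
sumOf-× f []       ys = refl
sumOf-× f (x ∷ xs) ys = trans (sumOf-++ f (map (x ,_) ys) _)
  (cong₂ _+_ (sumOf-map f (x ,_) ys) (sumOf-× f xs ys))

module _ {P : 𝒜 → Set} (P? : Decidable P) where

  sumOf-filter : ∀ (f : 𝒜 → ℕ) xs → sumOf f (filter P? xs) ≡ sumOf (λ x → ι ⌊ P? x ⌋ * f x) xs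
  sumOf-filter f []       = refl
  sumOf-filter f (x ∷ xs) with P? x
  ... | yes _ = cong₂ _+_ (sym (+-identityʳ (f x))) (sumOf-filter f xs)
  ... | no  _ = sumOf-filter f xs

  length-filter≡ : ∀ xs → length (filter P? xs) ≡ sumOf (λ x → ι ⌊ P? x ⌋) xs
  length-filter≡ []       = refl
  length-filter≡ (x ∷ xs) with P? x
  ... | yes _ = cong suc (length-filter≡ xs)
  ... | no  _ = length-filter≡ xs

sumOf-1 : ∀ (xs : List 𝒜) → sumOf (λ _ → 1) xs ≡ length xs
sumOf-1 xs = trans (sumOf-const 1 xs) (*-identityʳ (length xs))

sumOf-upTo-suc : ∀ (f : ℕ → ℕ) n → sumOf f (upTo (suc n)) ≡ sumOf f (upTo n) + f n
sumOf-upTo-suc f n = begin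
  sumOf f (upTo (suc n))         ≡⟨ cong (sumOf f) (sym (upTo-∷ʳ n)) ⟩
  sumOf f (upTo n ++ n ∷ [])     ≡⟨ sumOf-++ f (upTo n) (n ∷ []) ⟩
  sumOf f (upTo n) + (f n + 0)   ≡⟨ cong (sumOf f (upTo n) +_) (+-identityʳ (f n)) ⟩
  sumOf f (upTo n) + f n         ∎
  where open ≡-Reasoning

length-allFin : ∀ k → length (allFin k) ≡ k
length-allFin k = length-tabulate {n = k} id

-- Sums and cardinalities of duplicate-free lists

sumOf-⊆ : ∀ (f : 𝒜 → ℕ) {xs ys} → Unique xs → (∀ {x} → x ∈ xs → x ∈ ys) → sumOf f xs ≤ sumOf f ys
sumOf-⊆ f {[]} u h = z≤n
sumOf-⊆ f {x ∷ xs} {ys} (x∉ ∷ u) h with ∈-∃++ (h (here refl))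
... | as , bs , refl = begin
  f x + sumOf f xs               ≤⟨ +-monoʳ-≤ (f x) (sumOf-⊆ f u rest) ⟩
  f x + sumOf f (as ++ bs)       ≡⟨ cong (f x +_) (sumOf-++ f as bs) ⟩
  f x + (sumOf f as + sumOf f bs) ≡⟨ shuffle (f x) (sumOf f as) (sumOf f bs) ⟩
  sumOf f as + (f x + sumOf f bs) ≡⟨ sumOf-++ f as (x ∷ bs) ⟨
  sumOf f (as ++ x ∷ bs)         ∎
  where
  open ≤-Reasoning
  shuffle : ∀ a b c → a + (b + c) ≡ b + (a + c)
  shuffle = solve-∀
  rest : ∀ {y} → y ∈ xs → y ∈ as ++ bs
  rest {y} y∈ with ∈-++⁻ as (h (there y∈))
  ... | inj₁ y∈as         = ∈-++⁺ˡ y∈as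
  ... | inj₂ (here refl)  = ⊥-elim (All.lookup x∉ y∈ refl)
  ... | inj₂ (there y∈bs) = ∈-++⁺ʳ as y∈bs

length-⊆ : ∀ {xs ys : List 𝒜} → Unique xs → (∀ {x} → x ∈ xs → x ∈ ys) → length xs ≤ length ys
length-⊆ {xs = xs} {ys} u h = subst₂ _≤_ (sumOf-1 xs) (sumOf-1 ys) (sumOf-⊆ (λ _ → 1) u h)

Unique-map : ∀ (φ : 𝒜 → ℬ) {xs} → Unique xs →
  (∀ {x y} → x ∈ xs → y ∈ xs → φ x ≡ φ y → x ≡ y) → Unique (map φ xs)
Unique-map φ {[]}     u         inj = []
Unique-map φ {x ∷ xs} (x∉ ∷ u) inj =
  All.tabulate fresh ∷ Unique-map φ u (λ p q → inj (there p) (there q))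
  where
  fresh : ∀ {z} → z ∈ map φ xs → ¬ φ x ≡ z
  fresh z∈ eq with ∈-map⁻ φ z∈
  ... | y , y∈ , refl = All.lookup x∉ y∈ (inj (here refl) (there y∈) eq)

-- The form in which distinct lengths enter weighted counts: at worst, every length below `ℬ` occurs
-- once.
sumOf-injection : ∀ (ω : ℕ → ℕ) (φ : 𝒜 → ℕ) {xs ℬ} → Unique xs →
  (∀ {x y} → x ∈ xs → y ∈ xs → φ x ≡ φ y → x ≡ y) → (∀ {x} → x ∈ xs → φ x < ℬ) →
  sumOf (ω ∘ φ) xs ≤ sumOf ω (upTo ℬ)
sumOf-injection ω φ {xs} {ℬ} u inj bd = ≤-trans (≤-reflexive (sym (sumOf-map ω φ xs)))
  (sumOf-⊆ ω (Unique-map φ u inj) bounded)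
  where
  bounded : ∀ {z} → z ∈ map φ xs → z ∈ upTo ℬ
  bounded z∈ with ∈-map⁻ φ z∈
  ... | y , y∈ , refl = ∈-upTo⁺ (bd y∈)

length-injection : ∀ (φ : 𝒜 → ℕ) {xs ℬ} → Unique xs →
  (∀ {x y} → x ∈ xs → y ∈ xs → φ x ≡ φ y → x ≡ y) → (∀ {x} → x ∈ xs → φ x < ℬ) → length xs ≤ ℬ
length-injection φ {xs} {ℬ} u inj bd = subst₂ _≤_ (sumOf-1 xs) (trans (sumOf-1 (upTo ℬ)) (length-upTo ℬ))
  (sumOf-injection (λ _ → 1) φ u inj bd)

-- Averaging without division. It selects the next element of a cover, and later the base branch
-- with the fewest bad pairs.
∃-small : ∀ (f : 𝒜 → ℕ) {xs} → 0 < length xs → ∃[ x ] (x ∈ xs × length xs * f x ≤ sumOf f xs)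
∃-small f {x ∷ []}     _ = x , here refl , ≤-refl
∃-small f {x ∷ y ∷ xs} _ with ∃-small f {y ∷ xs} (s≤s z≤n)
... | z , z∈ , h with f x ≤? f z
...   | yes x≤z = x , here refl , +-monoʳ-≤ (f x) (≤-trans (*-monoʳ-≤ (suc (length xs)) x≤z) h)
...   | no  x≰z = z , there z∈ , +-mono-≤ (<⇒≤ (≰⇒> x≰z)) h

length-filter-∉ : ∀ {P : 𝒜 → Set} (P? : Decidable P) {xs ys : List 𝒜} → Unique xs →
  (∀ {x} → x ∈ xs → ¬ P x → x ∈ ys) → length xs ≤ length (filter P? xs) + length ys
length-filter-∉ P? {xs} {ys} u h = ≤-trans (length-⊆ u split) (≤-reflexive (length-++ (filter P? xs)))
  where
  split : ∀ {x} → x ∈ xs → x ∈ filter P? xs ++ ys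
  split {x} x∈ with P? x
  ... | yes px = ∈-++⁺ˡ (∈-filter⁺ P? x∈ px)
  ... | no ¬px = ∈-++⁺ʳ (filter P? xs) (h x∈ ¬px)

∈-take : ∀ k {xs : List 𝒜} {x} → x ∈ take k xs → x ∈ xs
∈-take (suc k) {_ ∷ _} (here eq)  = here eq
∈-take (suc k) {_ ∷ _} (there x∈) = there (∈-take k x∈)

-- Power sums and the Cauchy–Schwarz inequality

bernoulli : ∀ E t → E ^ suc t + suc t * E ^ t ≤ suc E ^ suc t
bernoulli E zero    = ≤-reflexive (eq E)
  where
  eq : ∀ E → E * 1 + 1 * 1 ≡ suc E * 1
  eq = solve-∀
bernoulli E (suc t) = begin
  E * (E * x) + suc (suc t) * (E * x)                 ≤⟨ m≤m+n _ (suc t * x) ⟩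
  E * (E * x) + suc (suc t) * (E * x) + suc t * x     ≡⟨ eq E t x ⟩
  suc E * (E * x + suc t * x)                         ≤⟨ *-monoʳ-≤ (suc E) (bernoulli E t) ⟩
  suc E * suc E ^ suc t                               ∎
  where
  open ≤-Reasoning
  x = E ^ t
  eq : ∀ E t x → E * (E * x) + suc (suc t) * (E * x) + suc t * x ≡ suc E * (E * x + suc t * x)
  eq = solve-∀

-- The discrete form of the integral of x^t from 0 to E; `bernoulli` bounds each increment.
power-sum : ∀ E t → suc t * sumOf (_^ t) (upTo E) ≤ E ^ suc t
power-sum zero    t = ≤-trans (≤-reflexive (*-zeroʳ (suc t))) z≤n
power-sum (suc E) t = begin
  suc t * sumOf (_^ t) (upTo (suc E))          ≡⟨ cong (suc t *_) (sumOf-upTo-suc (_^ t) E) ⟩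
  suc t * (sumOf (_^ t) (upTo E) + E ^ t)      ≡⟨ *-distribˡ-+ (suc t) _ (E ^ t) ⟩
  suc t * sumOf (_^ t) (upTo E) + suc t * E ^ t ≤⟨ +-monoˡ-≤ _ (power-sum E t) ⟩
  E ^ suc t + suc t * E ^ t                    ≤⟨ bernoulli E t ⟩
  suc E ^ suc t                                ∎
  where open ≤-Reasoning

2*m*n≤m²+n² : ∀ m n → 2 * (m * n) ≤ m * m + n * n
2*m*n≤m²+n² m n with ≤-total m n
... | inj₁ m≤n with m≤n⇒∃[o]m+o≡n m≤n
...   | o , refl = ≤-from-excess {P = 0} (o * o) z≤n (eq m o)
  where
  eq : ∀ m o → 2 * (m * (m + o)) + 0 + o * o ≡ m * m + (m + o) * (m + o) + 0
  eq = solve-∀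
2*m*n≤m²+n² m n | inj₂ n≤m with m≤n⇒∃[o]m+o≡n n≤m
...   | o , refl = ≤-from-excess {P = 0} (o * o) z≤n (eq n o)
  where
  eq : ∀ n o → 2 * ((n + o) * n) + 0 + o * o ≡ (n + o) * (n + o) + n * n + 0
  eq = solve-∀

cauchy-schwarz : ∀ (f : 𝒜 → ℕ) xs →
  sumOf f xs * sumOf f xs ≤ length xs * sumOf (λ x → f x * f x) xs
cauchy-schwarz f []       = z≤n
cauchy-schwarz f (x ∷ xs) = begin
  (a + s) * (a + s)                 ≡⟨ e₁ a s ⟩
  a * a + 2 * (a * s) + s * s       ≤⟨ +-mono-≤ (+-monoʳ-≤ (a * a) cross) (cauchy-schwarz f xs) ⟩
  a * a + (l * (a * a) + q) + l * q ≡⟨ e₂ a l q ⟩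
  suc l * (a * a + q)               ∎
  where
  open ≤-Reasoning
  a = f x
  s = sumOf f xs
  l = length xs
  q = sumOf (λ x → f x * f x) xs
  e₁ : ∀ a s → (a + s) * (a + s) ≡ a * a + 2 * (a * s) + s * s
  e₁ = solve-∀
  e₂ : ∀ a l q → a * a + (l * (a * a) + q) + l * q ≡ suc l * (a * a + q)
  e₂ = solve-∀
  cross : 2 * (a * s) ≤ l * (a * a) + q
  cross = begin
    2 * (a * s)                                ≡⟨ cong (2 *_) (sumOf-*ˡ a f xs) ⟨
    2 * sumOf (λ y → a * f y) xs               ≡⟨ sumOf-*ˡ 2 _ xs ⟨
    sumOf (λ y → 2 * (a * f y)) xs             ≤⟨ sumOf-mono xs (λ {y} _ → 2*m*n≤m²+n² a (f y)) ⟩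
    sumOf (λ y → a * a + f y * f y) xs         ≡⟨ sumOf-+ (λ _ → a * a) _ xs ⟩
    sumOf (λ _ → a * a) xs + q                 ≡⟨ cong (_+ q) (sumOf-const (a * a) xs) ⟩
    l * (a * a) + q                            ∎

-- Covering sets of distinct sizes

any-true : ∀ {A : Set} (p : A → Bool) {xs x} → x ∈ xs → p x ≡ true → any p xs ≡ true
any-true p (here refl) px rewrite px = refl
any-true p {y ∷ _} (there x∈) px with p y
... | true  = refl
... | false = any-true p x∈ px

any-witness : ∀ {A : Set} (p : A → Bool) {xs} → any p xs ≡ true → ∃[ x ] (x ∈ xs × p x ≡ true)
any-witness p {y ∷ xs} eq with p y in py
... | true  = y , here refl , py
... | false with any-witness p {xs} eq
...   | x , x∈ , px = x , there x∈ , px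

-- `es` is the ground set, and `z i` is the indicator function of the `i`-th set.
module Covering {A I : Set} (es : List A) (z : I → A → Bool) where

  private E = length es

  size : I → ℕ
  size i = sumOf (ι ∘ z i) es

  missed : List A → I → ℕ
  missed S i = ι (not (any (z i) S))

  size-complement : ∀ i → sumOf (ι ∘ not ∘ z i) es ≡ E ∸ size i
  size-complement i = sym (trans (cong (_∸ size i) total) (m+n∸n≡m _ (size i)))
    where
    ι-not : ∀ b → 1 ≡ ι (not b) + ι b
    ι-not true  = refl
    ι-not false = refl
    total : E ≡ sumOf (ι ∘ not ∘ z i) es + size i
    total = trans (sym (sumOf-1 es)) (trans (sumOf-cong es (λ {e} _ → ι-not (z i e)))
      (sumOf-+ (ι ∘ not ∘ z i) (ι ∘ z i) es))

  -- Averaging over the choice of the next element: a uniformly random t-tuple misses the set i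
  -- with probability (1 - size i / E) ^ t.
  greedy : 0 < E → ∀ t is → ∃[ S ] (length S ≤ t ×
    E ^ t * sumOf (missed S) is ≤ sumOf (λ i → (E ∸ size i) ^ t) is)
  greedy E>0 zero    is = [] , z≤n , ≤-reflexive (*-identityˡ _)
  greedy E>0 (suc t) is with ∃-small φ {es} E>0
    where
    φ : A → ℕ
    φ e = sumOf (λ i → ι (not (z i e)) * (E ∸ size i) ^ t) is
  ... | e , e∈ , small with greedy E>0 t (filter (λ i → z i e 𝔹.≟ false) is)
  ...   | S , S≤t , bound = e ∷ S , s≤s S≤t , (begin
    E * E ^ t * sumOf (missed (e ∷ S)) is               ≡⟨ *-assoc E (E ^ t) _ ⟩
    E * (E ^ t * sumOf (missed (e ∷ S)) is)             ≡⟨ cong (λ s → E * (E ^ t * s)) missed-∷ ⟩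
    E * (E ^ t * sumOf (missed S) is′)                  ≤⟨ *-monoʳ-≤ E bound ⟩
    E * sumOf (λ i → (E ∸ size i) ^ t) is′              ≡⟨ cong (E *_) restrict ⟩
    E * sumOf (λ i → ι (not (z i e)) * (E ∸ size i) ^ t) is ≤⟨ small ⟩
    sumOf (λ e → sumOf (λ i → ι (not (z i e)) * (E ∸ size i) ^ t) is) es ≡⟨ sumOf-swap _ es is ⟩
    sumOf (λ i → sumOf (λ e → ι (not (z i e)) * (E ∸ size i) ^ t) es) is ≡⟨ sumOf-cong is (λ {i} _ → factor i) ⟩
    sumOf (λ i → (E ∸ size i) ^ suc t) is               ∎)
    where
    open ≤-Reasoning
    is′ = filter (λ i → z i e 𝔹.≟ false) is
    chosen : ∀ i → ι ⌊ z i e 𝔹.≟ false ⌋ ≡ ι (not (z i e))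
    chosen i with z i e
    ... | true  = refl
    ... | false = refl
    miss-step : ∀ b c → ι (not (b ∨ c)) ≡ ι ⌊ b 𝔹.≟ false ⌋ * ι (not c)
    miss-step true  c = refl
    miss-step false c = sym (+-identityʳ _)
    missed-∷ : sumOf (missed (e ∷ S)) is ≡ sumOf (missed S) is′
    missed-∷ = trans (sumOf-cong is (λ {i} _ → miss-step (z i e) (any (z i) S)))
      (sym (sumOf-filter (λ i → z i e 𝔹.≟ false) (missed S) is))
    restrict : sumOf (λ i → (E ∸ size i) ^ t) is′ ≡ sumOf (λ i → ι (not (z i e)) * (E ∸ size i) ^ t) is
    restrict = trans (sumOf-filter (λ i → z i e 𝔹.≟ false) _ is)
      (sumOf-cong is (λ {i} _ → cong (_* (E ∸ size i) ^ t) (chosen i)))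
    factor : ∀ i → sumOf (λ e → ι (not (z i e)) * (E ∸ size i) ^ t) es ≡ (E ∸ size i) ^ suc t
    factor i = trans (sumOf-cong es (λ {e} _ → *-comm (ι (not (z i e))) _))
      (trans (sumOf-*ˡ ((E ∸ size i) ^ t) (ι ∘ not ∘ z i) es)
      (trans (cong ((E ∸ size i) ^ t *_) (size-complement i)) (*-comm _ (E ∸ size i))))

  pick-missed : ∀ S is → (∀ {i} → i ∈ is → ∃[ a ] z i a ≡ true) →
    ∃[ S′ ] (length S′ ≡ sumOf (missed S) is × (∀ {i} → i ∈ is → any (z i) (S′ ++ S) ≡ true))
  pick-missed S []       ne = [] , refl , λ ()
  pick-missed S (i ∷ is) ne with any (z i) S in eq | pick-missed S is (ne ∘ there)
  ... | true  | S′ , len , hit = S′ , len , λ where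
    (here refl) → let a , a∈ , za = any-witness (z i) eq in any-true (z i) (∈-++⁺ʳ S′ a∈) za
    (there j∈) → hit j∈
  ... | false | S′ , len , hit with ne (here refl)
  ...   | a , za = a ∷ S′ , cong suc len , λ where
    (here refl) → any-true (z i) {a ∷ S′ ++ S} (here refl) za
    (there {x = _} {xs = _} j∈) → let b , b∈ , zb = any-witness _ (hit j∈) in any-true _ {a ∷ S′ ++ S} (there b∈) zb

  opaque
    -- After `t` greedy choices the number of missed sets is at most the sum of (1 - size/E)^t. As
    -- the `len i` are distinct and positive, this is at most the sum of (s/E)^t over s < E, hence
    -- at most E / (t + 1). One more element is spent on each missed set, so t near √E gives a cover
    -- of about 2√E elements.
    cover : ∀ (len : I → ℕ) is → 0 < E → Unique (map len is) →
      (∀ {i} → i ∈ is → 0 < len i) → (∀ {i} → i ∈ is → len i ≤ size i) →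
      (∀ {i} → i ∈ is → ∃[ a ] z i a ≡ true) → ∀ t →
      ∃[ S ] ∃[ u ] (length S ≤ t + u × suc t * u ≤ E × (∀ {i} → i ∈ is → any (z i) S ≡ true))
    cover len is E>0 uniq pos len≤ ne t with greedy E>0 t is
    ... | S , S≤t , bound with pick-missed S is ne
    ...   | S′ , S′≡ , hit = S′ ++ S , sumOf (missed S) is , size-bound , missed-bound , hit
      where
      open ≤-Reasoning
      size-bound : length (S′ ++ S) ≤ t + sumOf (missed S) is
      size-bound = begin
        length (S′ ++ S)             ≡⟨ length-++ S′ ⟩
        length S′ + length S         ≡⟨ +-comm (length S′) _ ⟩
        length S + length S′         ≤⟨ +-mono-≤ S≤t (≤-reflexive S′≡) ⟩
        t + sumOf (missed S) is      ∎
      size≤ : ∀ i → size i ≤ E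
      size≤ i = ≤-trans (sumOf-mono es (λ _ → ι≤1 _)) (≤-reflexive (sumOf-1 es))
      uniq′ : Unique (map (E ∸_) (map len is))
      uniq′ = Unique-map (E ∸_) uniq inj
        where
        inj : ∀ {x y} → x ∈ map len is → y ∈ map len is → E ∸ x ≡ E ∸ y → x ≡ y
        inj x∈ y∈ eq with ∈-map⁻ len x∈ | ∈-map⁻ len y∈
        ... | i , i∈ , refl | j , j∈ , refl =
          ∸-cancelˡ-≡ (≤-trans (len≤ i∈) (size≤ i)) (≤-trans (len≤ j∈) (size≤ j)) eq
      inside : ∀ {x} → x ∈ map (E ∸_) (map len is) → x ∈ upTo E
      inside x∈ with ∈-map⁻ (E ∸_) x∈
      ... | y , y∈ , refl with ∈-map⁻ len y∈
      ...   | i , i∈ , refl = ∈-upTo⁺ (∸-monoʳ-< (pos i∈) (≤-trans (len≤ i∈) (size≤ i)))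
      powers : sumOf (λ i → (E ∸ size i) ^ t) is ≤ sumOf (_^ t) (upTo E)
      powers = begin
        sumOf (λ i → (E ∸ size i) ^ t) is        ≤⟨ sumOf-mono is (λ i∈ → ^-monoˡ-≤ t (∸-monoʳ-≤ E (len≤ i∈))) ⟩
        sumOf (λ i → (E ∸ len i) ^ t) is         ≡⟨ sumOf-map (λ x → (E ∸ x) ^ t) len is ⟨
        sumOf (λ x → (E ∸ x) ^ t) (map len is)   ≡⟨ sumOf-map (_^ t) (E ∸_) (map len is) ⟨
        sumOf (_^ t) (map (E ∸_) (map len is))   ≤⟨ sumOf-⊆ (_^ t) uniq′ inside ⟩
        sumOf (_^ t) (upTo E)                    ∎
      missed-bound : suc t * sumOf (missed S) is ≤ E
      missed-bound = *-cancelˡ-≤ (E ^ t) {{m^n≢0 E t {{>-nonZero E>0}}}} (begin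
        E ^ t * (suc t * sumOf (missed S) is)    ≡⟨ shuffle (E ^ t) (suc t) _ ⟩
        suc t * (E ^ t * sumOf (missed S) is)    ≤⟨ *-monoʳ-≤ (suc t) (≤-trans bound powers) ⟩
        suc t * sumOf (_^ t) (upTo E)            ≤⟨ power-sum E t ⟩
        E ^ suc t                                ≡⟨ *-comm E (E ^ t) ⟩
        E ^ t * E                                ∎)
        where
        shuffle : ∀ a b c → a * (b * c) ≡ b * (a * c)
        shuffle = solve-∀

-- Edges of graphs and of cycles

cnext-cases : ∀ {k} (i : Fin (suc k)) →
  toℕ (cnext i) ≡ suc (toℕ i) ⊎ (toℕ (cnext i) ≡ 0 × toℕ i ≡ k)
cnext-cases {k} i with suc (toℕ i) <? suc k
... | yes p = inj₁ (FP.toℕ-fromℕ< p)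
... | no ¬p = inj₂ (refl , suc-injective (≤-antisym (FP.toℕ<n i) (≮⇒≥ ¬p)))

-- False for one or two vertices, so the bound 3 is essential. It makes the edges of a cycle
-- pairwise different and forbids turning back.
cnext-cnext-≢ : ∀ {k} (i : Fin (3 + k)) → cnext (cnext i) ≢ i
cnext-cnext-≢ i eq with cnext-cases i | cnext-cases (cnext i) | cong toℕ eq
... | inj₁ a | inj₁ b | e = m+1+n≢n 1 (trans (trans (cong suc (sym a)) (sym b)) e)
... | inj₁ a | inj₂ (b , c) | e with trans (trans (sym c) a) (cong suc (trans (sym e) b))
...   | ()
cnext-cnext-≢ i eq | inj₂ (a , b) | inj₁ c | e with trans (sym b) (trans (sym e) (trans c (cong suc a)))
...   | ()
cnext-cnext-≢ i eq | inj₂ (a , b) | inj₂ (c , d) | e with trans (sym d) a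
...   | ()

Pair : ℕ → Set
Pair n = Fin n × Fin n

opaque

  -- An undirected edge is represented by its increasing pair, the one that `edgeCount` counts.
  norm : ∀ {n} → Fin n → Fin n → Pair n
  norm u v with toℕ u <? toℕ v
  ... | yes _ = u , v
  ... | no  _ = v , u

  norm-cases : ∀ {n} (u v : Fin n) → norm u v ≡ (u , v) ⊎ norm u v ≡ (v , u)
  norm-cases u v with toℕ u <? toℕ v
  ... | yes _ = inj₁ refl
  ... | no  _ = inj₂ refl

  norm-comm : ∀ {n} (u v : Fin n) → norm u v ≡ norm v u
  norm-comm u v with toℕ u <? toℕ v | toℕ v <? toℕ u
  ... | yes p | yes q = ⊥-elim (<-asym p q)
  ... | yes _ | no _  = refl
  ... | no _  | yes _ = refl
  ... | no p  | no q with FP.toℕ-injective (≤-antisym (≮⇒≥ q) (≮⇒≥ p))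
  ...   | refl = refl

  norm-< : ∀ {n} {u v : Fin n} → toℕ u < toℕ v → norm u v ≡ (u , v)
  norm-< {u = u} {v} p with toℕ u <? toℕ v
  ... | yes _ = refl
  ... | no ¬p = ⊥-elim (¬p p)

norm-≡ : ∀ {n} {u v x y : Fin n} → norm u v ≡ norm x y → (u ≡ x × v ≡ y) ⊎ (u ≡ y × v ≡ x)
norm-≡ {u = u} {v} {x} {y} eq with norm-cases u v | norm-cases x y
... | inj₁ a | inj₁ b = inj₁ (,-injective (trans (sym a) (trans eq b)))
... | inj₁ a | inj₂ b = inj₂ (,-injective (trans (sym a) (trans eq b)))
... | inj₂ a | inj₁ b = let p , q = ,-injective (trans (sym a) (trans eq b)) in inj₂ (q , p)
... | inj₂ a | inj₂ b = let p , q = ,-injective (trans (sym a) (trans eq b)) in inj₁ (q , p)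

module _ {n} (G : Graph n) where

  IsEdge : Pair n → Set
  IsEdge (i , j) = adj G i j ≡ true × toℕ i < toℕ j

  isEdge? : ∀ p → Dec (IsEdge p)
  isEdge? (i , j) = (adj G i j 𝔹.≟ true) ×-dec (toℕ i <? toℕ j)

  edges : List (Pair n)
  edges = filter isEdge? (cartesianProduct (allFin n) (allFin n))

  edges-unique : Unique edges
  edges-unique = Uniq.filter⁺ isEdge? (Uniq.cartesianProduct⁺ (Uniq.allFin⁺ n) (Uniq.allFin⁺ n))

  ∈-edges⁺ : ∀ {p} → IsEdge p → p ∈ edges
  ∈-edges⁺ e = ∈-filter⁺ isEdge? (∈-cartesianProduct⁺ (∈-allFin _) (∈-allFin _)) e

  ∈-edges⁻ : ∀ {p} → p ∈ edges → IsEdge p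
  ∈-edges⁻ p∈ = proj₂ (∈-filter⁻ isEdge? {xs = cartesianProduct (allFin n) (allFin n)} p∈)

  adj⇒≢ : ∀ {u v} → adj G u v ≡ true → u ≢ v
  adj⇒≢ {u} a refl with trans (sym a) (irrefl G u)
  ... | ()

  norm-∈-edges : ∀ {u v} → adj G u v ≡ true → norm u v ∈ edges
  norm-∈-edges {u} {v} a with <-cmp (toℕ u) (toℕ v)
  ... | tri< u<v _ _ = subst (_∈ edges) (sym (norm-< u<v)) (∈-edges⁺ (a , u<v))
  ... | tri≈ _ u≡v _ = ⊥-elim (adj⇒≢ a (FP.toℕ-injective u≡v))
  ... | tri> _ _ v<u = subst (_∈ edges) (trans (sym (norm-< v<u)) (norm-comm v u))
    (∈-edges⁺ (trans (Graph.sym G v u) a , v<u))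

  edgeCount≡ : edgeCount G ≡ length edges
  edgeCount≡ = begin
    edgeCount G                                       ≡⟨ sum≡ (λ i → sum (map (λ j → w i j) (allFin n))) (allFin n) ⟩
    sumOf (λ i → sum (map (λ j → w i j) (allFin n))) (allFin n) ≡⟨ sumOf-cong (allFin n) (λ {i} _ → trans (sum≡ (w i) (allFin n)) (sumOf-cong (allFin n) (λ {j} _ → w≡ i j))) ⟩
    sumOf (λ i → sumOf (λ j → ι ⌊ isEdge? (i , j) ⌋) (allFin n)) (allFin n) ≡⟨ sumOf-× (λ p → ι ⌊ isEdge? p ⌋) (allFin n) (allFin n) ⟨
    sumOf (λ p → ι ⌊ isEdge? p ⌋) (cartesianProduct (allFin n) (allFin n)) ≡⟨ length-filter≡ isEdge? (cartesianProduct (allFin n) (allFin n)) ⟨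
    length edges                                      ∎
    where
    open ≡-Reasoning
    w : Fin n → Fin n → ℕ
    w i j = if adj G i j ∧ ⌊ toℕ i <? toℕ j ⌋ then 1 else 0
    sum≡ : ∀ {A : Set} (f : A → ℕ) xs → sum (map f xs) ≡ sumOf f xs
    sum≡ f []       = refl
    sum≡ f (x ∷ xs) = cong (f x +_) (sum≡ f xs)
    w≡ : ∀ i j → w i j ≡ ι ⌊ isEdge? (i , j) ⌋
    w≡ i j with adj G i j | toℕ i <? toℕ j
    ... | true  | yes _ = refl
    ... | true  | no _  = refl
    ... | false | yes _ = refl
    ... | false | no _  = refl

module _ {n} {G : Graph n} {m} (c : Cycle G m) where

  opaque

    cycleEdge : Fin (3 + m) → Pair n
    cycleEdge i = norm (vtx c i) (vtx c (cnext i))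

    cycleEdge-injective : ∀ {i j} → cycleEdge i ≡ cycleEdge j → i ≡ j
    cycleEdge-injective {i} {j} eq with norm-≡ eq
    ... | inj₁ (p , _) = distinct c p
    ... | inj₂ (p , q) = ⊥-elim (cnext-cnext-≢ j
      (trans (cong cnext (sym (distinct c p))) (distinct c q)))

    cycleEdges : List (Pair n)
    cycleEdges = map cycleEdge (allFin (3 + m))

    cycleEdges-unique : Unique cycleEdges
    cycleEdges-unique = Uniq.map⁺ cycleEdge-injective (Uniq.allFin⁺ (3 + m))

    length-cycleEdges : length cycleEdges ≡ 3 + m
    length-cycleEdges = trans (length-map cycleEdge (allFin (3 + m))) (length-tabulate id)

    cycleEdge-∈ : ∀ i → cycleEdge i ∈ cycleEdges
    cycleEdge-∈ i = ∈-map⁺ cycleEdge (∈-allFin i)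

    ∈-cycleEdges⁻ : ∀ {p} → p ∈ cycleEdges → ∃[ i ] p ≡ cycleEdge i
    ∈-cycleEdges⁻ p∈ with ∈-map⁻ cycleEdge p∈
    ... | i , _ , eq = i , eq

    cycleEdge≡ : ∀ i → cycleEdge i ≡ norm (vtx c i) (vtx c (cnext i))
    cycleEdge≡ i = refl

    CycleEdge⇒∈ : ∀ {u v} → CycleEdge c u v → norm u v ∈ cycleEdges
    CycleEdge⇒∈ (i , inj₁ (refl , refl)) = cycleEdge-∈ i
    CycleEdge⇒∈ (i , inj₂ (refl , refl)) = subst (_∈ cycleEdges) (norm-comm _ _) (cycleEdge-∈ i)

    ∈⇒CycleEdge : ∀ {u v} → norm u v ∈ cycleEdges → CycleEdge c u v
    ∈⇒CycleEdge p∈ with ∈-map⁻ cycleEdge p∈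
    ... | i , _ , eq with norm-≡ eq
    ...   | inj₁ (p , q) = i , inj₁ (sym p , sym q)
    ...   | inj₂ (p , q) = i , inj₂ (sym q , sym p)

-- Walks along a cycle and a forest

Unique-++ : ∀ {A : Set} {xs ys : List A} → Unique xs → Unique ys →
  (∀ {v} → v ∈ xs → v ∈ ys → ⊥) → Unique (xs ++ ys)
Unique-++ ux uy d = Uniq.++⁺ ux uy (λ (p , q) → d p q)

Unique-reverse : ∀ {A : Set} {xs : List A} → Unique xs → Unique (reverse xs)
Unique-reverse {xs = []}     u        = []
Unique-reverse {xs = x ∷ xs} (x∉ ∷ u) = subst Unique (sym (unfold-reverse x xs))
  (Unique-++ (Unique-reverse u) ([] ∷ []) (λ { v∈ (here refl) → All.lookup x∉ (AnyP.reverse⁻ v∈) refl }))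

-- `InC` stands for the vertices of C, `NR` for the non-roots of a rooted forest, and `π` for the
-- parent. `CAdj` collects the steps without a label: the edges of C, or, when acyclicity is
-- exploited, edges of the forest itself.
module Walks {V : Set} (InC : V → Set) (CAdj : V → V → Set) (NR : V → Set) (π : V → V) where

  data Step (x y : V) : Set where
    along : CAdj x y → CAdj y x → Step x y
    up    : NR x → π x ≡ y → Step x y
    down  : NR y → π y ≡ x → Step x y

  flip : ∀ {x y} → Step x y → Step y x
  flip (along a b) = along b a
  flip (up a b)    = down a b
  flip (down a b)  = up a b

  -- A tree edge is named by its lower end.
  label : ∀ {x y} → Step x y → List V
  label (along _ _)     = []
  label {x} (up _ _)    = x ∷ []
  label {y = y} (down _ _) = y ∷ []

  label-flip : ∀ {x y} (s : Step x y) → label (flip s) ≡ label s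
  label-flip (along _ _) = refl
  label-flip (up _ _)    = refl
  label-flip (down _ _)  = refl

  infixr 5 _▸_ _⊕_

  data Walk : V → V → Set where
    ∅   : ∀ {x} → Walk x x
    _▸_ : ∀ {x y z} → Step x y → Walk y z → Walk x z

  _⊕_ : ∀ {x y z} → Walk x y → Walk y z → Walk x z
  ∅       ⊕ q = q
  (s ▸ p) ⊕ q = s ▸ (p ⊕ q)

  -- The final vertex is left out, so that concatenation of walks is `++` and a closed walk lists
  -- each visit once.
  verts : ∀ {x y} → Walk x y → List V
  verts ∅             = []
  verts {x} (s ▸ p) = x ∷ verts p

  labels : ∀ {x y} → Walk x y → List V
  labels ∅       = []
  labels (s ▸ p) = label s ++ labels p

  verts-⊕ : ∀ {x y z} (p : Walk x y) (q : Walk y z) → verts (p ⊕ q) ≡ verts p ++ verts q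
  verts-⊕ ∅       q = refl
  verts-⊕ (s ▸ p) q = cong (_ ∷_) (verts-⊕ p q)

  labels-⊕ : ∀ {x y z} (p : Walk x y) (q : Walk y z) → labels (p ⊕ q) ≡ labels p ++ labels q
  labels-⊕ ∅       q = refl
  labels-⊕ (s ▸ p) q = trans (cong (label s ++_) (labels-⊕ p q)) (sym (++-assoc (label s) _ _))

  rev : ∀ {x y} → Walk x y → Walk y x
  rev ∅       = ∅
  rev (s ▸ p) = rev p ⊕ (flip s ▸ ∅)

  verts-rev : ∀ {x y} (p : Walk x y) → verts (rev p) ++ [ x ] ≡ reverse (verts p ++ [ y ])
  verts-rev ∅ = refl
  verts-rev {x} {y} (_▸_ {y = m} s p) = begin
    verts (rev p ⊕ (flip s ▸ ∅)) ++ [ x ]  ≡⟨ cong (_++ [ x ]) (verts-⊕ (rev p) (flip s ▸ ∅)) ⟩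
    (verts (rev p) ++ [ m ]) ++ [ x ]      ≡⟨ cong (_++ [ x ]) (verts-rev p) ⟩
    reverse (verts p ++ [ y ]) ++ [ x ]    ≡⟨ unfold-reverse x (verts p ++ [ y ]) ⟨
    reverse (x ∷ verts p ++ [ y ])         ∎
    where open ≡-Reasoning

  verts-rev-inner : ∀ {x y} (p : Walk x y) {is} → verts p ≡ x ∷ is → verts (rev p) ≡ y ∷ reverse is
  verts-rev-inner {x} {y} p {is} eq = ++-cancelʳ [ x ] _ _ (begin
    verts (rev p) ++ [ x ]          ≡⟨ verts-rev p ⟩
    reverse (verts p ++ [ y ])      ≡⟨ cong (λ l → reverse (l ++ [ y ])) eq ⟩
    reverse (x ∷ is ++ [ y ])       ≡⟨ unfold-reverse x (is ++ [ y ]) ⟩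
    reverse (is ++ [ y ]) ++ [ x ]  ≡⟨ cong (_++ [ x ]) (reverse-++ is [ y ]) ⟩
    y ∷ reverse is ++ [ x ]         ∎)
    where open ≡-Reasoning

  labels-rev⁺ : ∀ {x y} (p : Walk x y) {h} → h ∈ labels p → h ∈ labels (rev p)
  labels-rev⁺ (s ▸ p) {h} h∈ = subst (h ∈_) (sym (labels-⊕ (rev p) (flip s ▸ ∅))) (go (∈-++⁻ (label s) h∈))
    where
    go : h ∈ label s ⊎ h ∈ labels p → h ∈ labels (rev p) ++ (label (flip s) ++ [])
    go (inj₁ q) = ∈-++⁺ʳ (labels (rev p)) (∈-++⁺ˡ (subst (h ∈_) (sym (label-flip s)) q))
    go (inj₂ q) = ∈-++⁺ˡ (labels-rev⁺ p q)

  labels-rev⁻ : ∀ {x y} (p : Walk x y) {h} → h ∈ labels (rev p) → h ∈ labels p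
  labels-rev⁻ (s ▸ p) {h} h∈ with ∈-++⁻ (labels (rev p)) (subst (h ∈_) (labels-⊕ (rev p) (flip s ▸ ∅)) h∈)
  ... | inj₁ q = ∈-++⁺ʳ (label s) (labels-rev⁻ p q)
  ... | inj₂ q with ∈-++⁻ (label (flip s)) q
  ...   | inj₁ r = ∈-++⁺ˡ (subst (h ∈_) (label-flip s) r)

  -- The signature of a walk. Among the vertices of C, `S` has exactly the labels of `p` as members,
  -- and labels off C are disregarded. A signature thus records which branches are entered from C,
  -- and not how the tree paths continue.
  record Signed {x y} (p : Walk x y) (S : List V) : Set where
    constructor signed
    field
      sig⁺ : ∀ {h} → h ∈ S → h ∈ labels p
      sig⁻ : ∀ {h} → InC h → h ∈ labels p → h ∈ S
  open Signed public

  signed-⊕ : ∀ {x y z} {p : Walk x y} {q : Walk y z} {S T} → Signed p S → Signed q T → Signed (p ⊕ q) (S ++ T)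
  signed-⊕ {p = p} {q} {S} {T} (signed a b) (signed c d) = signed
    (λ {h} h∈ → subst (h ∈_) (sym (labels-⊕ p q)) ([ ∈-++⁺ˡ ∘ a , ∈-++⁺ʳ (labels p) ∘ c ]′ (∈-++⁻ S h∈)))
    (λ {h} i h∈ → [ ∈-++⁺ˡ ∘ b i , ∈-++⁺ʳ S ∘ d i ]′ (∈-++⁻ (labels p) (subst (h ∈_) (labels-⊕ p q) h∈)))

  signed-rev : ∀ {x y} {p : Walk x y} {S} → Signed p S → Signed (rev p) S
  signed-rev {p = p} (signed a b) = signed (labels-rev⁺ p ∘ a) (λ i → b i ∘ labels-rev⁻ p)

  record Ear (x y : V) (S : List V) : Set where
    field
      walk  : Walk x y
      inner : List V
      verts≡ : verts walk ≡ x ∷ inner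
      uniq  : Unique inner
      outer : ∀ {v} → v ∈ inner → ¬ InC v
      sgn   : Signed walk S

  revEar : ∀ {x y S} → Ear x y S → Ear y x S
  revEar e = record
    { walk = rev walk ; inner = reverse inner ; verts≡ = verts-rev-inner walk verts≡
    ; uniq = Unique-reverse uniq ; outer = outer ∘ AnyP.reverse⁻ ; sgn = signed-rev sgn }
    where open Ear e

  -- `on` is only required to contain the vertices. It will be an interval of positions, which turns
  -- disjointness of arcs into arithmetic.
  record Arc (x y : V) : Set₁ where
    field
      walk   : Walk x y
      on     : V → Set
      uniq   : Unique (verts walk ++ [ y ])
      on⁺    : ∀ {v} → v ∈ verts walk ++ [ y ] → on v
      on-C   : ∀ {v} → on v → InC v
      plain  : labels walk ≡ []

  -- An arc of C followed by an ear. All cycles formed from branches are cyclic sequences of one,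
  -- two or three legs; since the end of a leg is the start of the next one, it is not counted.
  record Leg (x z : V) (S : List V) : Set₁ where
    field
      walk  : Walk x z
      on    : V → Set
      inner : List V
      uniq  : Unique (verts walk)
      mem   : ∀ {v} → v ∈ verts walk → on v ⊎ v ∈ inner
      on-C  : ∀ {v} → on v → InC v
      outer : ∀ {v} → v ∈ inner → ¬ InC v
      sgn   : Signed walk S

  leg : ∀ {x y z S} → Arc x y → Ear y z S → Leg x z S
  leg {y = y} a e = record
    { walk = A.walk ⊕ E.walk ; on = A.on ; inner = E.inner
    ; uniq = subst Unique (sym eq) (Unique-++ A.uniq E.uniq (λ p q → E.outer q (A.on-C (A.on⁺ p))))
    ; mem = λ {v} v∈ → [ inj₁ ∘ A.on⁺ , inj₂ ]′ (∈-++⁻ (verts A.walk ++ [ y ]) (subst (v ∈_) eq v∈))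
    ; on-C = A.on-C ; outer = E.outer
    ; sgn = signed-⊕ {p = A.walk} {E.walk} {[]} (signed (λ ()) (λ {h} _ → subst (h ∈_) A.plain)) E.sgn }
    where
    module A = Arc a
    module E = Ear e
    eq : verts (A.walk ⊕ E.walk) ≡ (verts A.walk ++ [ y ]) ++ E.inner
    eq = trans (verts-⊕ A.walk E.walk) (trans (cong (verts A.walk ++_) E.verts≡)
      (sym (++-assoc (verts A.walk) [ y ] E.inner)))

  length-leg : ∀ {x y z S} (a : Arc x y) (e : Ear y z S) →
    length (verts (Leg.walk (leg a e))) ≡ length (verts (Arc.walk a)) + suc (length (Ear.inner e))
  length-leg a e = trans (cong length (verts-⊕ (Arc.walk a) (Ear.walk e)))
    (trans (length-++ (verts (Arc.walk a))) (cong (λ l → length (verts (Arc.walk a)) + length l) (Ear.verts≡ e)))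

  _⟂_ : ∀ {x y z w S T} → Leg x y S → Leg z w T → Set
  ℓ ⟂ m = (∀ {v} → Leg.on ℓ v → Leg.on m v → ⊥) × (∀ {v} → v ∈ Leg.inner ℓ → v ∈ Leg.inner m → ⊥)

  legs-disjoint : ∀ {x y z w S T} (ℓ : Leg x y S) (m : Leg z w T) → ℓ ⟂ m →
    ∀ {v} → v ∈ verts (Leg.walk ℓ) → v ∈ verts (Leg.walk m) → ⊥
  legs-disjoint ℓ m (d , d′) p q with Leg.mem ℓ p | Leg.mem m q
  ... | inj₁ a | inj₁ b = d a b
  ... | inj₁ a | inj₂ b = Leg.outer m b (Leg.on-C ℓ a)
  ... | inj₂ a | inj₁ b = Leg.outer ℓ a (Leg.on-C m b)
  ... | inj₂ a | inj₂ b = d′ a b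

  record Closed (S : List V) : Set where
    constructor mkClosed
    field
      {base} : V
      walk   : Walk base base
      uniq   : Unique (verts walk)
      sgn    : Signed walk S

  len : ∀ {S} → Closed S → ℕ
  len c = length (verts (Closed.walk c))

  close₁ : ∀ {x S} → Leg x x S → Closed S
  close₁ ℓ = mkClosed (Leg.walk ℓ) (Leg.uniq ℓ) (Leg.sgn ℓ)

  close₂ : ∀ {x y S T} (ℓ : Leg x y S) (m : Leg y x T) → ℓ ⟂ m → Closed (S ++ T)
  close₂ ℓ m d = mkClosed (Leg.walk ℓ ⊕ Leg.walk m)
    (subst Unique (sym (verts-⊕ (Leg.walk ℓ) (Leg.walk m))) (Unique-++ (Leg.uniq ℓ) (Leg.uniq m) (legs-disjoint ℓ m d)))
    (signed-⊕ (Leg.sgn ℓ) (Leg.sgn m))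

  len-close₂ : ∀ {x y S T} (ℓ : Leg x y S) (m : Leg y x T) (d : ℓ ⟂ m) →
    len (close₂ ℓ m d) ≡ length (verts (Leg.walk ℓ)) + length (verts (Leg.walk m))
  len-close₂ ℓ m d = trans (cong length (verts-⊕ (Leg.walk ℓ) (Leg.walk m))) (length-++ (verts (Leg.walk ℓ)))

  close₃ : ∀ {x y z S T U} (ℓ : Leg x y S) (m : Leg y z T) (k : Leg z x U) →
    ℓ ⟂ m → ℓ ⟂ k → m ⟂ k → Closed (S ++ (T ++ U))
  close₃ ℓ m k d₁ d₂ d₃ = mkClosed (Leg.walk ℓ ⊕ (Leg.walk m ⊕ Leg.walk k))
    (subst Unique (sym (trans (verts-⊕ (Leg.walk ℓ) _) (cong (verts (Leg.walk ℓ) ++_) (verts-⊕ (Leg.walk m) (Leg.walk k)))))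
      (Unique-++ (Leg.uniq ℓ) (Unique-++ (Leg.uniq m) (Leg.uniq k) (legs-disjoint m k d₃))
        (λ {v} p q → [ legs-disjoint ℓ m d₁ p , legs-disjoint ℓ k d₂ p ]′ (∈-++⁻ (verts (Leg.walk m)) q))))
    (signed-⊕ (Leg.sgn ℓ) (signed-⊕ (Leg.sgn m) (Leg.sgn k)))

  resign : ∀ {S T} → (∀ {h} → h ∈ S → h ∈ T) → (∀ {h} → h ∈ T → h ∈ S) → Closed S → Closed T
  resign f g (mkClosed w u (signed a b)) = mkClosed w u (signed (a ∘ g) (λ i → f ∘ b i))

-- Cycles in theta graphs with chords

module Thetas {V : Set} (InC : V → Set) (CAdj : V → V → Set) (NR : V → Set) (π : V → V) where

  open Walks InC CAdj NR π

  record Rail : Set where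
    field
      top    : ℕ
      at     : ℕ → V
      at-C   : ∀ x → InC (at x)
      at-adj : ∀ {x} → x < top → CAdj (at x) (at (suc x)) × CAdj (at (suc x)) (at x)
      at-inj : ∀ {x y} → x ≤ top → y ≤ top → at x ≡ at y → x ≡ y

  module _ (R : Rail) where
    open Rail R

    Between : ℕ → ℕ → V → Set
    Between lo hi v = ∃[ x ] (lo ≤ x × x ≤ hi × v ≡ at x)

    climb : ∀ {i j} → i ≤′ j → j ≤ top → Walk (at i) (at j)
    climb (≤′-reflexive refl) _ = ∅
    climb (≤′-step i≤j) j≤ = climb i≤j (<⇒≤ j≤) ⊕ (along (proj₁ (at-adj j≤)) (proj₂ (at-adj j≤)) ▸ ∅)

    climb-nodes : ∀ {i j} (i≤j : i ≤′ j) (j≤ : suc j ≤ top) →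
      verts (climb (≤′-step i≤j) j≤) ≡ verts (climb i≤j (<⇒≤ j≤)) ++ [ at j ]
    climb-nodes i≤j j≤ = verts-⊕ (climb i≤j (<⇒≤ j≤)) _

    climb-mem : ∀ {i j} (i≤j : i ≤′ j) (j≤ : j ≤ top) {v} →
      v ∈ verts (climb i≤j j≤) ++ [ at j ] → Between i j v
    climb-mem (≤′-reflexive refl) _ (here refl) = _ , ≤-refl , ≤-refl , refl
    climb-mem {i} {suc j} (≤′-step i≤j) j≤ v∈ with ∈-++⁻ (verts (climb (≤′-step i≤j) j≤)) v∈
    ... | inj₂ (here refl) = suc j , m≤n⇒m≤1+n (≤′⇒≤ i≤j) , ≤-refl , refl
    ... | inj₁ p with climb-mem i≤j (<⇒≤ j≤) (subst (_ ∈_) (climb-nodes i≤j j≤) p)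
    ...   | x , a , b , eq = x , a , m≤n⇒m≤1+n b , eq

    climb-unique : ∀ {i j} (i≤j : i ≤′ j) (j≤ : j ≤ top) → Unique (verts (climb i≤j j≤) ++ [ at j ])
    climb-unique (≤′-reflexive refl) _ = [] ∷ []
    climb-unique (≤′-step i≤j) j≤ = Unique-++
      (subst Unique (sym (climb-nodes i≤j j≤)) (climb-unique i≤j (<⇒≤ j≤))) ([] ∷ []) fresh
      where
      fresh : ∀ {v} → v ∈ verts (climb (≤′-step i≤j) j≤) → v ∈ [ at _ ] → ⊥
      fresh v∈ (here refl) with climb-mem i≤j (<⇒≤ j≤) (subst (_ ∈_) (climb-nodes i≤j j≤) v∈)
      ... | x , _ , x≤ , eq = 1+n≰n (≤-trans (≤-reflexive (at-inj j≤ (≤-trans x≤ (<⇒≤ j≤)) eq)) x≤)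

    climb-plain : ∀ {i j} (i≤j : i ≤′ j) (j≤ : j ≤ top) → labels (climb i≤j j≤) ≡ []
    climb-plain (≤′-reflexive refl) _ = refl
    climb-plain (≤′-step i≤j) j≤ = trans (labels-⊕ (climb i≤j (<⇒≤ j≤)) _)
      (trans (++-identityʳ _) (climb-plain i≤j (<⇒≤ j≤)))

    climb-length : ∀ {i j} (i≤j : i ≤′ j) (j≤ : j ≤ top) → length (verts (climb i≤j j≤)) + i ≡ j
    climb-length (≤′-reflexive refl) _ = refl
    climb-length {i} {suc j} (≤′-step i≤j) j≤ = begin
      length (verts (climb (≤′-step i≤j) j≤)) + i     ≡⟨ cong (λ l → length l + i) (climb-nodes i≤j j≤) ⟩
      length (verts (climb i≤j (<⇒≤ j≤)) ++ [ at j ]) + i ≡⟨ cong (_+ i) (length-++ (verts (climb i≤j (<⇒≤ j≤)))) ⟩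
      length (verts (climb i≤j (<⇒≤ j≤))) + 1 + i     ≡⟨ cong (_+ i) (+-comm _ 1) ⟩
      suc (length (verts (climb i≤j (<⇒≤ j≤))) + i)   ≡⟨ cong suc (climb-length i≤j (<⇒≤ j≤)) ⟩
      suc j                                           ∎
      where open ≡-Reasoning

    no-members : ∀ {xs : List V} → (∀ {v} → v ∉ xs) → xs ≡ []
    no-members {[]}    _ = refl
    no-members {x ∷ _} h = ⊥-elim (h (here refl))

    arc : ∀ {a b} i j → i ≤ top → j ≤ top → at i ≡ a → at j ≡ b → Arc a b
    arc i j i≤ j≤ refl refl with ≤-total i j
    ... | inj₁ i≤j = record
      { walk = climb (≤⇒≤′ i≤j) j≤ ; on = Between (i ⊓ j) (i ⊔ j)
      ; uniq = climb-unique (≤⇒≤′ i≤j) j≤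
      ; on⁺ = λ v∈ → let x , p , q , eq = climb-mem (≤⇒≤′ i≤j) j≤ v∈ in
          x , ≤-trans (m⊓n≤m i j) p , ≤-trans q (m≤n⊔m i j) , eq
      ; on-C = λ { (x , _ , _ , refl) → at-C x }
      ; plain = climb-plain (≤⇒≤′ i≤j) j≤ }
    ... | inj₂ j≤i = record
      { walk = rev w ; on = Between (i ⊓ j) (i ⊔ j)
      ; uniq = subst Unique (sym (verts-rev w)) (Unique-reverse (climb-unique (≤⇒≤′ j≤i) i≤))
      ; on⁺ = λ v∈ → let x , p , q , eq = climb-mem (≤⇒≤′ j≤i) i≤ (AnyP.reverse⁻ (subst (_ ∈_) (verts-rev w) v∈)) in
          x , ≤-trans (m⊓n≤n i j) p , ≤-trans q (m≤m⊔n i j) , eq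
      ; on-C = λ { (x , _ , _ , refl) → at-C x }
      ; plain = no-members (λ {v} v∈ → ∉[] (subst (v ∈_) (climb-plain (≤⇒≤′ j≤i) i≤) (labels-rev⁻ w v∈))) }
      where
      w = climb (≤⇒≤′ j≤i) i≤

    arc-on : ∀ {a b} i j (i≤ : i ≤ top) (j≤ : j ≤ top) (p : at i ≡ a) (q : at j ≡ b) {v} →
      Arc.on (arc i j i≤ j≤ p q) v → Between (i ⊓ j) (i ⊔ j) v
    arc-on i j i≤ j≤ refl refl o with ≤-total i j
    ... | inj₁ _ = o
    ... | inj₂ _ = o

    arc-length : ∀ {a b} i j (i≤ : i ≤ top) (j≤ : j ≤ top) (p : at i ≡ a) (q : at j ≡ b) →
      length (verts (Arc.walk (arc i j i≤ j≤ p q))) ≡ ∣ i - j ∣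
    arc-length i j i≤ j≤ refl refl with ≤-total i j
    ... | inj₁ i≤j = trans (trans (sym (m+n∸n≡m _ i)) (cong (_∸ i) (climb-length (≤⇒≤′ i≤j) j≤))) (sym (m≤n⇒∣m-n∣≡n∸m i≤j))
    ... | inj₂ j≤i = trans (trans (trans rev-length (sym (m+n∸n≡m _ j))) (cong (_∸ j) (climb-length (≤⇒≤′ j≤i) i≤)))
      (sym (m≤n⇒∣n-m∣≡n∸m j≤i))
      where
      w = climb (≤⇒≤′ j≤i) i≤
      rev-length : length (verts (rev w)) ≡ length (verts w)
      rev-length = +-cancelʳ-≡ 1 _ _ (begin
        length (verts (rev w)) + 1               ≡⟨ length-++ (verts (rev w)) ⟨
        length (verts (rev w) ++ [ at j ])       ≡⟨ cong length (verts-rev w) ⟩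
        length (reverse (verts w ++ [ at i ]))   ≡⟨ length-reverse (verts w ++ [ at i ]) ⟩
        length (verts w ++ [ at i ])             ≡⟨ length-++ (verts w) ⟩
        length (verts w) + 1                     ∎)
        where open ≡-Reasoning

    between-disjoint : ∀ {lo hi lo′ hi′ v} → hi ≤ top → hi′ ≤ top → hi < lo′ →
      Between lo hi v → Between lo′ hi′ v → ⊥
    between-disjoint h h′ hi<lo′ (x , _ , x≤ , refl) (y , y≥ , y≤ , eq) =
      <⇒≱ hi<lo′ (≤-trans y≥ (≤-trans (≤-reflexive (sym (at-inj (≤-trans x≤ h) (≤-trans y≤ h′) eq))) x≤))

  _#_ : ∀ {a b c d S T} → Ear a b S → Ear c d T → Set
  e # f = ∀ {v} → v ∈ Ear.inner e → v ∈ Ear.inner f → ⊥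

  -- C cut at the two ends of a base ear into two rails from `s` to `t`, which by `cross` meet in
  -- their ends only. The ear itself, which completes the theta graph, is a separate argument of the
  -- lemmas.
  record Theta : Set where
    field
      rail  : Bool → Rail
      {s t} : V
      start : ∀ ρ → Rail.at (rail ρ) 0 ≡ s
      end   : ∀ ρ → Rail.at (rail ρ) (Rail.top (rail ρ)) ≡ t
    at = λ ρ → Rail.at (rail ρ)
    top = λ ρ → Rail.top (rail ρ)
    field
      cross : ∀ ρ {x y} → x ≤ top ρ → y ≤ top (not ρ) → at ρ x ≡ at (not ρ) y →
        (x ≡ 0 × y ≡ 0) ⊎ (x ≡ top ρ × y ≡ top (not ρ))

  backwards : Rail → Rail
  backwards R = record
    { top = top ; at = λ x → at (top ∸ x) ; at-C = λ x → at-C (top ∸ x)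
    ; at-adj = λ {x} x< → let p , q = at-adj {top ∸ suc x} (∸-monoʳ-< (s≤s z≤n) x<) in
        subst (λ z → CAdj (at z) (at (top ∸ suc x)) × CAdj (at (top ∸ suc x)) (at z)) (sym (+-∸-assoc 1 x<)) (q , p)
    ; at-inj = λ {x} {y} p q eq → ∸-cancelˡ-≡ p q (at-inj (m∸n≤m top x) (m∸n≤m top y) eq) }
    where open Rail R

  mirror : Theta → Theta
  mirror Θ = record
    { rail = λ ρ → backwards (rail ρ) ; s = t ; t = s
    ; start = end
    ; end = λ ρ → trans (cong (at ρ) (n∸n≡0 (top ρ))) (start ρ)
    ; cross = λ ρ {x} {y} p q eq → [ (λ (a , b) → inj₂ (zero⇒top p a , zero⇒top q b)) ,
        (λ (a , b) → inj₁ (top⇒zero p a , top⇒zero q b)) ]′ (cross ρ (m∸n≤m (top ρ) x) (m∸n≤m (top (not ρ)) y) eq) }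
    where
    open Theta Θ
    zero⇒top : ∀ {x t} → x ≤ t → t ∸ x ≡ 0 → x ≡ t
    zero⇒top p eq = ≤-antisym p (m∸n≡0⇒m≤n eq)
    top⇒zero : ∀ {x t} → x ≤ t → t ∸ x ≡ t → x ≡ 0
    top⇒zero {x} {t} p eq = ∸-cancelˡ-≡ p (z≤n {t}) eq

  module Cycles (Θ : Theta) where
    open Theta Θ

    apart : ∀ ρ {lo hi lo′ hi′ v} → hi ≤ top ρ → hi′ ≤ top (not ρ) →
      ¬ (lo ≡ 0 × lo′ ≡ 0) → ¬ (hi ≡ top ρ × hi′ ≡ top (not ρ)) →
      Between (rail ρ) lo hi v → Between (rail (not ρ)) lo′ hi′ v → ⊥
    apart ρ h h′ n₀ n₁ (x , x≥ , x≤ , refl) (y , y≥ , y≤ , eq) with cross ρ (≤-trans x≤ h) (≤-trans y≤ h′) eq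
    ... | inj₁ (refl , refl) = n₀ (n≤0⇒n≡0 x≥ , n≤0⇒n≡0 y≥)
    ... | inj₂ (refl , refl) = n₁ (≤-antisym h x≤ , ≤-antisym h′ y≤)

    sep : ∀ ρ {a b c d} i j k l (i≤ : i ≤ top ρ) (j≤ : j ≤ top ρ) (k≤ : k ≤ top ρ) (l≤ : l ≤ top ρ)
      (p : at ρ i ≡ a) (q : at ρ j ≡ b) (p′ : at ρ k ≡ c) (q′ : at ρ l ≡ d) →
      i < k → i < l → j < k → j < l →
      ∀ {v} → Arc.on (arc (rail ρ) i j i≤ j≤ p q) v → Arc.on (arc (rail ρ) k l k≤ l≤ p′ q′) v → ⊥
    sep ρ i j k l i≤ j≤ k≤ l≤ p q p′ q′ ik il jk jl u w = between-disjoint (rail ρ) (⊔-lub i≤ j≤) (⊔-lub k≤ l≤)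
      (⊓-pres-m< (⊔-pres-<m ik jk) (⊔-pres-<m il jl))
      (arc-on (rail ρ) i j i≤ j≤ p q u) (arc-on (rail ρ) k l k≤ l≤ p′ q′ w)

    apart-arcs : ∀ ρ {a b c d} i j k l (i≤ : i ≤ top ρ) (j≤ : j ≤ top ρ) (k≤ : k ≤ top (not ρ)) (l≤ : l ≤ top (not ρ))
      (p : at ρ i ≡ a) (q : at ρ j ≡ b) (p′ : at (not ρ) k ≡ c) (q′ : at (not ρ) l ≡ d) →
      0 < k → 0 < l → (i < top ρ × j < top ρ) ⊎ (k < top (not ρ) × l < top (not ρ)) →
      ∀ {v} → Arc.on (arc (rail ρ) i j i≤ j≤ p q) v → Arc.on (arc (rail (not ρ)) k l k≤ l≤ p′ q′) v → ⊥
    apart-arcs ρ i j k l i≤ j≤ k≤ l≤ p q p′ q′ k>0 l>0 side u w = apart ρ (⊔-lub i≤ j≤) (⊔-lub k≤ l≤)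
      (λ (_ , z) → <⇒≢ (⊓-pres-m< k>0 l>0) (sym z))
      (λ (z , z′) → [ (λ (a , b) → <⇒≢ (⊔-pres-<m a b) z) , (λ (a , b) → <⇒≢ (⊔-pres-<m a b) z′) ]′ side)
      (arc-on (rail ρ) i j i≤ j≤ p q u) (arc-on (rail (not ρ)) k l k≤ l≤ p′ q′ w)

    -- The cycle that avoids the base: along the gap `i`, through `f`, along the gap `k`, and back
    -- through `g`. The arcs add up to the difference of the two spans, which is why spans will
    -- serve as positions. Successive increments avoid subtraction.
    nested : ∀ ρ {a b c d F G} (f : Ear a b F) (g : Ear c d G) g₁ i j k →
      at ρ (g₁ + i) ≡ a → at ρ (g₁ + i + j) ≡ b → at ρ g₁ ≡ c → at ρ (g₁ + i + j + k) ≡ d →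
      0 < j → g₁ + i + j + k ≤ top ρ → f # g →
      Σ (Closed (F ++ G)) λ z → len z ≡ (i + k) + (suc (length (Ear.inner f)) + suc (length (Ear.inner g)))
    nested ρ f g g₁ i j k pa pb pc pd j>0 g₂≤ dis = close₂ ℓ m ℓ⟂m , (begin
      len (close₂ ℓ m ℓ⟂m)                          ≡⟨ len-close₂ ℓ m ℓ⟂m ⟩
      length (verts (Leg.walk ℓ)) + length (verts (Leg.walk m)) ≡⟨ cong₂ _+_ (length-leg α f) (length-leg β g′) ⟩
      length (verts (Arc.walk α)) + suc lf + (length (verts (Arc.walk β)) + suc (length (reverse (Ear.inner g))))
        ≡⟨ cong₂ (λ x y → length (verts (Arc.walk α)) + suc lf + (x + suc y)) β-len (length-reverse (Ear.inner g)) ⟩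
      length (verts (Arc.walk α)) + suc lf + (k + suc lg) ≡⟨ cong (λ x → x + suc lf + (k + suc lg)) α-len ⟩
      i + suc lf + (k + suc lg)                     ≡⟨ shuffle i k lf lg ⟩
      (i + k) + (suc lf + suc lg)                   ∎)
      where
      open ≡-Reasoning
      lf = length (Ear.inner f)
      lg = length (Ear.inner g)
      g′ = revEar g
      f₂≤ = ≤-trans (m≤m+n (g₁ + i + j) k) g₂≤
      f₁≤ = ≤-trans (m≤m+n (g₁ + i) j) f₂≤
      g₁≤ = ≤-trans (m≤m+n g₁ i) f₁≤
      α = arc (rail ρ) g₁ (g₁ + i) g₁≤ f₁≤ pc pa
      β = arc (rail ρ) (g₁ + i + j) (g₁ + i + j + k) f₂≤ g₂≤ pb pd
      ℓ = leg α f
      m = leg β g′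
      f₁<f₂ : g₁ + i < g₁ + i + j
      f₁<f₂ = m<m+n (g₁ + i) j>0
      ℓ⟂m : ℓ ⟂ m
      ℓ⟂m = sep ρ g₁ (g₁ + i) (g₁ + i + j) (g₁ + i + j + k) g₁≤ f₁≤ f₂≤ g₂≤ pc pa pb pd
              (≤-<-trans (m≤m+n g₁ i) f₁<f₂) (≤-<-trans (m≤m+n g₁ i) (<-≤-trans f₁<f₂ (m≤m+n _ k)))
              f₁<f₂ (<-≤-trans f₁<f₂ (m≤m+n _ k))
          , λ p q → dis p (AnyP.reverse⁻ q)
      α-len : length (verts (Arc.walk α)) ≡ i
      α-len = trans (arc-length (rail ρ) g₁ (g₁ + i) g₁≤ f₁≤ pc pa) (trans (m≤n⇒∣m-n∣≡n∸m (m≤m+n g₁ i)) (m+n∸m≡n g₁ i))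
      β-len : length (verts (Arc.walk β)) ≡ k
      β-len = trans (arc-length (rail ρ) (g₁ + i + j) (g₁ + i + j + k) f₂≤ g₂≤ pb pd)
        (trans (m≤n⇒∣m-n∣≡n∸m (m≤m+n (g₁ + i + j) k)) (m+n∸m≡n (g₁ + i + j) k))
      shuffle : ∀ i k a b → i + suc a + (k + suc b) ≡ (i + k) + (suc a + suc b)
      shuffle = solve-∀

    module _ {E} (e : Ear t s E) where

      two-on-rail : ∀ ρ {c d G} (g : Ear c d G) x y → at ρ x ≡ c → at ρ y ≡ d →
        x < y → y ≤ top ρ → g # e → Closed (G ++ E)
      two-on-rail ρ g x y pc pd x<y y≤ dis = close₂
        (leg (arc (rail ρ) 0 x z≤n x≤ (start ρ) pc) g) (leg (arc (rail ρ) y (top ρ) y≤ ≤-refl pd (end ρ)) e)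
        (sep ρ 0 x y (top ρ) z≤n x≤ y≤ ≤-refl (start ρ) pc pd (end ρ)
          (≤-<-trans z≤n x<y) (≤-<-trans z≤n (<-≤-trans x<y y≤)) x<y (<-≤-trans x<y y≤) , dis)
        where
        x≤ = ≤-trans (<⇒≤ x<y) y≤

      two-across : ∀ ρ {c d G} (g : Ear c d G) x y → at ρ x ≡ c → at (not ρ) y ≡ d →
        x < top ρ → 0 < y → y ≤ top (not ρ) → g # e → Closed (G ++ E)
      two-across ρ g x y pc pd x< y>0 y≤ dis = close₂
        (leg (arc (rail ρ) 0 x z≤n (<⇒≤ x<) (start ρ) pc) g)
        (leg (arc (rail (not ρ)) y (top (not ρ)) y≤ ≤-refl pd (end (not ρ))) e)
        (apart-arcs ρ 0 x y (top (not ρ)) z≤n (<⇒≤ x<) y≤ ≤-refl (start ρ) pc pd (end (not ρ))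
          y>0 (<-≤-trans y>0 y≤) (inj₁ (≤-<-trans z≤n x< , x<)) , dis)

      -- The middle arc from `f₂` to `g₁` may run in either direction, because both positions lie
      -- strictly between `f₁` and `g₂`. Disjoint and interleaved chords are therefore one case.
      staggered : ∀ ρ {a b c d F G} (f : Ear a b F) (g : Ear c d G) f₁ f₂ g₁ g₂ →
        at ρ f₁ ≡ a → at ρ f₂ ≡ b → at ρ g₁ ≡ c → at ρ g₂ ≡ d →
        f₁ < f₂ → g₁ < g₂ → f₁ < g₁ → f₂ < g₂ → g₂ ≤ top ρ →
        f # g → f # e → g # e → Closed (F ++ (G ++ E))
      staggered ρ f g f₁ f₂ g₁ g₂ pa pb pc pd f< g< l₁ l₂ g₂≤ fg fe ge = close₃
        (leg (arc (rail ρ) 0 f₁ z≤n f₁≤ (start ρ) pa) f)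
        (leg (arc (rail ρ) f₂ g₁ f₂≤ g₁≤ pb pc) g)
        (leg (arc (rail ρ) g₂ (top ρ) g₂≤ ≤-refl pd (end ρ)) e)
        (sep ρ 0 f₁ f₂ g₁ z≤n f₁≤ f₂≤ g₁≤ (start ρ) pa pb pc (≤-<-trans z≤n f<) (≤-<-trans z≤n l₁) f< l₁ , fg)
        (sep ρ 0 f₁ g₂ (top ρ) z≤n f₁≤ g₂≤ ≤-refl (start ρ) pa pd (end ρ)
          (≤-<-trans z≤n g<) (≤-<-trans z≤n (<-≤-trans g< g₂≤)) (<-trans f< l₂) (<-≤-trans (<-trans f< l₂) g₂≤) , fe)
        (sep ρ f₂ g₁ g₂ (top ρ) f₂≤ g₁≤ g₂≤ ≤-refl pb pc pd (end ρ) l₂ (<-≤-trans l₂ g₂≤) g< (<-≤-trans g< g₂≤) , ge)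
        where
        g₁≤ = ≤-trans (<⇒≤ g<) g₂≤
        f₂≤ = ≤-trans (<⇒≤ l₂) g₂≤
        f₁≤ = ≤-trans (<⇒≤ f<) f₂≤

      -- `f` changes rails and `g` stays on one. The order of `y` and `i` is immaterial as long as
      -- both lie beyond `x`; being below the top, they keep clear of `t`, where the other rail
      -- ends.
      detour : ∀ ρ {a b c d F G} (f : Ear a b F) (g : Ear c d G) i j x y →
        at ρ i ≡ a → at (not ρ) j ≡ b → at ρ x ≡ c → at ρ y ≡ d →
        x < i → x < y → i < top ρ → y < top ρ → 0 < j → j ≤ top (not ρ) →
        f # g → f # e → g # e → Closed (G ++ (F ++ E))
      detour ρ f g i j x y pa pb pc pd xi xy i< y< j>0 j≤ fg fe ge = close₃
        (leg (arc (rail ρ) 0 x z≤n x≤ (start ρ) pc) g)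
        (leg (arc (rail ρ) y i (<⇒≤ y<) (<⇒≤ i<) pd pa) f)
        (leg (arc (rail (not ρ)) j (top (not ρ)) j≤ ≤-refl pb (end (not ρ))) e)
        (sep ρ 0 x y i z≤n x≤ (<⇒≤ y<) (<⇒≤ i<) (start ρ) pc pd pa
          (≤-<-trans z≤n xy) (≤-<-trans z≤n xi) xy xi , λ p q → fg q p)
        (apart-arcs ρ 0 x j (top (not ρ)) z≤n x≤ j≤ ≤-refl (start ρ) pc pb (end (not ρ))
          j>0 (<-≤-trans j>0 j≤) (inj₁ (≤-<-trans z≤n i< , <-trans xi i<)) , ge)
        (apart-arcs ρ y i j (top (not ρ)) (<⇒≤ y<) (<⇒≤ i<) j≤ ≤-refl pd pa pb (end (not ρ))
          j>0 (<-≤-trans j>0 j≤) (inj₁ (y< , i<)) , fe)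
        where
        x≤ = <⇒≤ (<-trans xi i<)

      -- Both ears change rails: the cycle crosses over by `g`, moves along the other rail in
      -- whichever direction is needed, and crosses back by `f` beyond `x`.
      woven : ∀ ρ {a b c d F G} (f : Ear b a F) (g : Ear c d G) i j x y →
        at ρ i ≡ a → at (not ρ) j ≡ b → at ρ x ≡ c → at (not ρ) y ≡ d →
        x < i → i ≤ top ρ → 0 < j → j < top (not ρ) → 0 < y → y < top (not ρ) →
        f # g → f # e → g # e → Closed (G ++ (F ++ E))
      woven ρ f g i j x y pa pb pc pd xi i≤ j>0 j< y>0 y< fg fe ge = close₃
        (leg (arc (rail ρ) 0 x z≤n x≤ (start ρ) pc) g)
        (leg (arc (rail (not ρ)) y j (<⇒≤ y<) (<⇒≤ j<) pd pb) f)
        (leg (arc (rail ρ) i (top ρ) i≤ ≤-refl pa (end ρ)) e)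
        (apart-arcs ρ 0 x y j z≤n x≤ (<⇒≤ y<) (<⇒≤ j<) (start ρ) pc pd pb y>0 j>0 (inj₂ (y< , j<)) , λ p q → fg q p)
        (sep ρ 0 x i (top ρ) z≤n x≤ i≤ ≤-refl (start ρ) pc pa (end ρ)
          (≤-<-trans z≤n xi) (≤-<-trans z≤n (<-≤-trans xi i≤)) xi (<-≤-trans xi i≤) , ge)
        ((λ u w → apart-arcs ρ i (top ρ) y j i≤ ≤-refl (<⇒≤ y<) (<⇒≤ j<) pa (end ρ) pd pb y>0 j>0 (inj₂ (y< , j<)) w u) , fe)
        where
        x≤ = ≤-trans (<⇒≤ xi) i≤

-- Positions on a cycle

module OnCycle {n} {G : Graph n} {m} (C : Cycle G m) where

  L : ℕ
  L = 3 + m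

  record InC (v : Fin n) : Set where
    constructor onC
    field
      place  : Fin L
      place≡ : vtx C place ≡ v

  inC? : ∀ v → Dec (InC v)
  inC? v with FP.any? (λ i → vtx C i FP.≟ v)
  ... | yes (i , eq) = yes (onC i eq)
  ... | no none      = no λ { (onC i eq) → none (i , eq) }

  record CAdj (x y : Fin n) : Set where
    constructor cadj
    field
      adjacent : adj G x y ≡ true
      on-cycle : norm x y ∈ cycleEdges C

  cadj-next : ∀ i → CAdj (vtx C i) (vtx C (cnext i)) × CAdj (vtx C (cnext i)) (vtx C i)
  cadj-next i = cadj (closed C i) here′
              , cadj (trans (Graph.sym G _ _) (closed C i)) (subst (_∈ cycleEdges C) (norm-comm _ _) here′)
    where
    here′ : norm (vtx C i) (vtx C (cnext i)) ∈ cycleEdges C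
    here′ = subst (_∈ cycleEdges C) (cycleEdge≡ C i) (cycleEdge-∈ C i)

  after : Fin L → ℕ → Fin L
  after s zero    = s
  after s (suc j) = cnext (after s j)

  after-pos : ∀ s j → j ≤ L → toℕ (after s j) ≡ toℕ s + j ⊎ toℕ (after s j) + L ≡ toℕ s + j
  after-pos s zero    _  = inj₁ (sym (+-identityʳ _))
  after-pos s (suc j) j≤ with cnext-cases (after s j) | after-pos s j (<⇒≤ j≤)
  ... | inj₁ a       | inj₁ b = inj₁ (trans a (trans (cong suc b) (sym (+-suc _ j))))
  ... | inj₁ a       | inj₂ b = inj₂ (trans (cong (_+ L) a) (trans (cong suc b) (sym (+-suc _ j))))
  ... | inj₂ (a , c) | inj₁ b = inj₂ (trans (cong (_+ L) a) (trans (cong suc (trans (sym c) b)) (sym (+-suc _ j))))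
  ... | inj₂ (a , c) | inj₂ b = ⊥-elim (<⇒≱ (+-mono-<-≤ (FP.toℕ<n s) (s≤s⁻¹ j≤))
          (≤-trans (≤-reflexive (trans (+-comm L (2 + m)) (cong (_+ L) (sym c)))) (≤-reflexive b)))

  after-L : ∀ s → after s L ≡ s
  after-L s with after-pos s L ≤-refl
  ... | inj₁ a = ⊥-elim (<⇒≱ (FP.toℕ<n (after s L)) (≤-trans (m≤n+m L (toℕ s)) (≤-reflexive (sym a))))
  ... | inj₂ a = FP.toℕ-injective (+-cancelʳ-≡ L _ _ a)

  after-injective : ∀ s {i j} → i < L → j < L → after s i ≡ after s j → i ≡ j
  after-injective s {i} {j} i< j< eq with after-pos s i (<⇒≤ i<) | after-pos s j (<⇒≤ j<) | cong toℕ eq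
  ... | inj₁ a | inj₁ b | e = +-cancelˡ-≡ (toℕ s) i j (trans (sym a) (trans e b))
  ... | inj₂ a | inj₂ b | e = +-cancelˡ-≡ (toℕ s) i j (trans (sym a) (trans (cong (_+ L) e) b))
  ... | inj₁ a | inj₂ b | e = ⊥-elim (<⇒≱ j< (≤-trans (m≤n+m L i)
      (≤-reflexive (+-cancelˡ-≡ (toℕ s) _ _ (trans (sym (+-assoc (toℕ s) i L))
        (trans (cong (_+ L) (trans (sym a) e)) b))))))
  ... | inj₂ a | inj₁ b | e = ⊥-elim (<⇒≱ i< (≤-trans (m≤n+m L j)
      (≤-reflexive (+-cancelˡ-≡ (toℕ s) _ _ (trans (sym (+-assoc (toℕ s) j L))
        (trans (cong (_+ L) (trans (sym b) (sym e))) a))))))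

  after-surjective : ∀ s k → ∃[ j ] (j < L × after s j ≡ k)
  after-surjective s k with ≤-total (toℕ s) (toℕ k)
  ... | inj₁ s≤k = toℕ k ∸ toℕ s , j< , FP.toℕ-injective (fits (after-pos s _ (<⇒≤ j<)))
    where
    j< = ≤-<-trans (m∸n≤m (toℕ k) (toℕ s)) (FP.toℕ<n k)
    fits : _ → _
    fits (inj₁ a) = trans a (m+[n∸m]≡n s≤k)
    fits (inj₂ a) = ⊥-elim (<⇒≱ (FP.toℕ<n k) (≤-trans (m≤n+m L _) (≤-reflexive (trans a (m+[n∸m]≡n s≤k)))))
  ... | inj₂ k≤s with toℕ k ≟ toℕ s
  ...   | yes eq = 0 , s≤s z≤n , FP.toℕ-injective (sym eq)
  ...   | no neq = L ∸ (toℕ s ∸ toℕ k) , j< , FP.toℕ-injective (fits (after-pos s _ (<⇒≤ j<)))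
    where
    d = toℕ s ∸ toℕ k
    d≤L : d ≤ L
    d≤L = ≤-trans (m∸n≤m (toℕ s) (toℕ k)) (<⇒≤ (FP.toℕ<n s))
    j< : L ∸ d < L
    j< = ∸-monoʳ-< {L} {d} {0} (m<n⇒0<n∸m (≤∧≢⇒< k≤s neq)) d≤L
    total : toℕ s + (L ∸ d) ≡ toℕ k + L
    total = begin
      toℕ s + (L ∸ d)           ≡⟨ cong (_+ (L ∸ d)) (m+[n∸m]≡n k≤s) ⟨
      toℕ k + d + (L ∸ d)       ≡⟨ +-assoc (toℕ k) d _ ⟩
      toℕ k + (d + (L ∸ d))     ≡⟨ cong (toℕ k +_) (m+[n∸m]≡n d≤L) ⟩
      toℕ k + L                 ∎
      where open ≡-Reasoning
    fits : _ → _
    fits (inj₁ a) = ⊥-elim (<⇒≱ (FP.toℕ<n (after s (L ∸ d))) (≤-trans (m≤n+m L (toℕ k)) (≤-reflexive (sym (trans a total)))))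
    fits (inj₂ a) = +-cancelʳ-≡ L _ _ (trans a total)

  module Rails (NR : Fin n → Set) (π : Fin n → Fin n) where

    open Thetas InC CAdj NR π public

    point : Fin L → ℕ → Fin n
    point s j = vtx C (after s j)

    point-injective : ∀ s {i j} → i < L → j < L → point s i ≡ point s j → i ≡ j
    point-injective s i< j< eq = after-injective s i< j< (distinct C eq)

    line : Fin L → ∀ T → T < L → Rail
    line s T T< = record
      { top = T ; at = point s ; at-C = λ x → onC (after s x) refl
      ; at-adj = λ {x} _ → cadj-next (after s x)
      ; at-inj = λ i≤ j≤ → point-injective s (≤-<-trans i≤ T<) (≤-<-trans j≤ T<) }

    module _ (s : Fin L) (T : ℕ) (0<T : 0 < T) (T<L : T < L) where

      back-adj : ∀ {x} → x < L ∸ T → CAdj (point s (L ∸ x)) (point s (L ∸ suc x)) × CAdj (point s (L ∸ suc x)) (point s (L ∸ x))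
      back-adj {x} x< = subst (λ z → CAdj (point s z) (point s (L ∸ suc x)) × CAdj (point s (L ∸ suc x)) (point s z))
        (sym (+-∸-assoc 1 {2 + m} {x} (s≤s⁻¹ (<-≤-trans x< (m∸n≤m L T)))))
        (let p , q = cadj-next (after s (L ∸ suc x)) in q , p)

      back-inj : ∀ {x y} → x ≤ L ∸ T → y ≤ L ∸ T → point s (L ∸ x) ≡ point s (L ∸ y) → x ≡ y
      back-inj {zero}  {zero}  _ _ _ = refl
      back-inj {suc x} {suc y} p q eq = ∸-cancelˡ-≡ (≤-trans p (m∸n≤m L T)) (≤-trans q (m∸n≤m L T))
        (point-injective s (∸-monoʳ-< {L} {suc x} {0} (s≤s z≤n) (≤-trans p (m∸n≤m L T)))
          (∸-monoʳ-< {L} {suc y} {0} (s≤s z≤n) (≤-trans q (m∸n≤m L T))) eq)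
      back-inj {zero}  {suc y} p q eq = ⊥-elim (start-only y q (sym (trans (cong (vtx C) (sym (after-L s))) eq)))
        where
        start-only : ∀ y → suc y ≤ L ∸ T → point s (L ∸ suc y) ≡ vtx C s → ⊥
        start-only y q eq = <⇒≢ (<-≤-trans 0<T (≤-trans (≤-reflexive (sym (m∸[m∸n]≡n (<⇒≤ T<L)))) (∸-monoʳ-≤ L q)))
          (sym (point-injective s (∸-monoʳ-< {L} {suc y} {0} (s≤s z≤n) (≤-trans q (m∸n≤m L T))) (s≤s z≤n) eq))
      back-inj {suc x} {zero} p q eq = sym (back-inj {zero} {suc x} q p (sym eq))

      -- The base chord joins the positions 0 and `T`. One rail runs forwards, the other backwards
      -- from position `L`, which is position 0 again.
      theta : Theta
      theta = record
        { rail = λ { true → line s T T<L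
                   ; false → record { top = L ∸ T ; at = λ x → point s (L ∸ x) ; at-C = λ x → onC (after s (L ∸ x)) refl
                                    ; at-adj = back-adj ; at-inj = back-inj } }
        ; s = vtx C s ; t = point s T
        ; start = λ { true → refl ; false → cong (vtx C) (after-L s) }
        ; end = λ { true → refl ; false → cong (point s) (m∸[m∸n]≡n (<⇒≤ T<L)) }
        ; cross = λ { true p q eq → meet p q eq
                    ; false p q eq → [ (λ (a , b) → inj₁ (b , a)) , (λ (a , b) → inj₂ (b , a)) ]′ (meet q p (sym eq)) } }
        where
        meet : ∀ {x y} → x ≤ T → y ≤ L ∸ T → point s x ≡ point s (L ∸ y) → (x ≡ 0 × y ≡ 0) ⊎ (x ≡ T × y ≡ L ∸ T)
        meet {x} {zero} x≤ _ eq = inj₁ (point-injective s (≤-<-trans x≤ T<L) (s≤s z≤n)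
          (trans eq (cong (vtx C) (after-L s))) , refl)
        meet {x} {suc y} x≤ y≤ eq = inj₂ (x≡T , ≤-antisym y≤ (≤-trans (∸-monoʳ-≤ L L∸y≤T) (≤-reflexive (m∸[m∸n]≡n y≤L))))
          where
          y≤L = ≤-trans y≤ (m∸n≤m L T)
          x≡ : x ≡ L ∸ suc y
          x≡ = point-injective s (≤-<-trans x≤ T<L) (∸-monoʳ-< {L} {suc y} {0} (s≤s z≤n) y≤L) eq
          T≤ : T ≤ L ∸ suc y
          T≤ = ≤-trans (≤-reflexive (sym (m∸[m∸n]≡n (<⇒≤ T<L)))) (∸-monoʳ-≤ L y≤)
          x≡T = ≤-antisym x≤ (≤-trans T≤ (≤-reflexive (sym x≡)))
          L∸y≤T : L ∸ suc y ≤ T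
          L∸y≤T = ≤-trans (≤-reflexive (sym x≡)) x≤

      -- The two endpoints of the chord count as points of the first rail.
      locate : ∀ {v} → InC v → (∃[ x ] (x ≤ T × Theta.at theta true x ≡ v))
                             ⊎ (∃[ x ] (0 < x × x < L ∸ T × Theta.at theta false x ≡ v))
      locate (onC k refl) with after-surjective s k
      ... | j , j< , refl with j ≤? T
      ...   | yes j≤T = inj₁ (j , j≤T , refl)
      ...   | no  j≰T = inj₂ (L ∸ j , m<n⇒0<n∸m j< , ∸-monoʳ-< (≰⇒> j≰T) (<⇒≤ j<) , cong (point s) (m∸[m∸n]≡n (<⇒≤ j<)))

-- The tree edges of a closed walk

lookup-injective : ∀ {A : Set} {xs : List A} → Unique xs → ∀ {i j} → lookup xs i ≡ lookup xs j → i ≡ j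
lookup-injective (_ ∷ _)   {F.zero}  {F.zero}  _  = refl
lookup-injective (x∉ ∷ _)  {F.zero}  {F.suc j} eq = ⊥-elim (All.lookup x∉ (∈-lookup j) eq)
lookup-injective (x∉ ∷ _)  {F.suc i} {F.zero}  eq = ⊥-elim (All.lookup x∉ (∈-lookup i) (sym eq))
lookup-injective (_ ∷ u)   {F.suc i} {F.suc j} eq = cong F.suc (lookup-injective u eq)

module ToCycles {n} (G : Graph n) (InC : Fin n → Set) (CAdj : Fin n → Fin n → Set) (NR : Fin n → Set) (π : Fin n → Fin n)
  (step-adj : ∀ {x y} → Walks.Step InC CAdj NR π x y → adj G x y ≡ true) where

  open Walks InC CAdj NR π

  nxt : ∀ {x y} (p : Walk x y) → Fin (length (verts p)) → Fin n
  nxt (_▸_ {y = y} s p) F.zero    = y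
  nxt (s ▸ p)           (F.suc i) = nxt p i

  stepAt : ∀ {x y} (p : Walk x y) i → Step (lookup (verts p) i) (nxt p i)
  stepAt (s ▸ p) F.zero    = s
  stepAt (s ▸ p) (F.suc i) = stepAt p i

  first : ∀ {x y} (p : Walk x y) i → toℕ i ≡ 0 → lookup (verts p) i ≡ x
  first (s ▸ p) F.zero _ = refl

  nxt-inner : ∀ {x y} (p : Walk x y) i j → toℕ j ≡ suc (toℕ i) → nxt p i ≡ lookup (verts p) j
  nxt-inner (s ▸ p) F.zero    (F.suc j) eq = sym (first p j (suc-injective eq))
  nxt-inner (s ▸ p) (F.suc i) (F.suc j) eq = nxt-inner p i j (suc-injective eq)

  nxt-last : ∀ {x y} (p : Walk x y) i → suc (toℕ i) ≡ length (verts p) → nxt p i ≡ y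
  nxt-last (s ▸ ∅)           F.zero    eq = refl
  nxt-last (s ▸ p@(_ ▸ _))   (F.suc i) eq = nxt-last p i (suc-injective eq)

  labels-at : ∀ {x y h} (p : Walk x y) → h ∈ labels p → ∃[ i ] h ∈ label (stepAt p i)
  labels-at (s ▸ p) h∈ with ∈-++⁻ (label s) h∈
  ... | inj₁ q = F.zero , q
  ... | inj₂ q = let i , r = labels-at p q in F.suc i , r

  at-labels : ∀ {x y h} (p : Walk x y) i → h ∈ label (stepAt p i) → h ∈ labels p
  at-labels (s ▸ p) F.zero    h∈ = ∈-++⁺ˡ h∈
  at-labels (s ▸ p) (F.suc i) h∈ = ∈-++⁺ʳ (label s) (at-labels p i h∈)

  module ToCycle {x} (p : Walk x x) {k} (len≡ : 3 + k ≡ length (verts p)) (u : Unique (verts p)) where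

    nxt-cnext : ∀ i → nxt p (cast len≡ i) ≡ lookup (verts p) (cast len≡ (cnext i))
    nxt-cnext i with cnext-cases i
    ... | inj₁ eq = nxt-inner p _ _ (trans (FP.toℕ-cast len≡ (cnext i)) (trans eq (cong suc (sym (FP.toℕ-cast len≡ i)))))
    ... | inj₂ (eq , last) = trans
      (nxt-last p _ (trans (cong suc (trans (FP.toℕ-cast len≡ i) last)) len≡))
      (sym (first p _ (trans (FP.toℕ-cast len≡ (cnext i)) eq)))

    w : Fin (3 + k) → Fin n
    w i = lookup (verts p) (cast len≡ i)

    w-injective : ∀ {i j} → w i ≡ w j → i ≡ j
    w-injective {i} {j} eq = FP.toℕ-injective (begin
      toℕ i              ≡⟨ FP.toℕ-cast len≡ i ⟨
      toℕ (cast len≡ i)  ≡⟨ cong toℕ (lookup-injective u eq) ⟩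
      toℕ (cast len≡ j)  ≡⟨ FP.toℕ-cast len≡ j ⟩
      toℕ j              ∎)
      where open ≡-Reasoning

    w-adj : ∀ i → adj G (w i) (w (cnext i)) ≡ true
    w-adj i = subst (λ z → adj G (w i) z ≡ true) (nxt-cnext i) (step-adj (stepAt p (cast len≡ i)))

    cycle : Cycle G k
    cycle = record { vtx = w ; distinct = w-injective ; closed = w-adj }

    edge≡ : ∀ i → cycleEdge cycle i ≡ norm (w i) (nxt p (cast len≡ i))
    edge≡ i = trans (cycleEdge≡ cycle i) (cong (norm (w i)) (sym (nxt-cnext i)))

    cast⁻¹ : ∀ j → cast len≡ (cast (sym len≡) j) ≡ j
    cast⁻¹ j = FP.toℕ-injective (trans (FP.toℕ-cast len≡ _) (FP.toℕ-cast (sym len≡) j))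

    step-∈ : ∀ j → norm (lookup (verts p) j) (nxt p j) ∈ cycleEdges cycle
    step-∈ j = subst (_∈ cycleEdges cycle)
      (trans (edge≡ _) (cong (λ j → norm (lookup (verts p) j) (nxt p j)) (cast⁻¹ j)))
      (cycleEdge-∈ cycle (cast (sym len≡) j))

    ∈-step : ∀ {e} → e ∈ cycleEdges cycle → ∃[ j ] e ≡ norm (lookup (verts p) j) (nxt p j)
    ∈-step e∈ with ∈-cycleEdges⁻ cycle e∈
    ... | i , eq = cast len≡ i , trans eq (edge≡ i)

module Signatures {n} (G : Graph n) {m} (C : Cycle G m)
  (NR : Fin n → Set) (π : Fin n → Fin n) (rank : Fin n → ℕ)
  (rank-π : ∀ {x} → NR x → rank (π x) < rank x)
  (π-adj : ∀ {x} → NR x → adj G x (π x) ≡ true)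
  (π-chord : ∀ {x} → NR x → norm x (π x) ∉ cycleEdges C) where

  open OnCycle C using (InC; CAdj; cadj)
  open Walks InC CAdj NR π

  -- If an edge were the parent edge of both its ends, each end would have smaller rank than the
  -- other.
  π-norm-injective : ∀ {f g} → NR f → NR g → norm f (π f) ≡ norm g (π g) → f ≡ g
  π-norm-injective {f} {g} nf ng eq with norm-≡ eq
  ... | inj₁ (p , _) = p
  ... | inj₂ (p , q) = ⊥-elim (<-asym
    (subst (λ z → rank z < rank f) q (rank-π nf)) (subst (λ z → rank z < rank g) (sym p) (rank-π ng)))

  step-adj : ∀ {x y} → Step x y → adj G x y ≡ true
  step-adj (along (cadj a _) _) = a
  step-adj (up nr refl)      = π-adj nr
  step-adj (down nr refl)    = trans (Graph.sym G _ _) (π-adj nr)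

  step-label : ∀ {x y h} (s : Step x y) → NR h → norm x y ≡ norm h (π h) → h ∈ label s
  step-label (along (cadj _ c) _) nh eq = ⊥-elim (π-chord nh (subst (_∈ cycleEdges C) eq c))
  step-label (up nr refl)      nh eq = here (sym (π-norm-injective nr nh eq))
  step-label (down nr refl)    nh eq = here (sym (π-norm-injective nr nh (trans (norm-comm _ _) eq)))

  label-step : ∀ {x y h} (s : Step x y) → h ∈ label s → NR h × norm x y ≡ norm h (π h)
  label-step (up nr refl)   (here refl) = nr , refl
  label-step (down nr refl) (here refl) = nr , norm-comm _ _

  open ToCycles G InC CAdj NR π step-adj

  module Labels {x} (p : Walk x x) {k} (len≡ : 3 + k ≡ length (verts p)) (u : Unique (verts p)) where

    open ToCycle p len≡ u public

    label⇒edge : ∀ {h} → h ∈ labels p → NR h × norm h (π h) ∈ cycleEdges cycle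
    label⇒edge h∈ with labels-at p h∈
    ... | j , q = let nh , eq = label-step (stepAt p j) q in nh , subst (_∈ cycleEdges cycle) eq (step-∈ j)

    edge⇒label : ∀ {h} → NR h → norm h (π h) ∈ cycleEdges cycle → h ∈ labels p
    edge⇒label nh e∈ with ∈-step e∈
    ... | j , eq = at-labels p j (step-label (stepAt p j) nh (sym eq))

  len≤n : ∀ {S} (c : Closed S) → len c ≤ n
  len≤n c = subst (len c ≤_) (length-tabulate id) (length-⊆ (Closed.uniq c) (λ _ → ∈-allFin _))

  -- A closed walk on two vertices uses one edge twice, and one edge carries only one label.
  len≥3 : ∀ {S} (c : Closed S) {f g} → f ∈ S → g ∈ S → f ≢ g → 3 ≤ len c
  len≥3 (mkClosed ∅ _ s) f∈ _ _ with sig⁺ s f∈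
  ... | ()
  len≥3 (mkClosed (s ▸ ∅) _ _) _ _ _ = ⊥-elim (adj⇒≢ G (step-adj s) refl)
  len≥3 (mkClosed (_▸_ {x} {y} s (t ▸ ∅)) _ sg) {f} {g} f∈ g∈ f≢g =
    let nf , ef = on-edge (sig⁺ sg f∈) ; ng , eg = on-edge (sig⁺ sg g∈)
    in ⊥-elim (f≢g (π-norm-injective nf ng (trans (sym ef) eg)))
    where
    on-edge : ∀ {h} → h ∈ label s ++ (label t ++ []) → NR h × norm x y ≡ norm h (π h)
    on-edge h∈ with ∈-++⁻ (label s) h∈
    ... | inj₁ q = label-step s q
    ... | inj₂ q with ∈-++⁻ (label t) q
    ...   | inj₁ r = let nh , eq = label-step t r in nh , trans (norm-comm x y) eq
  len≥3 (mkClosed (_ ▸ (_ ▸ (_ ▸ _))) _ _) _ _ _ = s≤s (s≤s (s≤s z≤n))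

  -- Equal length forces equal edge sets. A tree edge is never an edge of C and determines its lower
  -- end, so the edge set determines the labels. Closed walks with different signatures thus have
  -- different lengths.
  same-signature : DistinctCycleLengths G → ∀ {S T} (c : Closed S) (d : Closed T) → 3 ≤ len c → len c ≡ len d →
    ∀ {h} → InC h → h ∈ S → h ∈ T
  same-signature D c d len≥ eq {h} ih h∈ with m≤n⇒∃[o]m+o≡n len≥
  ... | k , len≡ = sig⁻ (Closed.sgn d) ih (Q.edge⇒label nh (CycleEdge⇒∈ Q.cycle
        (Equivalence.to (D k P.cycle Q.cycle h (π h)) (∈⇒CycleEdge P.cycle e∈))))
    where
    module P = Labels (Closed.walk c) len≡ (Closed.uniq c)
    module Q = Labels (Closed.walk d) (trans len≡ eq) (Closed.uniq d)
    nh = proj₁ (P.label⇒edge (sig⁺ (Closed.sgn c) h∈))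
    e∈ = proj₂ (P.label⇒edge (sig⁺ (Closed.sgn c) h∈))

-- Climbing in the forest

module Climbs {V : Set} (InC : V → Set) (CAdj : V → V → Set) (NR : V → Set) (π : V → V)
  (rank : V → ℕ) (rank-π : ∀ {x} → NR x → rank (π x) < rank x) where

  open Walks InC CAdj NR π

  data Climb : V → V → Set where
    stop : ∀ {x} → Climb x x
    step : ∀ {x y} → NR x → Climb (π x) y → Climb x y

  below : ∀ {x y} → Climb x y → List V
  below stop             = []
  below (step {x} _ c)   = x ∷ below c

  climb-rank : ∀ {x y} → Climb x y → rank y ≤ rank x
  climb-rank stop        = ≤-refl
  climb-rank (step nr c) = ≤-trans (climb-rank c) (<⇒≤ (rank-π nr))

  below-rank : ∀ {x y z} (c : Climb x y) → z ∈ below c → rank y < rank z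
  below-rank (step nr c) (here refl) = ≤-<-trans (climb-rank c) (rank-π nr)
  below-rank (step nr c) (there z∈)  = below-rank c z∈

  below-start : ∀ {x y z} (c : Climb x y) → z ∈ below c → z ≡ x ⊎ rank z < rank x
  below-start (step nr c) (here refl) = inj₁ refl
  below-start (step nr c) (there z∈) with below-start c z∈
  ... | inj₁ refl = inj₂ (rank-π nr)
  ... | inj₂ lt   = inj₂ (<-trans lt (rank-π nr))

  below-≤ : ∀ {x y z} (c : Climb x y) → z ∈ below c → rank z ≤ rank x
  below-≤ c z∈ = [ (λ { refl → ≤-refl }) , <⇒≤ ]′ (below-start c z∈)

  below-unique : ∀ {x y} (c : Climb x y) → Unique (below c)
  below-unique stop        = []
  below-unique (step nr c) = All.tabulate (λ { z∈ refl → <⇒≱ (rank-π nr) (below-≤ c z∈) }) ∷ below-unique c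

  concat-climb : ∀ {x y z} → Climb x y → Climb y z → Climb x z
  concat-climb stop        d = d
  concat-climb (step nr c) d = step nr (concat-climb c d)

  below-concat : ∀ {x y z} (c : Climb x y) (d : Climb y z) → below (concat-climb c d) ≡ below c ++ below d
  below-concat stop        d = refl
  below-concat (step nr c) d = cong (_ ∷_) (below-concat c d)

  record Split {x y} (c : Climb x y) (w : V) : Set where
    field
      lower  : Climb x w
      upper  : Climb w y
      below≡ : below c ≡ below lower ++ below upper
      w∈     : w ∈ below upper
    lower⊆ : ∀ {z} → z ∈ below lower → z ∈ below c
    lower⊆ z∈ = subst (_ ∈_) (sym below≡) (∈-++⁺ˡ z∈)
    upper⊆ : ∀ {z} → z ∈ below upper → z ∈ below c
    upper⊆ z∈ = subst (_ ∈_) (sym below≡) (∈-++⁺ʳ (below lower) z∈)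
    lower⊎upper : ∀ {z} → z ∈ below c → z ∈ below lower ⊎ z ∈ below upper
    lower⊎upper z∈ = ∈-++⁻ (below lower) (subst (_ ∈_) below≡ z∈)

  split-first : ∀ {P : V → Set} (P? : ∀ z → Dec (P z)) {x y} (c : Climb x y) →
    (∀ {z} → z ∈ below c → ¬ P z) ⊎
    (∃[ w ] (P w × Σ (Split c w) λ s → ∀ {z} → z ∈ below (Split.lower s) → ¬ P z))
  split-first P? stop = inj₁ λ ()
  split-first P? (step {x} nr c) with P? x
  ... | yes px = inj₂ (x , px , record { lower = stop ; upper = step nr c ; below≡ = refl ; w∈ = here refl } , λ ())
  ... | no ¬px with split-first P? c
  ...   | inj₁ none = inj₁ λ { (here refl) → ¬px ; (there z∈) → none z∈ }
  ...   | inj₂ (w , pw , s , free) = inj₂ (w , pw ,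
    record { lower = step nr (Split.lower s) ; upper = Split.upper s
           ; below≡ = cong (x ∷_) (Split.below≡ s) ; w∈ = Split.w∈ s } ,
    λ { (here refl) → ¬px ; (there z∈) → free z∈ })

  split-at : ∀ {x y w} (c : Climb x y) → w ∈ below c → Split c w
  split-at (step nr c) (here refl) = record { lower = stop ; upper = step nr c ; below≡ = refl ; w∈ = here refl }
  split-at (step nr c) (there w∈) = record { lower = step nr (Split.lower s) ; upper = Split.upper s
    ; below≡ = cong (_ ∷_) (Split.below≡ s) ; w∈ = Split.w∈ s }
    where s = split-at c w∈

  ascend : ∀ {x y} → Climb x y → Walk x y
  ascend stop        = ∅
  ascend (step nr c) = up nr refl ▸ ascend c

  verts-ascend : ∀ {x y} (c : Climb x y) → verts (ascend c) ≡ below c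
  verts-ascend stop        = refl
  verts-ascend (step nr c) = cong (_ ∷_) (verts-ascend c)

  labels-ascend : ∀ {x y} (c : Climb x y) → labels (ascend c) ≡ below c
  labels-ascend stop        = refl
  labels-ascend (step nr c) = cong (_ ∷_) (labels-ascend c)

  ascend-signed : ∀ {f y} (nf : NR f) (c : Climb (π f) y) → (∀ {z} → z ∈ below c → ¬ InC z) →
    Signed (ascend (step nf c)) [ f ]
  ascend-signed {f} nf c out = signed (λ { (here refl) → here refl })
    (λ { i (here refl) → here refl ; i (there h∈) → ⊥-elim (out (subst (_ ∈_) (labels-ascend c) h∈) i) })

  upEar : ∀ {f y} (nf : NR f) (c : Climb (π f) y) → (∀ {z} → z ∈ below c → ¬ InC z) → Ear f y [ f ]
  upEar nf c out = record
    { walk = ascend (step nf c) ; inner = below c ; verts≡ = cong (_ ∷_) (verts-ascend c)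
    ; uniq = below-unique c ; outer = out ; sgn = ascend-signed nf c out }

  meet : ∀ {f g w} (nf : NR f) (ng : NR g) (c : Climb (π f) w) (d : Climb (π g) w) →
    (∀ {z} → z ∈ below c → ¬ InC z) → (∀ {z} → z ∈ below d → ¬ InC z) → ¬ InC w →
    (∀ {z} → z ∈ below c → z ∈ below d → ⊥) → Ear f g (f ∷ g ∷ [])
  meet {f} {g} {w} nf ng c d oc od ow dis = record
    { walk = ascend (step nf c) ⊕ rev (ascend (step ng d))
    ; inner = below c ++ w ∷ reverse (below d)
    ; verts≡ = trans (verts-⊕ (ascend (step nf c)) _) (cong₂ _++_ (cong (f ∷_) (verts-ascend c))
        (verts-rev-inner (ascend (step ng d)) (cong (g ∷_) (verts-ascend d))))
    ; uniq = Unique-++ (below-unique c)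
        (All.tabulate (λ { z∈ refl → <-irrefl refl (below-rank d (AnyP.reverse⁻ z∈)) }) ∷ Unique-reverse (below-unique d))
        (λ { z∈ (here refl) → <-irrefl refl (below-rank c z∈) ; z∈ (there z∈′) → dis z∈ (AnyP.reverse⁻ z∈′) })
    ; outer = λ z∈ → [ oc , (λ { (here refl) → ow ; (there z∈′) → od (AnyP.reverse⁻ z∈′) }) ]′ (∈-++⁻ (below c) z∈)
    ; sgn = signed-⊕ (ascend-signed nf c oc) (signed-rev (ascend-signed ng d od)) }

  meet-inner : ∀ {f g w} (nf : NR f) (ng : NR g) (c : Climb (π f) w) (d : Climb (π g) w)
    (oc : ∀ {z} → z ∈ below c → ¬ InC z) (od : ∀ {z} → z ∈ below d → ¬ InC z) (ow : ¬ InC w)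
    (dis : ∀ {z} → z ∈ below c → z ∈ below d → ⊥) {z} →
    z ∈ Ear.inner (meet nf ng c d oc od ow dis) → z ∈ below c ⊎ z ≡ w ⊎ z ∈ below d
  meet-inner nf ng c d oc od ow dis z∈ with ∈-++⁻ (below c) z∈
  ... | inj₁ p           = inj₁ p
  ... | inj₂ (here eq)   = inj₂ (inj₁ eq)
  ... | inj₂ (there p)   = inj₂ (inj₂ (AnyP.reverse⁻ p))

  module _ (Tree : V → Set) (tree-π : ∀ {v} → Tree v → NR v → Tree (π v))
    (tree-NR : ∀ {v} → Tree v → ¬ InC v → NR v)
    {D : V → Set} (D? : ∀ v → Dec (D v)) (C⊆D : ∀ {v} → InC v → D v) where

    -- In a tree rooted on C every vertex off C has a parent, so the climb cannot get stuck before
    -- it meets `D`; the rank bounds its length.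
    first-hit : ∀ v → Tree v → ∃[ y ] (D y × Σ (Climb v y) λ c → ∀ {z} → z ∈ below c → ¬ D z)
    first-hit v tv = go v tv (<-wellFounded (rank v))
      where
      go : ∀ v → Tree v → Acc _<_ (rank v) → ∃[ y ] (D y × Σ (Climb v y) λ c → ∀ {z} → z ∈ below c → ¬ D z)
      go v tv (acc rs) with D? v
      ... | yes d = v , d , stop , λ ()
      ... | no ¬d = let nv = tree-NR tv (¬d ∘ C⊆D)
                        y , dy , c , free = go (π v) (tree-π tv nv) (rs (rank-π nv))
                    in y , dy , step nv c , λ { (here refl) → ¬d ; (there z∈) → free z∈ }

-- Pairs of chords against a fixed chord

sub₃ : ∀ {A : Set} {a b c : A} {xs} → a ∈ xs → b ∈ xs → c ∈ xs → ∀ {h} → h ∈ a ∷ b ∷ c ∷ [] → h ∈ xs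
sub₃ p q r (here refl)                 = p
sub₃ p q r (there (here refl))         = q
sub₃ p q r (there (there (here refl))) = r

sub₂ : ∀ {A : Set} {a b : A} {xs} → a ∈ xs → b ∈ xs → ∀ {h} → h ∈ a ∷ b ∷ [] → h ∈ xs
sub₂ p q (here refl)         = p
sub₂ p q (there (here refl)) = q

module _ {A : Set} {a : A} where
  0th : ∀ {xs} → a ∈ a ∷ xs
  0th = here refl
  1st : ∀ {b xs} → a ∈ b ∷ a ∷ xs
  1st = there (here refl)
  2nd : ∀ {b c xs} → a ∈ b ∷ c ∷ a ∷ xs
  2nd = there (there (here refl))

module Keys {n} {G : Graph n} {m} (C : Cycle G m) (NR : Fin n → Set) (π : Fin n → Fin n)
  (rank : Fin n → ℕ) (rank-π : ∀ {x} → NR x → rank (π x) < rank x) (Tree : Fin n → Set)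
  (tree-π : ∀ {v} → Tree v → NR v → Tree (π v)) (tree-C : ∀ {v} → OnCycle.InC C v → Tree v)
  (tree-NR : ∀ {v} → Tree v → ¬ OnCycle.InC C v → NR v) (w : ℕ) where

  open OnCycle C
  open Rails NR π
  open Walks InC CAdj NR π
  open Climbs InC CAdj NR π rank rank-π

  private
    V = Fin n
    variable
      a b c d x y z u : V
      S S′ : List V

  Turned : V → V → V → V → Set
  Turned x y a b = (a ≡ x × b ≡ y) ⊎ (a ≡ y × b ≡ x)

  turn : Turned x y a b → Ear x y S → Ear a b S
  turn (inj₁ (refl , refl)) e = e
  turn (inj₂ (refl , refl)) e = revEar e

  turn-inner : ∀ (o : Turned x y a b) (e : Ear x y S) {v} → v ∈ Ear.inner (turn o e) → v ∈ Ear.inner e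
  turn-inner (inj₁ (refl , refl)) e v∈ = v∈
  turn-inner (inj₂ (refl , refl)) e v∈ = AnyP.reverse⁻ v∈

  turn-length : ∀ (o : Turned x y a b) (e : Ear x y S) → length (Ear.inner (turn o e)) ≡ length (Ear.inner e)
  turn-length (inj₁ (refl , refl)) e = refl
  turn-length (inj₂ (refl , refl)) e = length-reverse (Ear.inner e)

  turned-sym : Turned x y a b → Turned y x a b
  turned-sym (inj₁ p) = inj₂ p
  turned-sym (inj₂ p) = inj₁ p

  module OnTheta (s : Fin L) (T : ℕ) (0<T : 0 < T) (T<L : T < L) where

    Θ = theta s T 0<T T<L
    open Theta Θ using (at; top; rail; start; end)

    -- `Turned` orients the chord so that the lower position, or the end on the first rail, comes
    -- first. A chord with an end in common with the base chord counts as lying on a rail, so the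
    -- ends in `across` are interior to their rails.
    data Placed (x y : V) : Set where
      onRail : ∀ ρ {a b} → Turned x y a b → ∀ i j → at ρ i ≡ a → at ρ j ≡ b → i < j → j ≤ top ρ → Placed x y
      across : ∀ {a b} → Turned x y a b → ∀ i j → at true i ≡ a → at false j ≡ b →
        0 < i → i < T → 0 < j → j < L ∸ T → Placed x y

    same-rail : ∀ ρ → x ≢ y → ∀ i j → at ρ i ≡ x → at ρ j ≡ y → i ≤ top ρ → j ≤ top ρ → Placed x y
    same-rail ρ x≢y i j p q i≤ j≤ with <-cmp i j
    ... | tri< i<j _ _ = onRail ρ (inj₁ (refl , refl)) i j p q i<j j≤
    ... | tri≈ _ refl _ = ⊥-elim (x≢y (trans (sym p) q))
    ... | tri> _ _ j<i = onRail ρ (inj₂ (refl , refl)) j i q p j<i i≤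

    different-rails : ∀ i j → at true i ≡ x → at false j ≡ y → i ≤ T → 0 < j → j < L ∸ T → x ≢ y → Placed x y
    different-rails zero    j p q _  0<j j< x≢y = same-rail false x≢y 0 j (trans (trans (start false) (sym (start true))) p) q z≤n (<⇒≤ j<)
    different-rails (suc i) j p q i≤ 0<j j< x≢y with suc i <? T
    ... | yes i<T = across (inj₁ (refl , refl)) (suc i) j p q (s≤s z≤n) i<T 0<j j<
    ... | no  i≮T with ≤-antisym i≤ (≮⇒≥ i≮T)
    ...   | refl = same-rail false x≢y (L ∸ T) j (trans (trans (end false) (sym (end true))) p) q ≤-refl (<⇒≤ j<)

    swap-placed : Placed x y → Placed y x
    swap-placed (onRail ρ o i j p q i< j≤)      = onRail ρ (turned-sym o) i j p q i< j≤
    swap-placed (across o i j p q i₁ i₂ j₁ j₂) = across (turned-sym o) i j p q i₁ i₂ j₁ j₂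

    place : InC x → InC y → x ≢ y → Placed x y
    place cx cy x≢y with locate s T 0<T T<L cx | locate s T 0<T T<L cy
    ... | inj₁ (i , i≤ , p)       | inj₁ (j , j≤ , q)       = same-rail true x≢y i j p q i≤ j≤
    ... | inj₂ (i , _ , i< , p)   | inj₂ (j , _ , j< , q)   = same-rail false x≢y i j p q (<⇒≤ i<) (<⇒≤ j<)
    ... | inj₁ (i , i≤ , p)       | inj₂ (j , 0<j , j< , q) = different-rails i j p q i≤ 0<j j< x≢y
    ... | inj₂ (i , 0<i , i< , p) | inj₁ (j , j≤ , q)       = swap-placed (different-rails j i q p j≤ 0<i i< (x≢y ∘ sym))

    open Cycles

    inside : ∀ ρ {F G} (f : Ear a b F) (g : Ear c d G) f₁ f₂ g₁ g₂ →
      at ρ f₁ ≡ a → at ρ f₂ ≡ b → at ρ g₁ ≡ c → at ρ g₂ ≡ d →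
      f₁ < f₂ → g₂ ≤ top ρ → g₁ ≤ f₁ → f₂ ≤ g₂ → f # g →
      Σ (Closed (F ++ G)) λ z → len z ≡ ∣ (f₂ ∸ f₁) - (g₂ ∸ g₁) ∣ + (suc (length (Ear.inner f)) + suc (length (Ear.inner g)))
    inside ρ f g f₁ f₂ g₁ g₂ pa pb pc pd f< g≤ l₁ l₂ fg
      with m≤n⇒∃[o]m+o≡n l₁ | m≤n⇒∃[o]m+o≡n (<⇒≤ f<) | m≤n⇒∃[o]m+o≡n l₂
    ... | i , refl | j , refl | k , refl with nested Θ ρ f g g₁ i j k pa pb pc pd (pos f<) g≤ fg
      where
      pos : g₁ + i < g₁ + i + j → 0 < j
      pos lt = +-cancelˡ-< (g₁ + i) 0 j (subst (_< g₁ + i + j) (sym (+-identityʳ _)) lt)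
    ...   | z , eq = z , trans eq (cong (_+ _) (sym gap))
      where
      gap : ∣ (g₁ + i + j ∸ (g₁ + i)) - (g₁ + i + j + k ∸ g₁) ∣ ≡ i + k
      gap = begin
        ∣ (g₁ + i + j ∸ (g₁ + i)) - (g₁ + i + j + k ∸ g₁) ∣ ≡⟨ cong₂ ∣_-_∣ (m+n∸m≡n (g₁ + i) j) outer-gap ⟩
        ∣ j - (j + (i + k)) ∣                               ≡⟨ m≤n⇒∣m-n∣≡n∸m (m≤m+n j (i + k)) ⟩
        j + (i + k) ∸ j                                     ≡⟨ m+n∸m≡n j (i + k) ⟩
        i + k                                               ∎
        where
        open ≡-Reasoning
        rearrange : g₁ + i + j + k ≡ g₁ + (j + (i + k))
        rearrange = begin
          g₁ + i + j + k       ≡⟨ cong (_+ k) (+-assoc g₁ i j) ⟩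
          g₁ + (i + j) + k     ≡⟨ +-assoc g₁ (i + j) k ⟩
          g₁ + (i + j + k)     ≡⟨ cong (λ t → g₁ + (t + k)) (+-comm i j) ⟩
          g₁ + (j + i + k)     ≡⟨ cong (g₁ +_) (+-assoc j i k) ⟩
          g₁ + (j + (i + k))   ∎
        outer-gap : g₁ + i + j + k ∸ g₁ ≡ j + (i + k)
        outer-gap = trans (cong (_∸ g₁) rearrange) (m+n∸m≡n g₁ _)

    module _ {E} (e : Ear (Theta.t Θ) (Theta.s Θ) E) where

      two-placed : ∀ {F} (f : Ear x y F) → Placed x y → f # e → Closed (F ++ E)
      two-placed f (onRail ρ o i j p q i<j j≤) fe =
        two-on-rail Θ e ρ (turn o f) i j p q i<j j≤ (fe ∘ turn-inner o f)
      two-placed f (across o i j p q 0<i i< 0<j j<) fe =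
        two-across Θ e true (turn o f) i j p q i< 0<j (<⇒≤ j<) (fe ∘ turn-inner o f)

      -- Two intervals on a rail are staggered, which gives a cycle through all three ears, or one
      -- contains the other, which gives a cycle avoiding the base. Equal ends belong to the second
      -- case.
      rail-pair : ∀ ρ {f g} (F : Ear a b [ f ]) (G : Ear c d [ g ]) f₁ f₂ g₁ g₂ →
        at ρ f₁ ≡ a → at ρ f₂ ≡ b → at ρ g₁ ≡ c → at ρ g₂ ≡ d →
        f₁ < f₂ → g₁ < g₂ → f₂ ≤ top ρ → g₂ ≤ top ρ → F # G → F # e → G # e →
        Closed (f ∷ g ∷ E) ⊎ Σ (Closed (f ∷ g ∷ [])) λ z →
          len z ≡ ∣ (f₂ ∸ f₁) - (g₂ ∸ g₁) ∣ + (suc (length (Ear.inner F)) + suc (length (Ear.inner G)))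
      rail-pair ρ {f} {g} F G f₁ f₂ g₁ g₂ pa pb pc pd f< g< f≤ g≤ fg fe ge = go (<-cmp f₁ g₁) (<-cmp f₂ g₂)
        where
        Result : Set
        Result = Closed (f ∷ g ∷ E) ⊎ Σ (Closed (f ∷ g ∷ [])) λ z →
          len z ≡ ∣ (f₂ ∸ f₁) - (g₂ ∸ g₁) ∣ + (suc (length (Ear.inner F)) + suc (length (Ear.inner G)))
        f-in-g : g₁ ≤ f₁ → f₂ ≤ g₂ → Result
        f-in-g l₁ l₂ = inj₂ (inside ρ F G f₁ f₂ g₁ g₂ pa pb pc pd f< g≤ l₁ l₂ fg)
        g-in-f : f₁ ≤ g₁ → g₂ ≤ f₂ → Result
        g-in-f l₁ l₂ with inside ρ G F g₁ g₂ f₁ f₂ pc pd pa pb g< f≤ l₁ l₂ (λ p q → fg q p)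
        ... | z , eq = inj₂ (resign (sub₂ 1st 0th) (sub₂ 1st 0th) z ,
          trans eq (cong₂ _+_ (∣-∣-comm (g₂ ∸ g₁) (f₂ ∸ f₁)) (+-comm (suc (length (Ear.inner G))) _)))
        swap₂ : ∀ {h} → h ∈ g ∷ f ∷ E → h ∈ f ∷ g ∷ E
        swap₂ (here p) = there (here p)
        swap₂ (there (here p)) = here p
        swap₂ (there (there p)) = there (there p)
        swap₂′ : ∀ {h} → h ∈ f ∷ g ∷ E → h ∈ g ∷ f ∷ E
        swap₂′ (here p) = there (here p)
        swap₂′ (there (here p)) = here p
        swap₂′ (there (there p)) = there (there p)
        go : _ → _ → Result
        go (tri< l₁ _ _) (tri< l₂ _ _) = inj₁ (staggered Θ e ρ F G f₁ f₂ g₁ g₂ pa pb pc pd f< g< l₁ l₂ g≤ fg fe ge)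
        go (tri< l₁ _ _) (tri≈ _ l₂ _) = g-in-f (<⇒≤ l₁) (≤-reflexive (sym l₂))
        go (tri< l₁ _ _) (tri> _ _ l₂) = g-in-f (<⇒≤ l₁) (<⇒≤ l₂)
        go (tri≈ _ l₁ _) (tri< l₂ _ _) = f-in-g (≤-reflexive (sym l₁)) (<⇒≤ l₂)
        go (tri≈ _ l₁ _) (tri≈ _ l₂ _) = f-in-g (≤-reflexive (sym l₁)) (≤-reflexive l₂)
        go (tri≈ _ l₁ _) (tri> _ _ l₂) = g-in-f (≤-reflexive l₁) (<⇒≤ l₂)
        go (tri> _ _ l₁) (tri< l₂ _ _) = f-in-g (<⇒≤ l₁) (<⇒≤ l₂)
        go (tri> _ _ l₁) (tri≈ _ l₂ _) = f-in-g (<⇒≤ l₁) (≤-reflexive l₂)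
        go (tri> _ _ l₁) (tri> _ _ l₂) = inj₁ (resign swap₂ swap₂′
          (staggered Θ e ρ G F g₁ g₂ f₁ f₂ pc pd pa pb g< f< l₁ l₂ f≤ (λ p q → fg q p) ge fe))

      -- Either the detour along g before the crossing ear f works from s, or it works from t.
      crossing-and-rail : ∀ ρ {F G} (f : Ear a b F) (g : Ear c d G) i j x y →
        at ρ i ≡ a → at (not ρ) j ≡ b → at ρ x ≡ c → at ρ y ≡ d →
        0 < i → i < top ρ → 0 < j → j < top (not ρ) → x < y → y ≤ top ρ → ¬ (x ≡ 0 × y ≡ top ρ) →
        f # g → f # e → g # e → Closed (G ++ (F ++ E))
      crossing-and-rail ρ {F} {G} f g i j x y pa pb pc pd 0<i i< 0<j j< xy y≤ ends fg fe ge = go (x <? i) (y <? top ρ)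
        where
        t = top ρ
        x≤ : x ≤ t
        x≤ = <⇒≤ (<-≤-trans xy y≤)
        mirrored : i < y → 0 < x → Closed (G ++ (F ++ E))
        mirrored i<y 0<x = detour (mirror Θ) (revEar e) ρ f (revEar g) (t ∸ i) (top (not ρ) ∸ j) (t ∸ y) (t ∸ x)
          (trans (cong (at ρ) (m∸[m∸n]≡n (<⇒≤ i<))) pa) (trans (cong (at (not ρ)) (m∸[m∸n]≡n (<⇒≤ j<))) pb)
          (trans (cong (at ρ) (m∸[m∸n]≡n y≤)) pd) (trans (cong (at ρ) (m∸[m∸n]≡n x≤)) pc)
          (∸-monoʳ-< i<y y≤) (∸-monoʳ-< xy y≤)
          (∸-monoʳ-< {t} {i} {0} 0<i (<⇒≤ i<)) (∸-monoʳ-< {t} {x} {0} 0<x x≤)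
          (m<n⇒0<n∸m j<) (m∸n≤m (top (not ρ)) j)
          (λ p q → fg p (AnyP.reverse⁻ q)) (λ p q → fe p (AnyP.reverse⁻ q))
          (λ p q → ge (AnyP.reverse⁻ p) (AnyP.reverse⁻ q))
        go : Dec (x < i) → Dec (y < t) → Closed (G ++ (F ++ E))
        go (yes xi) (yes y<) = detour Θ e ρ f g i j x y pa pb pc pd xi xy i< y< 0<j (<⇒≤ j<) fg fe ge
        go (no x≮i) _        = mirrored (≤-<-trans (≮⇒≥ x≮i) xy) (<-≤-trans 0<i (≮⇒≥ x≮i))
        go (yes xi) (no y≮)  = mirrored (<-≤-trans i< (≮⇒≥ y≮))
          (n≢0⇒n>0 (λ x≡0 → ends (x≡0 , ≤-antisym y≤ (≮⇒≥ y≮))))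

      -- The two ears differ in their ends on at least one of the rails, and the weaving is done
      -- from such a rail.
      crossing-pair : ∀ {f g} (F : Ear a b [ f ]) (G : Ear c d [ g ]) i j x y →
        at true i ≡ a → at false j ≡ b → at true x ≡ c → at false y ≡ d →
        0 < i → i < T → 0 < j → j < L ∸ T → 0 < x → x < T → 0 < y → y < L ∸ T → ¬ (i ≡ x × j ≡ y) →
        F # G → F # e → G # e → Closed (f ∷ g ∷ E)
      crossing-pair {f = f} {g} F G i j x y pa pb pc pd 0<i i< 0<j j< 0<x x< 0<y y< ne fg fe ge = go (<-cmp i x) (<-cmp j y)
        where
        gf : G # F
        gf p q = fg q p
        flipˡ : ∀ {a b S c d S′} {A : Ear a b S} {B : Ear c d S′} → A # B → revEar A # B
        flipˡ h p q = h (AnyP.reverse⁻ p) q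
        flipʳ : ∀ {a b S c d S′} {A : Ear a b S} {B : Ear c d S′} → A # B → A # revEar B
        flipʳ h p q = h p (AnyP.reverse⁻ q)
        swap₂ : ∀ {f g h} → h ∈ g ∷ f ∷ E → h ∈ f ∷ g ∷ E
        swap₂ (here p) = there (here p)
        swap₂ (there (here p)) = here p
        swap₂ (there (there p)) = there (there p)
        go : _ → _ → Closed (f ∷ g ∷ E)
        go (tri< l _ _) _ = woven Θ e true (revEar G) F x y i j pc pd pa pb l (<⇒≤ x<) 0<y y< 0<j j<
          (flipˡ {A = G} {F} gf) (flipˡ {A = G} {e} ge) fe
        go (tri> _ _ l) _ = resign swap₂ swap₂ (woven Θ e true (revEar F) G i j x y pa pb pc pd l (<⇒≤ i<) 0<j j< 0<y y<
          (flipˡ {A = F} {G} fg) (flipˡ {A = F} {e} fe) ge)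
        go (tri≈ _ p _) (tri≈ _ q _) = ⊥-elim (ne (p , q))
        go (tri≈ _ _ _) (tri< l _ _) = woven Θ e false G (revEar F) y x j i pd pc pb pa l (<⇒≤ y<) 0<x x< 0<i i<
          (flipʳ {A = G} {F} gf) ge (flipˡ {A = F} {e} fe)
        go (tri≈ _ _ _) (tri> _ _ l) = resign swap₂ swap₂ (woven Θ e false F (revEar G) j i y x pb pa pd pc l (<⇒≤ j<) 0<i i< 0<x x<
          (flipʳ {A = F} {G} fg) fe (flipˡ {A = G} {e} ge))

  -- No relative position is excluded: seen from the theta graph of C and `e`, the ear `g` lies on a
  -- rail or across, and C closes up both ears in either case.
  two : ∀ (e : Ear x y S) (g : Ear z u S′) → InC x → InC y → x ≢ y → InC z → InC u → z ≢ u → g # e → Closed (S′ ++ S)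
  two e g (onC s refl) (onC k refl) x≢y cz cu z≢u ge with after-surjective s k
  ... | zero , _ , refl = ⊥-elim (x≢y refl)
  ... | suc j , j< , refl = two-placed (revEar e) g (place cz cu z≢u) (λ p q → ge p (AnyP.reverse⁻ q))
    where open OnTheta s (suc j) (s≤s z≤n) j<

  -- The name of a branch: the vertex of C from which it climbs into the forest.
  Unit : V → Set
  Unit f = InC f × NR f

  -- The base branch. It climbs from `e` until its first return to C at `r`, which differs from `e`
  -- because ranks fall; C together with this stem is the theta graph.
  module ForUnit (s : Fin L) (ne : NR (vtx C s)) where

    e : V
    e = vtx C s

    opaque
     e-hit : ∃[ y ] (InC y × Σ (Climb (π e) y) λ c → ∀ {z} → z ∈ below c → ¬ InC z)
     e-hit = first-hit Tree tree-π tree-NR inC? id (π e) (tree-π (tree-C (onC s refl)) ne)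

    r : V
    r = proj₁ e-hit
    r-C : InC r
    r-C = proj₁ (proj₂ e-hit)
    stem : Climb (π e) r
    stem = proj₁ (proj₂ (proj₂ e-hit))
    stem-free : ∀ {z} → z ∈ below stem → ¬ InC z
    stem-free = proj₂ (proj₂ (proj₂ e-hit))

    top-rank : ∀ {f t} → NR f → Climb (π f) t → rank t < rank f
    top-rank nf c = ≤-<-trans (climb-rank c) (rank-π nf)

    top≢ : ∀ {f t} → NR f → Climb (π f) t → f ≢ t
    top≢ nf c refl = <-irrefl refl (top-rank nf c)

    stemEar : Ear e r [ e ]
    stemEar = upEar ne stem stem-free

    opaque
     r-position : ∃[ j ] (j < L × after s j ≡ InC.place r-C)
     r-position = after-surjective s (InC.place r-C)

    T : ℕ
    T = proj₁ r-position
    T<L : T < L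
    T<L = proj₁ (proj₂ r-position)
    r≡ : point s T ≡ r
    r≡ = trans (cong (vtx C) (proj₂ (proj₂ r-position))) (InC.place≡ r-C)
    0<T : 0 < T
    0<T = n≢0⇒n>0 (λ T≡0 → top≢ ne stem (trans (cong (point s) (sym T≡0)) r≡))

    open OnTheta s T 0<T T<L
    open Theta Θ using (at; top; rail; start; end)

    backEar : Ear (point s T) e [ e ]
    backEar = turn (inj₂ (r≡ , refl)) stemEar

    backEar-inner : ∀ {v} → v ∈ Ear.inner backEar → v ∈ below stem
    backEar-inner = turn-inner (inj₂ (r≡ , refl)) stemEar

    D : V → Set
    D v = InC v ⊎ v ∈ below stem

    D? : ∀ v → Dec (D v)
    D? v = inC? v ⊎-dec any? (v FP.≟_) (below stem)

    -- Every other branch is cut off at its first vertex on C or on the stem. Hence its inner part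
    -- avoids the stem by construction, and only its foot needs a case distinction.
    record Chain (f : V) : Set where
      constructor mkChain
      field
        foot  : V
        hit   : D foot
        ascent : Climb (π f) foot
        free  : ∀ {z} → z ∈ below ascent → ¬ D z

    opaque
     chain : ∀ {f} → Unit f → Chain f
     chain {f} (cf , nf) = let t , d , c , free = first-hit Tree tree-π tree-NR D? inj₁ (π f) (tree-π (tree-C cf) nf)
       in mkChain t d c free

    hairs : ∀ {f} → Unit f → List V
    hairs u = below (Chain.ascent (chain u))

    chainEar : ∀ {f} → NR f → (c : Chain f) → Ear f (Chain.foot c) [ f ]
    chainEar nf c = upEar nf (Chain.ascent c) (λ z∈ → Chain.free c z∈ ∘ inj₁)

    data Role (f : V) (c : Chain f) : Set where
      hangs : Chain.foot c ∈ below stem → ∀ j → j < L → point s j ≡ f → Role f c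
      sits  : InC (Chain.foot c) → Placed f (Chain.foot c) → Role f c

    opaque
     role : ∀ {f} (u : Unit f) → Role f (chain u)
     role u with Chain.hit (chain u)
     ... | inj₁ ct = sits ct (place (proj₁ u) ct (top≢ (proj₂ u) (Chain.ascent (chain u))))
     ... | inj₂ t∈ = let j , j< , eq = after-surjective s (InC.place (proj₁ u))
                     in hangs t∈ j j< (trans (cong (vtx C) eq) (InC.place≡ (proj₁ u)))

    -- Spans on the first rail are at most `T`. The shift by `T + w` moves the second rail so far
    -- away that chords on different rails never share a window of length `w`.
    rail-offset : Bool → ℕ
    rail-offset true  = 0
    rail-offset false = T + w

    -- On a rail the span is what matters, by `inside`. A branch that changes rails forms a bad pair
    -- with every other branch, so its value 0 is a mere default.
    placed-position : ∀ {x y} → Placed x y → ℕ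
    placed-position (onRail ρ _ i j _ _ _ _)       = rail-offset ρ + (j ∸ i)
    placed-position (across _ _ _ _ _ _ _ _ _) = 0

    -- Two branches hanging from the same vertex of the stem are closed up by an arc of C between
    -- their starting points, so there the place on C is the position. Comparing places with spans
    -- is harmless, since a hanging and a sitting branch always form a bad pair.
    position : ∀ {f c} → Role f c → ℕ
    position (hangs _ j _ _) = j
    position (sits _ p)      = placed-position p

    position≤ : ∀ {f c} (ρ : Role f c) → position ρ ≤ L + w
    position≤ (hangs _ j j< _) = ≤-trans (<⇒≤ j<) (m≤m+n L w)
    position≤ (sits _ (across _ _ _ _ _ _ _ _ _)) = z≤n
    position≤ (sits _ (onRail true  _ i j _ _ _ j≤)) = ≤-trans (m∸n≤m j i) (≤-trans j≤ (≤-trans (<⇒≤ T<L) (m≤m+n L w)))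
    position≤ (sits _ (onRail false _ i j _ _ _ j≤)) = begin
      T + w + (j ∸ i)    ≤⟨ +-monoʳ-≤ (T + w) (≤-trans (m∸n≤m j i) j≤) ⟩
      T + w + (L ∸ T)    ≡⟨ +-comm (T + w) _ ⟩
      L ∸ T + (T + w)    ≡⟨ +-assoc (L ∸ T) T w ⟨
      L ∸ T + T + w      ≡⟨ cong (_+ w) (m∸n+n≡m (<⇒≤ T<L)) ⟩
      L + w              ∎
      where open ≤-Reasoning

    -- Of the two ends of a chain the unit is the one of larger rank, so the ends determine the
    -- unit.
    no-same-ends : ∀ {f g t t′ a b} → f ≢ g → rank t < rank f → rank t′ < rank g →
      Turned f t a b → Turned g t′ a b → ⊥
    no-same-ends f≢g lf lg (inj₁ (refl , refl)) (inj₁ (refl , _))    = f≢g refl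
    no-same-ends f≢g lf lg (inj₁ (refl , refl)) (inj₂ (refl , refl)) = <-asym lf lg
    no-same-ends f≢g lf lg (inj₂ (refl , refl)) (inj₁ (refl , refl)) = <-asym lf lg
    no-same-ends f≢g lf lg (inj₂ (refl , refl)) (inj₂ (_ , refl))    = f≢g refl

    -- The hair of `f` and the stem below `m` form an ear from `f` to `e` that already carries two
    -- labels. With a disjoint ear from `g`, two chords are enough for a signature of three.
    hang-bad : ∀ {f g m y} (uf : Unit f) (ug : Unit g) → f ≢ g → e ≢ f →
      (c : Climb (π f) m) → (∀ {z} → z ∈ below c → ¬ D z) → m ∈ below stem → (σ : Split stem m) →
      (d : Climb (π g) y) → InC y → (∀ {z} → z ∈ below d → ¬ InC z) →
      (∀ {z} → z ∈ below d → z ∉ below c × z ≢ m × z ∉ below (Split.lower σ)) → Closed (f ∷ g ∷ e ∷ [])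
    hang-bad {f} {g} {m} (cf , nf) (cg , ng) f≢g e≢f c cfree m∈ σ d cy dfree avoid =
      resign (sub₃ 1st 0th 2nd) (sub₃ 1st 0th 2nd)
        (two A (upEar ng d dfree) cf (onC s refl) (e≢f ∘ sym) cg cy (top≢ ng d) B#A)
      where
      c-C : ∀ {z} → z ∈ below c → ¬ InC z
      c-C p = cfree p ∘ inj₁
      l-C : ∀ {z} → z ∈ below (Split.lower σ) → ¬ InC z
      l-C p = stem-free (Split.lower⊆ σ p)
      c-l : ∀ {z} → z ∈ below c → z ∈ below (Split.lower σ) → ⊥
      c-l p q = cfree p (inj₂ (Split.lower⊆ σ q))
      A = meet nf ne c (Split.lower σ) c-C l-C (stem-free m∈) c-l
      B#A : upEar ng d dfree # A
      B#A p q with meet-inner nf ne c (Split.lower σ) c-C l-C (stem-free m∈) c-l q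
      ... | inj₁ q′        = proj₁ (avoid p) q′
      ... | inj₂ (inj₁ eq) = proj₁ (proj₂ (avoid p)) eq
      ... | inj₂ (inj₂ q′) = proj₂ (proj₂ (avoid p)) q′

    Disjoint : ∀ {f g} → Unit f → Unit g → Set
    Disjoint uf ug = ∀ {z} → z ∈ hairs uf → z ∈ hairs ug → ⊥

    -- The lower part of the stem serves the branch with the lower foot; the other branch climbs its
    -- own hair and then the upper part of the stem to `r`.
    hang-hang : ∀ {f g} (uf : Unit f) (ug : Unit g) → f ≢ g → e ≢ f → Disjoint uf ug →
      let m = Chain.foot (chain uf) ; m′ = Chain.foot (chain ug) in
      m ∈ below stem → (σ : Split stem m) → m′ ∈ below (Split.upper σ) → m ≢ m′ → Closed (f ∷ g ∷ e ∷ [])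
    hang-hang {f} {g} uf ug f≢g e≢f dis m∈ σ m′∈ m≢m′ = hang-bad uf ug f≢g e≢f (f.ascent) f.free m∈ σ
      (concat-climb g.ascent (Split.upper τ)) r-C
      (λ p → [ (λ q → g.free q ∘ inj₁) , (λ q → stem-free (above q)) ]′ (parts p))
      (λ p → [ from-g , from-stem ]′ (parts p))
      where
      module f = Chain (chain uf)
      module g = Chain (chain ug)
      τ = split-at (Split.upper σ) m′∈
      above : ∀ {z} → z ∈ below (Split.upper τ) → z ∈ below stem
      above q = Split.upper⊆ σ (Split.upper⊆ τ q)
      parts : ∀ {z} → z ∈ below (concat-climb g.ascent (Split.upper τ)) → z ∈ below g.ascent ⊎ z ∈ below (Split.upper τ)
      parts p = ∈-++⁻ (below g.ascent) (subst (_ ∈_) (below-concat g.ascent (Split.upper τ)) p)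
      lt : rank g.foot < rank f.foot
      lt = [ (λ eq → ⊥-elim (m≢m′ (sym eq))) , id ]′ (below-start (Split.upper σ) m′∈)
      from-g : ∀ {z} → z ∈ below g.ascent → z ∉ below f.ascent × z ≢ f.foot × z ∉ below (Split.lower σ)
      from-g q = (λ q′ → dis q′ q) , (λ { refl → g.free q (inj₂ m∈) }) , (λ q′ → g.free q (inj₂ (Split.lower⊆ σ q′)))
      from-stem : ∀ {z} → z ∈ below (Split.upper τ) → z ∉ below f.ascent × z ≢ f.foot × z ∉ below (Split.lower σ)
      from-stem q = (λ q′ → f.free q′ (inj₂ (above q))) , (λ { refl → <⇒≱ lt (below-≤ (Split.upper τ) q) })
        , (λ q′ → <-asym (below-rank (Split.lower σ) q′) (≤-<-trans (below-≤ (Split.upper τ) q) lt))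

    hang-sit : ∀ {f g} (uf : Unit f) (ug : Unit g) → f ≢ g → e ≢ f → Disjoint uf ug →
      Chain.foot (chain uf) ∈ below stem → InC (Chain.foot (chain ug)) → Closed (f ∷ g ∷ e ∷ [])
    hang-sit uf ug f≢g e≢f dis m∈ ct = hang-bad uf ug f≢g e≢f f.ascent f.free m∈ σ g.ascent ct (λ p → g.free p ∘ inj₁)
      (λ q → (λ q′ → dis q′ q) , (λ { refl → g.free q (inj₂ m∈) }) , (λ q′ → g.free q (inj₂ (Split.lower⊆ σ q′))))
      where
      module f = Chain (chain uf)
      module g = Chain (chain ug)
      σ = split-at stem m∈

    -- Hairs that meet off the stem form an ear from `f` to `g` with both labels, disjoint from the
    -- stem. This makes hairs with a common vertex a bad pair, which later bounds their total
    -- length.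
    joined : ∀ {f g w} (uf : Unit f) (ug : Unit g) → f ≢ g → (σ : Split (Chain.ascent (chain uf)) w) → w ∈ hairs ug →
      (∀ {z} → z ∈ below (Split.lower σ) → z ∉ hairs ug) → Closed (f ∷ g ∷ e ∷ [])
    joined {f} {g} {w} uf ug f≢g σ w∈ free = two stemEar J (onC s refl) r-C (top≢ ne stem) (proj₁ uf) (proj₁ ug) f≢g J#
      where
      module f = Chain (chain uf)
      module g = Chain (chain ug)
      τ = split-at g.ascent w∈
      c-C : ∀ {z} → z ∈ below (Split.lower σ) → ¬ InC z
      c-C p = f.free (Split.lower⊆ σ p) ∘ inj₁
      d-C : ∀ {z} → z ∈ below (Split.lower τ) → ¬ InC z
      d-C p = g.free (Split.lower⊆ τ p) ∘ inj₁
      c-d : ∀ {z} → z ∈ below (Split.lower σ) → z ∈ below (Split.lower τ) → ⊥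
      c-d p q = free p (Split.lower⊆ τ q)
      J = meet (proj₂ uf) (proj₂ ug) (Split.lower σ) (Split.lower τ) c-C d-C (g.free w∈ ∘ inj₁) c-d
      J# : J # stemEar
      J# p q with meet-inner (proj₂ uf) (proj₂ ug) (Split.lower σ) (Split.lower τ) c-C d-C (g.free w∈ ∘ inj₁) c-d p
      ... | inj₁ p′           = f.free (Split.lower⊆ σ p′) (inj₂ q)
      ... | inj₂ (inj₁ refl)  = g.free w∈ (inj₂ q)
      ... | inj₂ (inj₂ p′)    = g.free (Split.lower⊆ τ p′) (inj₂ q)

    spread : ∀ {f} → Unit f → ℕ
    spread u = suc (length (hairs u))

    -- Bad pairs are rare for a suitable base, good pairs have pairwise different lengths, and far
    -- pairs share no window. The last two kinds keep the disjointness of the hairs, so a common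
    -- vertex can only occur in a bad pair.
    data Class {f g} (uf : Unit f) (ug : Unit g) : Set where
      bad  : Closed (f ∷ g ∷ e ∷ []) → Class uf ug
      good : Disjoint uf ug → (z : Closed (f ∷ g ∷ [])) →
             len z ≤ ∣ position (role uf) - position (role ug) ∣ + (spread uf + spread ug) → Class uf ug
      far  : Disjoint uf ug → w ≤ ∣ position (role uf) - position (role ug) ∣ → Class uf ug

    -- Two hairs rooted at the same vertex of the stem are closed up by an arc of C.
    fork : ∀ {f g} (uf : Unit f) (ug : Unit g) → Disjoint uf ug → Chain.foot (chain uf) ≡ Chain.foot (chain ug) →
      Chain.foot (chain uf) ∈ below stem → ∀ i j → i < L → j < L → point s i ≡ f → point s j ≡ g →
      Σ (Closed (f ∷ g ∷ [])) λ z → len z ≤ ∣ i - j ∣ + (spread uf + spread ug)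
    fork {f} {g} uf ug dis same m∈ i j i< j< pi pj = close₁ (leg α J) , ≤-reflexive (begin
      length (verts (Leg.walk (leg α J)))                    ≡⟨ length-leg α J ⟩
      length (verts (Arc.walk α)) + suc (length (below f.ascent ++ f.foot ∷ reverse (below δ)))
        ≡⟨ cong₂ (λ x y → x + suc y) (trans (arc-length line′ j i (s≤s⁻¹ j<) (s≤s⁻¹ i<) pj pi) (∣-∣-comm j i))
             (trans (length-++ (below f.ascent)) (cong (λ y → length (below f.ascent) + suc y) (trans (length-reverse (below δ)) (δ-length same)))) ⟩
      ∣ i - j ∣ + (spread uf + spread ug)                    ∎)
      where
      open ≡-Reasoning
      module f = Chain (chain uf)
      module g = Chain (chain ug)
      line′ = line s (2 + m) ≤-refl
      α = arc line′ j i (s≤s⁻¹ j<) (s≤s⁻¹ i<) pj pi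
      δ : Climb (π g) f.foot
      δ = subst (Climb (π g)) (sym same) g.ascent
      below-δ : ∀ {t} (eq : t ≡ g.foot) → below (subst (Climb (π g)) (sym eq) g.ascent) ≡ below g.ascent
      below-δ refl = refl
      δ-length : f.foot ≡ g.foot → length (below δ) ≡ length (below g.ascent)
      δ-length _ = cong length (below-δ same)
      δ⊆ : ∀ {z} → z ∈ below δ → z ∈ hairs ug
      δ⊆ = subst (_ ∈_) (below-δ same)
      J = meet (proj₂ uf) (proj₂ ug) f.ascent δ (λ p → f.free p ∘ inj₁) (λ p → g.free (δ⊆ p) ∘ inj₁)
        (stem-free m∈) (λ p q → dis p (δ⊆ q))

    module _ {f g} (uf : Unit f) (ug : Unit g) (f≢g : f ≢ g) (e≢f : e ≢ f) (e≢g : e ≢ g) (dis : Disjoint uf ug) where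

      private
        module f = Chain (chain uf)
        module g = Chain (chain ug)
        Fᵉ = chainEar (proj₂ uf) (chain uf)
        Gᵉ = chainEar (proj₂ ug) (chain ug)

      Outcome : ℕ → ℕ → Set
      Outcome p q = Closed (f ∷ g ∷ e ∷ [])
        ⊎ (Σ (Closed (f ∷ g ∷ [])) λ z → len z ≤ ∣ p - q ∣ + (spread uf + spread ug))
        ⊎ w ≤ ∣ p - q ∣

      module _ {a b c d} (o : Turned f f.foot a b) (o′ : Turned g g.foot c d) where

        FG : turn o Fᵉ # turn o′ Gᵉ
        FG p q = dis (turn-inner o Fᵉ p) (turn-inner o′ Gᵉ q)

        Fe : turn o Fᵉ # backEar
        Fe p q = f.free (turn-inner o Fᵉ p) (inj₂ (backEar-inner q))

        Ge : turn o′ Gᵉ # backEar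
        Ge p q = g.free (turn-inner o′ Gᵉ p) (inj₂ (backEar-inner q))

        lengths : suc (length (Ear.inner (turn o Fᵉ))) + suc (length (Ear.inner (turn o′ Gᵉ))) ≡ spread uf + spread ug
        lengths = cong₂ (λ x y → suc x + suc y) (turn-length o Fᵉ) (turn-length o′ Gᵉ)

      full-ends : ∀ {h t a b} ρ {x y} → e ≢ h → rank t < rank h → Turned h t a b → at ρ x ≡ a → at ρ y ≡ b → ¬ (x ≡ 0 × y ≡ top ρ)
      full-ends ρ e≢h th o pa pb (refl , refl) =
        no-same-ends e≢h (top-rank ne stem) th (inj₁ (trans (sym pa) (start ρ) , trans (sym pb) (trans (end ρ) r≡))) o

      rails-apart : ∀ {i j} k → j ∸ i ≤ T → w ≤ ∣ j ∸ i - T + w + k ∣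
      rails-apart {i} {j} k h = begin
        w                           ≡⟨ m+n∸m≡n T w ⟨
        T + w ∸ T                   ≤⟨ ∸-mono (m≤m+n (T + w) k) h ⟩
        T + w + k ∸ (j ∸ i)         ≡⟨ m≤n⇒∣m-n∣≡n∸m (≤-trans h (≤-trans (m≤m+n T w) (m≤m+n (T + w) k))) ⟨
        ∣ j ∸ i - T + w + k ∣       ∎
        where open ≤-Reasoning

      same-offset : ∀ ρ {p q x} z → x ≡ ∣ p - q ∣ + z → x ≤ ∣ rail-offset ρ + p - rail-offset ρ + q ∣ + z
      same-offset ρ {p} {q} z eq = ≤-reflexive (trans eq (cong (_+ z) (sym (∣m+n-m+o∣≡∣n-o∣ (rail-offset ρ) p q))))

      on-one-rail : ∀ ρ {a b c d} (o : Turned f f.foot a b) (o′ : Turned g g.foot c d) f₁ f₂ g₁ g₂ →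
        at ρ f₁ ≡ a → at ρ f₂ ≡ b → at ρ g₁ ≡ c → at ρ g₂ ≡ d → f₁ < f₂ → f₂ ≤ top ρ → g₁ < g₂ → g₂ ≤ top ρ →
        Outcome (rail-offset ρ + (f₂ ∸ f₁)) (rail-offset ρ + (g₂ ∸ g₁))
      on-one-rail ρ o o′ f₁ f₂ g₁ g₂ pa pb pc pd f< f≤ g< g≤
        with rail-pair backEar ρ (turn o Fᵉ) (turn o′ Gᵉ) f₁ f₂ g₁ g₂ pa pb pc pd f< g< f≤ g≤ (FG o o′) (Fe o o′) (Ge o o′)
      ... | inj₁ z        = inj₁ z
      ... | inj₂ (z , eq) = inj₂ (inj₁ (z , same-offset ρ _ (trans eq (cong (∣ (f₂ ∸ f₁) - (g₂ ∸ g₁) ∣ +_) (lengths o o′)))))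

      sit-sit : (P : Placed f f.foot) (Q : Placed g g.foot) → Outcome (placed-position P) (placed-position Q)
      sit-sit (onRail true o f₁ f₂ pa pb f< f≤) (onRail true o′ g₁ g₂ pc pd g< g≤) =
        on-one-rail true o o′ f₁ f₂ g₁ g₂ pa pb pc pd f< f≤ g< g≤
      sit-sit (onRail false o f₁ f₂ pa pb f< f≤) (onRail false o′ g₁ g₂ pc pd g< g≤) =
        on-one-rail false o o′ f₁ f₂ g₁ g₂ pa pb pc pd f< f≤ g< g≤
      sit-sit (onRail true _ i j _ _ _ j≤) (onRail false _ i′ j′ _ _ _ _) =
        inj₂ (inj₂ (rails-apart {i} {j} (j′ ∸ i′) (≤-trans (m∸n≤m j i) j≤)))
      sit-sit (onRail false _ i′ j′ _ _ _ _) (onRail true _ i j _ _ _ j≤) =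
        inj₂ (inj₂ (subst (w ≤_) (∣-∣-comm (j ∸ i) (T + w + (j′ ∸ i′))) (rails-apart {i} {j} (j′ ∸ i′) (≤-trans (m∸n≤m j i) j≤))))
      sit-sit (across o i j pa pb 0<i i< 0<j j<) (onRail true o′ x y pc pd xy y≤) = inj₁ (resign (sub₃ 1st 0th 2nd) (sub₃ 1st 0th 2nd)
        (crossing-and-rail backEar true (turn o Fᵉ) (turn o′ Gᵉ) i j x y pa pb pc pd 0<i i< 0<j j< xy y≤
          (full-ends true e≢g (top-rank (proj₂ ug) g.ascent) o′ pc pd) (FG o o′) (Fe o o′) (Ge o o′)))
      sit-sit (across o i j pa pb 0<i i< 0<j j<) (onRail false o′ x y pc pd xy y≤) = inj₁ (resign (sub₃ 1st 0th 2nd) (sub₃ 1st 0th 2nd)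
        (crossing-and-rail backEar false (turn (turned-swap o) Fᵉ) (turn o′ Gᵉ) j i x y pb pa pc pd 0<j j< 0<i i< xy y≤
          (full-ends false e≢g (top-rank (proj₂ ug) g.ascent) o′ pc pd) (FG (turned-swap o) o′) (Fe (turned-swap o) o′) (Ge (turned-swap o) o′)))
        where
        turned-swap : ∀ {x y a b : V} → Turned x y a b → Turned x y b a
        turned-swap (inj₁ (p , q)) = inj₂ (q , p)
        turned-swap (inj₂ (p , q)) = inj₁ (q , p)
      sit-sit (onRail true o x y pa pb xy y≤) (across o′ i j pc pd 0<i i< 0<j j<) = inj₁
        (crossing-and-rail backEar true (turn o′ Gᵉ) (turn o Fᵉ) i j x y pc pd pa pb 0<i i< 0<j j< xy y≤
          (full-ends true e≢f (top-rank (proj₂ uf) f.ascent) o pa pb) (λ p q → FG o o′ q p) (Ge o o′) (Fe o o′))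
      sit-sit (onRail false o x y pa pb xy y≤) (across o′ i j pc pd 0<i i< 0<j j<) = inj₁
        (crossing-and-rail backEar false (turn (turned-swap o′) Gᵉ) (turn o Fᵉ) j i x y pd pc pa pb 0<j j< 0<i i< xy y≤
          (full-ends false e≢f (top-rank (proj₂ uf) f.ascent) o pa pb) (λ p q → FG o (turned-swap o′) q p)
          (Ge o (turned-swap o′)) (Fe o (turned-swap o′)))
        where
        turned-swap : ∀ {x y a b : V} → Turned x y a b → Turned x y b a
        turned-swap (inj₁ (p , q)) = inj₂ (q , p)
        turned-swap (inj₂ (p , q)) = inj₁ (q , p)
      sit-sit (across o i j pa pb 0<i i< 0<j j<) (across o′ x y pc pd 0<x x< 0<y y<) = inj₁
        (crossing-pair backEar (turn o Fᵉ) (turn o′ Gᵉ) i j x y pa pb pc pd 0<i i< 0<j j< 0<x x< 0<y y<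
          (λ { (refl , refl) → no-same-ends f≢g (top-rank (proj₂ uf) f.ascent) (top-rank (proj₂ ug) g.ascent) o
               (subst₂ (Turned g g.foot) (trans (sym pc) pa) (trans (sym pd) pb) o′) })
          (FG o o′) (Fe o o′) (Ge o o′))

      disjoint-outcome : (R : Role f (chain uf)) (R′ : Role g (chain ug)) → Outcome (position R) (position R′)
      disjoint-outcome (sits _ P) (sits _ Q) = sit-sit P Q
      disjoint-outcome (hangs m∈ _ _ _) (sits ct _) = inj₁ (hang-sit uf ug f≢g e≢f dis m∈ ct)
      disjoint-outcome (sits ct _) (hangs m∈ _ _ _) = inj₁ (resign (sub₃ 1st 0th 2nd) (sub₃ 1st 0th 2nd)
        (hang-sit ug uf (f≢g ∘ sym) e≢g (λ p q → dis q p) m∈ ct))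
      disjoint-outcome (hangs m∈ i i< pi) (hangs m′∈ j j< pj) with f.foot FP.≟ g.foot
      ... | yes same = inj₂ (inj₁ (fork uf ug dis same m∈ i j i< j< pi pj))
      ... | no  m≢m′ with Split.lower⊎upper (split-at stem m∈) m′∈
      ...   | inj₂ hi = inj₁ (hang-hang uf ug f≢g e≢f dis m∈ (split-at stem m∈) hi m≢m′)
      ...   | inj₁ lo with Split.lower⊎upper (split-at stem m′∈) m∈
      ...     | inj₂ hi′ = inj₁ (resign (sub₃ 1st 0th 2nd) (sub₃ 1st 0th 2nd)
                (hang-hang ug uf (f≢g ∘ sym) e≢g (λ p q → dis q p) m′∈ (split-at stem m′∈) hi′ (m≢m′ ∘ sym)))
      ...     | inj₁ lo′ = ⊥-elim (<-asym (below-rank (Split.lower (split-at stem m∈)) lo)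
                (below-rank (Split.lower (split-at stem m′∈)) lo′))

    -- Meeting hairs are settled first, at the first vertex where they meet; the case analysis of
    -- positions may then assume disjoint hairs.
    classify : ∀ {f g} (uf : Unit f) (ug : Unit g) → f ≢ g → e ≢ f → e ≢ g → Class uf ug
    classify {f} {g} uf ug f≢g e≢f e≢g with split-first (λ z → any? (z FP.≟_) (hairs ug)) (Chain.ascent (chain uf))
    ... | inj₂ (v , v∈ , σ , free) = bad (joined uf ug f≢g σ v∈ free)
    ... | inj₁ dis with disjoint-outcome uf ug f≢g e≢f e≢g dis (role uf) (role ug)
    ...   | inj₁ z              = bad z
    ...   | inj₂ (inj₁ (z , h)) = good dis z h
    ...   | inj₂ (inj₂ h)       = far dis h

-- The Sidon-type counting bound

sumOf-product : ∀ {A B : Set} (f : A → ℕ) (g : B → ℕ) xs ys →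
  sumOf f xs * sumOf g ys ≡ sumOf (λ x → sumOf (λ y → f x * g y) ys) xs
sumOf-product f g []       ys = refl
sumOf-product f g (x ∷ xs) ys = trans (*-distribʳ-+ (sumOf g ys) (f x) (sumOf f xs))
  (cong₂ _+_ (sym (sumOf-*ˡ (f x) g ys)) (sumOf-product f g xs ys))

inWindow : ℕ → ℕ → ℕ → ℕ
inWindow lo hi t = ι (⌊ lo ≤? t ⌋ ∧ ⌊ t <? hi ⌋)

window-size : ∀ lo hi W → sumOf (inWindow lo hi) (upTo W) ≡ hi ⊓ W ∸ lo
window-size lo hi zero    = sym (trans (cong (_∸ lo) (⊓-zeroʳ hi)) (0∸n≡0 lo))
window-size lo hi (suc W) = trans (sumOf-upTo-suc (inWindow lo hi) W)
  (trans (cong (_+ inWindow lo hi W) (window-size lo hi W)) (step (lo ≤? W) (W <? hi)))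
  where
  step : ∀ (p : Dec (lo ≤ W)) (q : Dec (W < hi)) → hi ⊓ W ∸ lo + ι (⌊ p ⌋ ∧ ⌊ q ⌋) ≡ hi ⊓ suc W ∸ lo
  step (yes lo≤W) (yes W<hi) = begin
    hi ⊓ W ∸ lo + 1  ≡⟨ cong (λ t → t ∸ lo + 1) (m≥n⇒m⊓n≡n (<⇒≤ W<hi)) ⟩
    W ∸ lo + 1       ≡⟨ +-comm (W ∸ lo) 1 ⟩
    1 + (W ∸ lo)     ≡⟨ +-∸-assoc 1 lo≤W ⟨
    suc W ∸ lo       ≡⟨ cong (_∸ lo) (m≥n⇒m⊓n≡n W<hi) ⟨
    hi ⊓ suc W ∸ lo  ∎
    where open ≡-Reasoning
  step (yes _) (no W≮hi) = trans (+-identityʳ _) (cong (_∸ lo)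
    (trans (m≤n⇒m⊓n≡m (≮⇒≥ W≮hi)) (sym (m≤n⇒m⊓n≡m (m≤n⇒m≤1+n (≮⇒≥ W≮hi))))))
  step (no lo≰W) _ = trans (+-identityʳ _) (trans (m≤n⇒m∸n≡0 (≤-trans (m⊓n≤n hi W) (<⇒≤ (≰⇒> lo≰W))))
    (sym (m≤n⇒m∸n≡0 (≤-trans (m⊓n≤n hi (suc W)) (≰⇒> lo≰W)))))

window-overlap : ∀ a b w W →
  sumOf (λ t → inWindow a (a + w) t * inWindow b (b + w) t) (upTo W) ≤ w ∸ ∣ a - b ∣
window-overlap a b w W with ≤-total a b
... | inj₁ a≤b = begin
  sumOf (λ t → inWindow a (a + w) t * inWindow b (b + w) t) (upTo W) ≤⟨ sumOf-mono (upTo W) (λ {t} _ → both t) ⟩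
  sumOf (inWindow b (a + w)) (upTo W)  ≡⟨ window-size b (a + w) W ⟩
  (a + w) ⊓ W ∸ b                      ≤⟨ ∸-monoˡ-≤ b (m⊓n≤m (a + w) W) ⟩
  a + w ∸ b                            ≡⟨ cong (a + w ∸_) (m+[n∸m]≡n a≤b) ⟨
  a + w ∸ (a + (b ∸ a))                ≡⟨ [m+n]∸[m+o]≡n∸o a w (b ∸ a) ⟩
  w ∸ (b ∸ a)                          ≡⟨ cong (w ∸_) (m≤n⇒∣m-n∣≡n∸m a≤b) ⟨
  w ∸ ∣ a - b ∣                        ∎
  where
  open ≤-Reasoning
  both : ∀ t → inWindow a (a + w) t * inWindow b (b + w) t ≤ inWindow b (a + w) t
  both t with a ≤? t | t <? a + w | b ≤? t | t <? b + w
  ... | yes _ | yes _ | yes _ | yes _ = ≤-refl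
  ... | yes _ | yes _ | yes _ | no _  = z≤n
  ... | yes _ | yes _ | no _  | _     = z≤n
  ... | yes _ | no _  | _     | _     = z≤n
  ... | no _  | _     | _     | _     = z≤n
... | inj₂ b≤a = begin
  sumOf (λ t → inWindow a (a + w) t * inWindow b (b + w) t) (upTo W) ≤⟨ sumOf-mono (upTo W) (λ {t} _ → both t) ⟩
  sumOf (inWindow a (b + w)) (upTo W)  ≡⟨ window-size a (b + w) W ⟩
  (b + w) ⊓ W ∸ a                      ≤⟨ ∸-monoˡ-≤ a (m⊓n≤m (b + w) W) ⟩
  b + w ∸ a                            ≡⟨ cong (b + w ∸_) (m+[n∸m]≡n b≤a) ⟨
  b + w ∸ (b + (a ∸ b))                ≡⟨ [m+n]∸[m+o]≡n∸o b w (a ∸ b) ⟩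
  w ∸ (a ∸ b)                          ≡⟨ cong (w ∸_) (m≤n⇒∣n-m∣≡n∸m b≤a) ⟨
  w ∸ ∣ a - b ∣                        ∎
  where
  open ≤-Reasoning
  both : ∀ t → inWindow a (a + w) t * inWindow b (b + w) t ≤ inWindow a (b + w) t
  both t with a ≤? t | t <? a + w | b ≤? t | t <? b + w
  ... | yes _ | yes _ | yes _ | yes _ = ≤-refl
  ... | yes _ | yes _ | yes _ | no _  = z≤n
  ... | yes _ | yes _ | no _  | _     = z≤n
  ... | yes _ | no _  | _     | _     = z≤n
  ... | no _  | _     | _     | _     = z≤n

-- With the tail from `M` on added, the sum no longer depends on `M`; the proof is by this exact
-- identity.
triangle : ∀ w M → 2 * sumOf (w ∸_) (upTo M) ≤ w * suc w
triangle w M = ≤-trans (m≤m+n _ ((w ∸ M) * suc (w ∸ M))) (≤-reflexive (exact M))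
  where
  exact : ∀ M → 2 * sumOf (w ∸_) (upTo M) + (w ∸ M) * suc (w ∸ M) ≡ w * suc w
  exact zero    = refl
  exact (suc M) = trans (cong₂ (λ s x → 2 * s + x * suc x) (sumOf-upTo-suc (w ∸_) M) (trans (cong (w ∸_) (+-comm 1 M)) (sym (∸-+-assoc w M 1))))
    (trans (peel (w ∸ M) (sumOf (w ∸_) (upTo M))) (exact M))
    where
    ring₁ : ∀ y s → 2 * (s + suc y) + y * suc y ≡ 2 * s + suc y * suc (suc y)
    ring₁ = solve-∀
    peel : ∀ x s → 2 * (s + x) + (x ∸ 1) * suc (x ∸ 1) ≡ 2 * s + x * suc x
    peel zero    s = cong (λ t → 2 * t + 0) (+-identityʳ s)
    peel (suc y) s = ring₁ y s

module Pairs (k : ℕ) where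

  private I = allFin k

  Less : Fin k × Fin k → Set
  Less (i , j) = toℕ i < toℕ j

  less? : ∀ p → Dec (Less p)
  less? (i , j) = toℕ i <? toℕ j

  pairs : List (Fin k × Fin k)
  pairs = filter less? (cartesianProduct I I)

  pairs-unique : Unique pairs
  pairs-unique = Uniq.filter⁺ less? (Uniq.cartesianProduct⁺ (Uniq.allFin⁺ k) (Uniq.allFin⁺ k))

  pairs-less : ∀ {p} → p ∈ pairs → Less p
  pairs-less p∈ = proj₂ (∈-filter⁻ less? {xs = cartesianProduct I I} p∈)

  sum-pairs : ∀ (f : Fin k → Fin k → ℕ) →
    sumOf (λ p → f (proj₁ p) (proj₂ p)) pairs ≡ sumOf (λ i → sumOf (λ j → ι ⌊ less? (i , j) ⌋ * f i j) I) I
  sum-pairs f = trans (sumOf-filter less? _ (cartesianProduct I I)) (sumOf-× _ I I)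

  only-self : ∀ i → sumOf (λ j → ι ⌊ i FP.≟ j ⌋) I ≤ 1
  only-self i = ≤-trans (≤-reflexive (sym (length-filter≡ (i FP.≟_) I)))
    (length-⊆ {ys = i ∷ []} (Uniq.filter⁺ (i FP.≟_) (Uniq.allFin⁺ k)) (λ j∈ → here (sym (proj₂ (∈-filter⁻ (i FP.≟_) {xs = I} j∈)))))

  symmetric-sum : ∀ (f : Fin k → Fin k → ℕ) (g : Fin k → ℕ) → (∀ i j → f i j ≤ f j i) → (∀ i → f i i ≤ g i) →
    sumOf (λ i → sumOf (f i) I) I ≤ sumOf g I + 2 * sumOf (λ p → f (proj₁ p) (proj₂ p)) pairs
  symmetric-sum f g sy diag = begin
    sumOf (λ i → sumOf (f i) I) I
      ≤⟨ sumOf-mono I (λ {i} _ → sumOf-mono I (λ {j} _ → trichotomy i j)) ⟩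
    sumOf (λ i → sumOf (λ j → (δ i j + lt i j) + lt j i) I) I
      ≡⟨ sumOf-cong I (λ {i} _ → trans (sumOf-+ (λ j → δ i j + lt i j) (λ j → lt j i) I) (cong (_+ sumOf (λ j → lt j i) I) (sumOf-+ (δ i) (lt i) I))) ⟩
    sumOf (λ i → (sumOf (δ i) I + sumOf (lt i) I) + sumOf (λ j → lt j i) I) I
      ≡⟨ trans (sumOf-+ _ _ I) (cong₂ _+_ (sumOf-+ _ _ I) (sumOf-swap (λ i j → lt j i) I I)) ⟩
    (sumOf (λ i → sumOf (δ i) I) I + P) + P
      ≤⟨ +-monoˡ-≤ P (+-monoˡ-≤ P (sumOf-mono I (λ {i} _ → δ-sum i))) ⟩
    (sumOf g I + P) + P
      ≡⟨ trans (+-assoc (sumOf g I) P P) (cong (λ t → sumOf g I + (P + t)) (sym (+-identityʳ P))) ⟩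
    sumOf g I + 2 * P
      ≡⟨ cong (λ t → sumOf g I + 2 * t) (sum-pairs f) ⟨
    sumOf g I + 2 * sumOf (λ p → f (proj₁ p) (proj₂ p)) pairs ∎
    where
    open ≤-Reasoning
    δ lt : Fin k → Fin k → ℕ
    δ i j = g i * ι ⌊ i FP.≟ j ⌋
    lt i j = ι ⌊ less? (i , j) ⌋ * f i j
    P = sumOf (λ i → sumOf (lt i) I) I
    δ-sum : ∀ i → sumOf (δ i) I ≤ g i
    δ-sum i = ≤-trans (≤-reflexive (sumOf-*ˡ (g i) (λ j → ι ⌊ i FP.≟ j ⌋) I))
      (≤-trans (*-monoʳ-≤ (g i) (only-self i)) (≤-reflexive (*-identityʳ (g i))))
    trichotomy : ∀ i j → f i j ≤ (δ i j + lt i j) + lt j i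
    trichotomy i j with <-cmp (toℕ i) (toℕ j)
    ... | tri< i<j _ _ with toℕ i <? toℕ j
    ...   | yes _ = ≤-trans (≤-trans (≤-reflexive (sym (+-identityʳ _))) (m≤n+m _ (δ i j))) (m≤m+n _ (lt j i))
    ...   | no ¬p = ⊥-elim (¬p i<j)
    trichotomy i j | tri> _ _ j<i with toℕ j <? toℕ i
    ...   | yes _ = ≤-trans (sy i j) (≤-trans (≤-reflexive (sym (+-identityʳ _))) (m≤n+m _ (δ i j + lt i j)))
    ...   | no ¬p = ⊥-elim (¬p j<i)
    trichotomy i j | tri≈ _ eq _ with FP.toℕ-injective eq
    ...   | refl with i FP.≟ i
    ...     | yes _ = ≤-trans (≤-trans (diag i) (≤-reflexive (sym (*-identityʳ (g i))))) (≤-trans (m≤m+n _ (lt i i)) (m≤m+n _ (lt i i)))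
    ...     | no ¬p = ⊥-elim (¬p refl)

  module _ (bad : Fin k → Fin k → Bool) where

    X : ℕ
    X = sumOf (λ p → ι (bad (proj₁ p) (proj₂ p))) pairs

    -- The Erdős-Turán count for an approximate Sidon set. Two windows overlap in at most `w` minus
    -- the distance. For a good pair this is at most `w ∸ ℓ` plus the error `h i + h j`, and as the
    -- values of `ℓ` are distinct, the first parts add up to at most a triangular number. A bad pair
    -- costs at most `w`, a far pair nothing.
    module SidonBound (w W M : ℕ) (p h : Fin k → ℕ) (good : Fin k → Fin k → Bool) (ℓ : Fin k → Fin k → ℕ)
      (p≤ : ∀ i → p i + w ≤ W)
      (cases : ∀ i j → toℕ i < toℕ j → bad i j ≡ true ⊎ (good i j ≡ true × ℓ i j ≤ ∣ p i - p j ∣ + (h i + h j)) ⊎ w ≤ ∣ p i - p j ∣)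
      (ℓ-injective : ∀ {i j i′ j′} → toℕ i < toℕ j → toℕ i′ < toℕ j′ → good i j ≡ true → good i′ j′ ≡ true →
        ℓ i j ≡ ℓ i′ j′ → (i , j) ≡ (i′ , j′))
      (ℓ< : ∀ {i j} → toℕ i < toℕ j → good i j ≡ true → ℓ i j < M) where

      v : Fin k → Fin k → ℕ
      v i j = w ∸ ∣ p i - p j ∣

      isGood? : ∀ (q : Fin k × Fin k) → Dec (good (proj₁ q) (proj₂ q) ≡ true)
      isGood? q = good (proj₁ q) (proj₂ q) 𝔹.≟ true

      ℓ′ : Fin k × Fin k → ℕ
      ℓ′ q = ℓ (proj₁ q) (proj₂ q)

      goodSum : ℕ
      goodSum = sumOf (λ q → w ∸ ℓ′ q) (filter isGood? pairs)

      good-bound : 2 * goodSum ≤ w * suc w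
      good-bound = ≤-trans (*-monoʳ-≤ 2 (sumOf-injection (w ∸_) ℓ′ (Uniq.filter⁺ isGood? pairs-unique) inj bound)) (triangle w M)
        where
        split : ∀ {q} → q ∈ filter isGood? pairs → q ∈ pairs × good (proj₁ q) (proj₂ q) ≡ true
        split = ∈-filter⁻ isGood? {xs = pairs}
        inj : ∀ {q q′} → q ∈ filter isGood? pairs → q′ ∈ filter isGood? pairs → ℓ′ q ≡ ℓ′ q′ → q ≡ q′
        inj {_ , _} {_ , _} q∈ q′∈ eq = ℓ-injective (pairs-less (proj₁ (split q∈))) (pairs-less (proj₁ (split q′∈)))
          (proj₂ (split q∈)) (proj₂ (split q′∈)) eq
        bound : ∀ {q} → q ∈ filter isGood? pairs → ℓ′ q < M
        bound {_ , _} q∈ = ℓ< (pairs-less (proj₁ (split q∈))) (proj₂ (split q∈))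

      H : ℕ
      H = sumOf h I

      pair-bound : ∀ i j → toℕ i < toℕ j →
        v i j ≤ (ι (bad i j) * w + ι ⌊ isGood? (i , j) ⌋ * (w ∸ ℓ i j)) + (h i + h j)
      pair-bound i j i<j with cases i j i<j
      ... | inj₁ b rewrite b = ≤-trans (m∸n≤m w ∣ p i - p j ∣)
        (≤-trans (≤-reflexive (sym (+-identityʳ w))) (≤-trans (m≤m+n (w + 0) _) (m≤m+n _ (h i + h j))))
      ... | inj₂ (inj₂ far) = ≤-trans (≤-reflexive (m≤n⇒m∸n≡0 far)) z≤n
      ... | inj₂ (inj₁ (g , le)) with isGood? (i , j)
      ...   | no ¬g = ⊥-elim (¬g g)
      ...   | yes _ = begin
        w ∸ D                             ≤⟨ m≤n+m∸n (w ∸ D) s ⟩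
        s + (w ∸ D ∸ s)                   ≡⟨ cong (s +_) (∸-+-assoc w D s) ⟩
        s + (w ∸ (D + s))                 ≤⟨ +-monoʳ-≤ s (∸-monoʳ-≤ w le) ⟩
        s + (w ∸ ℓ i j)                   ≡⟨ +-comm s _ ⟩
        (w ∸ ℓ i j) + s                   ≡⟨ cong (_+ s) (+-identityʳ (w ∸ ℓ i j)) ⟨
        1 * (w ∸ ℓ i j) + s               ≤⟨ +-monoˡ-≤ s (m≤n+m _ (ι (bad i j) * w)) ⟩
        (ι (bad i j) * w + 1 * (w ∸ ℓ i j)) + s ∎
        where
        open ≤-Reasoning
        D = ∣ p i - p j ∣
        s = h i + h j

      pairs-bound : sumOf (λ q → v (proj₁ q) (proj₂ q)) pairs ≤ (X * w + goodSum) + 2 * (k * H)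
      pairs-bound = begin
        sumOf (λ q → v (proj₁ q) (proj₂ q)) pairs
          ≤⟨ sumOf-mono pairs (λ { {i , j} q∈ → pair-bound i j (pairs-less q∈) }) ⟩
        sumOf (λ q → (b q * w + g q) + hh q) pairs
          ≡⟨ trans (sumOf-+ (λ q → b q * w + g q) hh pairs) (cong (_+ sumOf hh pairs) (sumOf-+ (λ q → b q * w) g pairs)) ⟩
        (sumOf (λ q → b q * w) pairs + sumOf g pairs) + sumOf hh pairs
          ≤⟨ +-mono-≤ (≤-reflexive (cong₂ _+_ bads (sym (sumOf-filter isGood? (λ q → w ∸ ℓ′ q) pairs)))) hh≤ ⟩
        (X * w + goodSum) + 2 * (k * H) ∎
        where
        open ≤-Reasoning
        b g hh : Fin k × Fin k → ℕ
        b q = ι (bad (proj₁ q) (proj₂ q))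
        g q = ι ⌊ isGood? q ⌋ * (w ∸ ℓ′ q)
        hh q = h (proj₁ q) + h (proj₂ q)
        bads : sumOf (λ q → b q * w) pairs ≡ X * w
        bads = trans (sumOf-cong pairs (λ {q} _ → *-comm (b q) w)) (trans (sumOf-*ˡ w b pairs) (*-comm w X))
        hh≤ : sumOf hh pairs ≤ 2 * (k * H)
        hh≤ = begin
          sumOf hh pairs                                ≡⟨ sum-pairs (λ i j → h i + h j) ⟩
          sumOf (λ i → sumOf (λ j → ι ⌊ less? (i , j) ⌋ * (h i + h j)) I) I
            ≤⟨ sumOf-mono I (λ {i} _ → sumOf-mono I (λ {j} _ → ≤-trans (*-monoˡ-≤ (h i + h j) (ι≤1 ⌊ less? (i , j) ⌋)) (≤-reflexive (*-identityˡ _)))) ⟩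
          sumOf (λ i → sumOf (λ j → h i + h j) I) I     ≡⟨ sumOf-cong I (λ {i} _ → trans (sumOf-+ (λ _ → h i) h I) (cong (_+ H) (trans (sumOf-const (h i) I) (cong (_* h i) (length-allFin k))))) ⟩
          sumOf (λ i → k * h i + H) I                   ≡⟨ trans (sumOf-+ (λ i → k * h i) (λ _ → H) I) (cong₂ _+_ (sumOf-*ˡ k h I) (trans (sumOf-const H I) (cong (_* H) (length-allFin k)))) ⟩
          k * H + k * H                                 ≡⟨ cong (k * H +_) (+-identityʳ (k * H)) ⟨
          2 * (k * H)                                   ∎

      N : ℕ → ℕ
      N t = sumOf (λ i → inWindow (p i) (p i + w) t) I

      N-sum : sumOf N (upTo W) ≡ k * w
      N-sum = begin
        sumOf N (upTo W)                                        ≡⟨ sumOf-swap (λ t i → inWindow (p i) (p i + w) t) (upTo W) I ⟩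
        sumOf (λ i → sumOf (inWindow (p i) (p i + w)) (upTo W)) I ≡⟨ sumOf-cong I (λ {i} _ → one i) ⟩
        sumOf (λ _ → w) I                                       ≡⟨ trans (sumOf-const w I) (cong (_* w) (length-allFin k)) ⟩
        k * w                                                   ∎
        where
        open ≡-Reasoning
        one : ∀ i → sumOf (inWindow (p i) (p i + w)) (upTo W) ≡ w
        one i = trans (window-size (p i) (p i + w) W) (trans (cong (_∸ p i) (m≤n⇒m⊓n≡m (p≤ i))) (m+n∸m≡n (p i) w))

      N²-sum : sumOf (λ t → N t * N t) (upTo W) ≤ sumOf (λ i → sumOf (v i) I) I
      N²-sum = begin
        sumOf (λ t → N t * N t) (upTo W)
          ≡⟨ sumOf-cong (upTo W) (λ {t} _ → sumOf-product (c t) (c t) I I) ⟩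
        sumOf (λ t → sumOf (λ i → sumOf (λ j → c t i * c t j) I) I) (upTo W)
          ≡⟨ sumOf-swap (λ t i → sumOf (λ j → c t i * c t j) I) (upTo W) I ⟩
        sumOf (λ i → sumOf (λ t → sumOf (λ j → c t i * c t j) I) (upTo W)) I
          ≡⟨ sumOf-cong I (λ {i} _ → sumOf-swap (λ t j → c t i * c t j) (upTo W) I) ⟩
        sumOf (λ i → sumOf (λ j → sumOf (λ t → c t i * c t j) (upTo W)) I) I
          ≤⟨ sumOf-mono I (λ {i} _ → sumOf-mono I (λ {j} _ → window-overlap (p i) (p j) w W)) ⟩
        sumOf (λ i → sumOf (v i) I) I ∎
        where
        open ≤-Reasoning
        c : ℕ → Fin k → ℕ
        c t i = inWindow (p i) (p i + w) t

      -- Sliding windows of length w, as in the Erdős–Turán bound for Sidon sets.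
      sidon-bound : (k * w) * (k * w) ≤ W * (k * w + (2 * (X * w) + w * suc w + 4 * (k * H)))
      sidon-bound = begin
        (k * w) * (k * w)                          ≡⟨ cong₂ _*_ N-sum N-sum ⟨
        sumOf N (upTo W) * sumOf N (upTo W)        ≤⟨ cauchy-schwarz N (upTo W) ⟩
        length (upTo W) * sumOf (λ t → N t * N t) (upTo W) ≡⟨ cong (_* sumOf (λ t → N t * N t) (upTo W)) (length-upTo W) ⟩
        W * sumOf (λ t → N t * N t) (upTo W)       ≤⟨ *-monoʳ-≤ W (begin
          sumOf (λ t → N t * N t) (upTo W)           ≤⟨ N²-sum ⟩
          sumOf (λ i → sumOf (v i) I) I              ≤⟨ symmetric-sum v (λ _ → w) (λ i j → ≤-reflexive (cong (w ∸_) (∣-∣-comm (p i) (p j)))) (λ i → m∸n≤m w ∣ p i - p i ∣) ⟩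
          sumOf (λ _ → w) I + 2 * sumOf (λ q → v (proj₁ q) (proj₂ q)) pairs ≤⟨ +-mono-≤ (≤-reflexive (trans (sumOf-const w I) (cong (_* w) (length-allFin k)))) (*-monoʳ-≤ 2 pairs-bound) ⟩
          k * w + 2 * ((X * w + goodSum) + 2 * (k * H)) ≡⟨ cong (k * w +_) (expand (X * w) goodSum (k * H)) ⟩
          k * w + (2 * (X * w) + 2 * goodSum + 4 * (k * H)) ≤⟨ +-monoʳ-≤ (k * w) (+-monoˡ-≤ (4 * (k * H)) (+-monoʳ-≤ (2 * (X * w)) good-bound)) ⟩
          k * w + (2 * (X * w) + w * suc w + 4 * (k * H)) ∎) ⟩
        W * (k * w + (2 * (X * w) + w * suc w + 4 * (k * H))) ∎
        where
        open ≤-Reasoning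
        expand : ∀ a b c → 2 * ((a + b) + 2 * c) ≡ 2 * a + 2 * b + 4 * c
        expand = solve-∀

    -- A vertex on y hairs accounts for y(y - 1)/2 bad pairs. So y is at most about √(2X), and
    -- counting incidences over all vertices bounds the total length of the hairs, though single
    -- hairs may be long.
    module HairBound {n} (hair : Fin k → List (Fin n)) (hair-unique : ∀ i → Unique (hair i))
      (shared : ∀ i j {z} → toℕ i < toℕ j → z ∈ hair i → z ∈ hair j → bad i j ≡ true)
      (Y : ℕ) (Y-large : 2 * X < suc Y * Y) where

      on? : ∀ z i → Dec (z ∈ hair i)
      on? z i = any? (z FP.≟_) (hair i)

      y : Fin n → ℕ
      y z = sumOf (λ i → ι ⌊ on? z i ⌋) I

      ι-idem : ∀ b → ι b * ι b ≤ ι b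
      ι-idem true  = ≤-refl
      ι-idem false = ≤-refl

      y² : ∀ z → y z * y z ≤ y z + 2 * X
      y² z = begin
        y z * y z                                          ≡⟨ sumOf-product b b I I ⟩
        sumOf (λ i → sumOf (λ j → b i * b j) I) I          ≤⟨ symmetric-sum (λ i j → b i * b j) b (λ i j → ≤-reflexive (*-comm (b i) (b j))) (λ i → ι-idem ⌊ on? z i ⌋) ⟩
        y z + 2 * sumOf (λ q → b (proj₁ q) * b (proj₂ q)) pairs ≤⟨ +-monoʳ-≤ (y z) (*-monoʳ-≤ 2 (sumOf-mono pairs λ { {i , j} q∈ → meets i j (pairs-less q∈) })) ⟩
        y z + 2 * X                                        ∎
        where
        open ≤-Reasoning
        b : Fin k → ℕ
        b i = ι ⌊ on? z i ⌋
        meets : ∀ i j → toℕ i < toℕ j → b i * b j ≤ ι (bad i j)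
        meets i j i<j with on? z i | on? z j
        ... | yes p | yes q rewrite shared i j i<j p q = ≤-refl
        ... | yes _ | no _  = z≤n
        ... | no _  | _     = z≤n

      y≤Y : ∀ z → y z ≤ Y
      y≤Y z = ≮⇒≥ (λ Y<y → <⇒≱ Y-large (+-cancelˡ-≤ (y z) _ _ (≤-trans (lower (y z) Y<y) (y² z))))
        where
        lower : ∀ a → Y < a → a + suc Y * Y ≤ a * a
        lower (suc a) (s≤s Y≤a) = +-monoʳ-≤ (suc a) (≤-trans (*-mono-≤ (s≤s Y≤a) Y≤a) (≤-reflexive (*-comm (suc a) a)))

      hair-sum : sumOf (λ i → suc (length (hair i))) I ≤ k + n * Y
      hair-sum = begin
        sumOf (λ i → suc (length (hair i))) I               ≡⟨ sumOf-+ (λ _ → 1) (length ∘ hair) I ⟩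
        sumOf (λ _ → 1) I + sumOf (length ∘ hair) I         ≤⟨ +-mono-≤ (≤-reflexive (trans (sumOf-1 I) (length-allFin k))) (sumOf-mono I (λ {i} _ → hair-length i)) ⟩
        k + sumOf (λ i → sumOf (λ z → ι ⌊ on? z i ⌋) (allFin n)) I ≡⟨ cong (k +_) (sumOf-swap (λ i z → ι ⌊ on? z i ⌋) I (allFin n)) ⟩
        k + sumOf y (allFin n)                              ≤⟨ +-monoʳ-≤ k (sumOf-≤-const (allFin n) (λ {z} _ → y≤Y z)) ⟩
        k + length (allFin n) * Y                           ≡⟨ cong (λ t → k + t * Y) (length-allFin n) ⟩
        k + n * Y                                           ∎
        where
        open ≤-Reasoning
        hair-length : ∀ i → length (hair i) ≤ sumOf (λ z → ι ⌊ on? z i ⌋) (allFin n)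
        hair-length i = ≤-trans (length-⊆ (hair-unique i) (λ {z} z∈ → ∈-filter⁺ (λ z → on? z i) (∈-allFin z) z∈))
          (≤-reflexive (length-filter≡ (λ z → on? z i) (allFin n)))

-- Counting bad and good pairs

module Counting {n} {G : Graph n} (distinctLengths : DistinctCycleLengths G) {m} (C : Cycle G m) (NR : Fin n → Set) (π : Fin n → Fin n)
  (rank : Fin n → ℕ) (rank-π : ∀ {x} → NR x → rank (π x) < rank x) (Tree : Fin n → Set)
  (tree-π : ∀ {v} → Tree v → NR v → Tree (π v)) (tree-C : ∀ {v} → OnCycle.InC C v → Tree v)
  (tree-NR : ∀ {v} → Tree v → ¬ OnCycle.InC C v → NR v)
  (π-adj : ∀ {x} → NR x → adj G x (π x) ≡ true) (π-chord : ∀ {x} → NR x → norm x (π x) ∉ cycleEdges C)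
  (w : ℕ) where

  open OnCycle C using (L; InC; onC; CAdj)
  open Walks InC CAdj NR π
  open Climbs InC CAdj NR π rank rank-π using (below-unique)
  open Signatures G C NR π rank rank-π π-adj π-chord
  open Keys C NR π rank rank-π Tree tree-π tree-C tree-NR w

  -- The first `r` units are tried as bases, the other `k` form the family to be counted. Keeping
  -- the two apart allows the base to be read off from the signature of a bad triple.
  module WithUnits (r k : ℕ) (0<r : 0 < r) (u : Fin (r + k) → Fin n) (u-injective : ∀ {i j} → u i ≡ u j → i ≡ j)
    (unit : ∀ i → Unit (u i)) where

    f : Fin k → Fin n
    f i = u (r ↑ʳ i)

    uf : ∀ i → Unit (f i)
    uf i = unit (r ↑ʳ i)

    f-injective : ∀ {i j} → f i ≡ f j → i ≡ j
    f-injective eq = FP.↑ʳ-injective r _ _ (u-injective eq)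

    base : Fin r → Fin L
    base a = InC.place (proj₁ (unit (a ↑ˡ k)))

    base≡ : ∀ a → vtx C (base a) ≡ u (a ↑ˡ k)
    base≡ a = InC.place≡ (proj₁ (unit (a ↑ˡ k)))

    base-NR : ∀ a → NR (vtx C (base a))
    base-NR a = subst NR (sym (base≡ a)) (proj₂ (unit (a ↑ˡ k)))

    base-injective : ∀ {a b} → vtx C (base a) ≡ vtx C (base b) → a ≡ b
    base-injective {a} {b} eq = FP.↑ˡ-injective k _ _ (u-injective (trans (sym (base≡ a)) (trans eq (base≡ b))))

    base≢f : ∀ a i → vtx C (base a) ≢ f i
    base≢f a i eq with trans (sym (FP.splitAt-↑ˡ r a k))
      (trans (cong (F.splitAt r) (u-injective (trans (sym (base≡ a)) eq))) (FP.splitAt-↑ʳ r k i))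
    ... | ()

    open Pairs k

    f≢ : ∀ {i j} → toℕ i < toℕ j → f i ≢ f j
    f≢ i<j eq = <⇒≢ i<j (cong toℕ (f-injective eq))

    recover : ∀ {i j i′ j′ : Fin k} → toℕ i < toℕ j → toℕ i′ < toℕ j′ → i ≡ i′ ⊎ i ≡ j′ → j ≡ i′ ⊎ j ≡ j′ → (i , j) ≡ (i′ , j′)
    recover l l′ (inj₁ refl) (inj₂ refl) = refl
    recover l l′ (inj₁ refl) (inj₁ refl) = ⊥-elim (<-irrefl refl l)
    recover l l′ (inj₂ refl) (inj₂ refl) = ⊥-elim (<-irrefl refl l)
    recover l l′ (inj₂ refl) (inj₁ refl) = ⊥-elim (<-asym l l′)

    two-members : ∀ {h i j} → f h ∈ f i ∷ f j ∷ [] → h ≡ i ⊎ h ≡ j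
    two-members (here e)         = inj₁ (f-injective e)
    two-members (there (here e)) = inj₂ (f-injective e)

    three-members : ∀ {h i j a} → f h ∈ f i ∷ f j ∷ vtx C (base a) ∷ [] → h ≡ i ⊎ h ≡ j
    three-members (here e)         = inj₁ (f-injective e)
    three-members (there (here e)) = inj₂ (f-injective e)
    three-members {h} {a = a} (there (there (here e))) = ⊥-elim (base≢f a h (sym e))

    base-member : ∀ {b i j a} → vtx C (base b) ∈ f i ∷ f j ∷ vtx C (base a) ∷ [] → b ≡ a
    base-member {b} {i} (here e)         = ⊥-elim (base≢f b i e)
    base-member {b} {j = j} (there (here e)) = ⊥-elim (base≢f b j e)
    base-member (there (there (here e))) = base-injective e

    module At (a : Fin r) where

      open ForUnit (base a) (base-NR a)

      opaque
       classOf : ∀ i j → toℕ i < toℕ j → Class (uf i) (uf j)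
       classOf i j i<j = classify (uf i) (uf j) (f≢ i<j) (base≢f a i) (base≢f a j)

      isBad isGood : ∀ {i j} → Class (uf i) (uf j) → Bool
      isBad (bad _)  = true
      isBad _        = false
      isGood (good _ _ _) = true
      isGood _            = false

      size : ∀ {i j} → Class (uf i) (uf j) → ℕ
      size (bad z)      = len z
      size (good _ z _) = len z
      size (far _ _)    = 0

      upon : ∀ {A : Set} i j → (Class (uf i) (uf j) → A) → A → A
      upon i j g z with toℕ i <? toℕ j
      ... | yes i<j = g (classOf i j i<j)
      ... | no  _   = z

      pos spr : Fin k → ℕ
      pos i = position (role (uf i))
      spr i = spread (uf i)

      opaque

        badPair goodPair : Fin k → Fin k → Bool
        badPair i j  = upon i j isBad false
        goodPair i j = upon i j isGood false

        pairLen : Fin k → Fin k → ℕ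
        pairLen i j = upon i j size 0

        bad-closed : ∀ {i j} → toℕ i < toℕ j → badPair i j ≡ true →
          Σ (Closed (f i ∷ f j ∷ vtx C (base a) ∷ [])) λ z → pairLen i j ≡ len z
        bad-closed {i} {j} i<j b with toℕ i <? toℕ j
        ... | no ¬p = ⊥-elim (¬p i<j)
        ... | yes p with classOf i j p
        ...   | bad z = z , refl

        good-closed : ∀ {i j} → toℕ i < toℕ j → goodPair i j ≡ true →
          Σ (Closed (f i ∷ f j ∷ [])) λ z → pairLen i j ≡ len z
        good-closed {i} {j} i<j b with toℕ i <? toℕ j
        ... | no ¬p = ⊥-elim (¬p i<j)
        ... | yes p with classOf i j p
        ...   | good _ z _ = z , refl

        cases : ∀ i j → toℕ i < toℕ j → badPair i j ≡ true
          ⊎ (goodPair i j ≡ true × pairLen i j ≤ ∣ pos i - pos j ∣ + (spr i + spr j)) ⊎ w ≤ ∣ pos i - pos j ∣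
        cases i j i<j with toℕ i <? toℕ j
        ... | no ¬p = ⊥-elim (¬p i<j)
        ... | yes p with classOf i j p
        ...   | bad _      = inj₁ refl
        ...   | good _ _ h = inj₂ (inj₁ (refl , h))
        ...   | far _ h    = inj₂ (inj₂ h)

        shared : ∀ i j {z} → toℕ i < toℕ j → z ∈ hairs (uf i) → z ∈ hairs (uf j) → badPair i j ≡ true
        shared i j i<j p q with toℕ i <? toℕ j
        ... | no ¬p = ⊥-elim (¬p i<j)
        ... | yes i<j′ with classOf i j i<j′
        ...   | bad _        = refl
        ...   | good dis _ _ = ⊥-elim (dis p q)
        ...   | far dis _    = ⊥-elim (dis p q)

      -- Equal lengths give equal signatures, and the increasing pair is recovered from its two
      -- units.
      good-injective : ∀ {i j i′ j′} → toℕ i < toℕ j → toℕ i′ < toℕ j′ → goodPair i j ≡ true → goodPair i′ j′ ≡ true →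
        pairLen i j ≡ pairLen i′ j′ → (i , j) ≡ (i′ , j′)
      good-injective {i} {j} {i′} {j′} l l′ g g′ eq =
        recover {i} {j} {i′} {j′} l l′ (two-members {i} {i′} {j′} (among 0th (proj₁ (uf i)))) (two-members {j} {i′} {j′} (among 1st (proj₁ (uf j))))
        where
        z = good-closed l g
        z′ = good-closed l′ g′
        among : ∀ {v} → v ∈ f i ∷ f j ∷ [] → InC v → v ∈ f i′ ∷ f j′ ∷ []
        among v∈ c = same-signature distinctLengths (proj₁ z) (proj₁ z′) (len≥3 (proj₁ z) 0th 1st (f≢ l))
          (trans (sym (proj₂ z)) (trans eq (proj₂ z′))) c v∈

      X-at : ℕ
      X-at = X badPair

      bound : ∀ Y → 2 * X-at < suc Y * Y →
        (k * w) * (k * w) ≤ (L + w + w) * (k * w + (2 * (X-at * w) + w * suc w + 4 * (k * (k + n * Y))))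
      bound Y Y-large = ≤-trans
        -- Positions reach up to `L + w` and each window extends `w` further; cycle lengths are at
        -- most `n`, hence below `suc n`.
        (SidonBound.sidon-bound badPair w (L + w + w) (suc n) pos spr goodPair pairLen
          (λ i → +-monoˡ-≤ w (position≤ (role (uf i)))) cases good-injective
          (λ l g → let z , p = good-closed l g in s≤s (≤-trans (≤-reflexive p) (len≤n z))))
        (*-monoʳ-≤ (L + w + w) (+-monoʳ-≤ (k * w) (+-monoʳ-≤ (2 * (X-at * w) + w * suc w) (*-monoʳ-≤ 4 (*-monoʳ-≤ k
          (HairBound.hair-sum badPair (hairs ∘ uf) (λ i → below-unique (Chain.ascent (chain (uf i)))) shared Y Y-large))))))

    triples : List (Fin r × (Fin k × Fin k))
    triples = cartesianProduct (allFin r) pairs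

    bad? : ∀ (t : Fin r × (Fin k × Fin k)) → Dec (At.badPair (proj₁ t) (proj₁ (proj₂ t)) (proj₂ (proj₂ t)) ≡ true)
    bad? (a , i , j) = At.badPair a i j 𝔹.≟ true

    badTriples : List (Fin r × (Fin k × Fin k))
    badTriples = filter bad? triples

    badTriple : ∀ {a i j} → (a , i , j) ∈ badTriples → toℕ i < toℕ j × At.badPair a i j ≡ true
    badTriple t∈ with ∈-filter⁻ bad? {xs = triples} t∈
    ... | t∈′ , b = pairs-less (proj₂ (∈-cartesianProduct⁻ (allFin r) pairs t∈′)) , b

    tripleLen : Fin r × (Fin k × Fin k) → ℕ
    tripleLen (a , i , j) = At.pairLen a i j

    bad-injective : ∀ {t t′} → t ∈ badTriples → t′ ∈ badTriples → tripleLen t ≡ tripleLen t′ → t ≡ t′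
    bad-injective {a , i , j} {a′ , i′ , j′} t∈ t′∈ eq = same (base-member {a} {i′} {j′} {a′} (among 2nd (onC (base a) refl)))
      (recover {i} {j} {i′} {j′} l l′ (three-members {i} {i′} {j′} {a′} (among 0th (proj₁ (uf i)))) (three-members {j} {i′} {j′} {a′} (among 1st (proj₁ (uf j)))))
      where
      l = proj₁ (badTriple t∈)
      l′ = proj₁ (badTriple t′∈)
      z = At.bad-closed a l (proj₂ (badTriple t∈))
      z′ = At.bad-closed a′ l′ (proj₂ (badTriple t′∈))
      among : ∀ {v} → v ∈ f i ∷ f j ∷ vtx C (base a) ∷ [] → InC v → v ∈ f i′ ∷ f j′ ∷ vtx C (base a′) ∷ []
      among v∈ c = same-signature distinctLengths (proj₁ z) (proj₁ z′) (len≥3 (proj₁ z) 0th 1st (f≢ l))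
        (trans (sym (proj₂ z)) (trans eq (proj₂ z′))) c v∈
      same : a ≡ a′ → (i , j) ≡ (i′ , j′) → (a , i , j) ≡ (a′ , i′ , j′)
      same refl refl = refl

    bad-total : sumOf At.X-at (allFin r) ≤ suc n
    bad-total = begin
      sumOf At.X-at (allFin r)                     ≡⟨ sumOf-× b (allFin r) pairs ⟨
      sumOf b triples                              ≡⟨ sumOf-cong triples (λ {t} _ → b≡ t) ⟩
      sumOf (λ t → ι ⌊ bad? t ⌋) triples           ≡⟨ length-filter≡ bad? triples ⟨
      length badTriples                            ≤⟨ length-injection tripleLen
                                                        (Uniq.filter⁺ bad? (Uniq.cartesianProduct⁺ (Uniq.allFin⁺ r) pairs-unique))
                                                        bad-injective bounded ⟩
      suc n                                        ∎
      where
      open ≤-Reasoning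
      b : Fin r × (Fin k × Fin k) → ℕ
      b (a , i , j) = ι (At.badPair a i j)
      b≡ : ∀ t → b t ≡ ι ⌊ bad? t ⌋
      b≡ (a , i , j) with At.badPair a i j
      ... | true  = refl
      ... | false = refl
      bounded : ∀ {t} → t ∈ badTriples → tripleLen t < suc n
      bounded {a , i , j} t∈ = let l , b = badTriple t∈ ; z , p = At.bad-closed a l b
        in s≤s (≤-trans (≤-reflexive p) (len≤n z))

    unit-bound : ∃[ X ] (r * X ≤ suc n × (∀ Y → 2 * X < suc Y * Y →
      (k * w) * (k * w) ≤ (L + w + w) * (k * w + (2 * (X * w) + w * suc w + 4 * (k * (k + n * Y))))))
    unit-bound with ∃-small At.X-at {allFin r} (subst (0 <_) (sym (length-tabulate id)) 0<r)
    ... | a , _ , small = At.X-at a ,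
      ≤-trans (≤-trans (≤-reflexive (cong (_* At.X-at a) (sym (length-tabulate {n = r} id)))) small) bad-total , At.bound a

-- Rooted spanning forests

-- The least-number principle for a predicate that is not decided, hence only up to double negation.
¬¬-least : ∀ {P : ℕ → Set} k → P k → ¬ ¬ (∃[ k₀ ] (P k₀ × (∀ j → P j → k₀ ≤ j)))
¬¬-least {P} k pk = go k (<-wellFounded k) pk
  where
  go : ∀ k → Acc _<_ k → P k → ¬ ¬ (∃[ k₀ ] (P k₀ × (∀ j → P j → k₀ ≤ j)))
  go k (acc rs) pk ¬least = ¬least (k , pk , λ j pj → ≮⇒≥ (λ j<k → go j (rs j<k) pj ¬least))

¬¬-Fin : ∀ {n} {P : Fin n → Set} → (∀ i → ¬ ¬ P i) → ¬ ¬ (∀ i → P i)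
¬¬-Fin {zero}  h k = k λ ()
¬¬-Fin {suc n} h k = h F.zero λ p₀ → ¬¬-Fin (h ∘ F.suc) λ ps → k λ { F.zero → p₀ ; (F.suc i) → ps i }

module Forests {n} {G : Graph n} {m} (C : Cycle G m) (hs : List (Pair n)) (hs-unique : Unique hs)
  (hs⊆ : ∀ {p} → p ∈ hs → p ∈ edges G)
  (acyclic : ∀ {k} (c : Cycle G k) → (∀ {p} → p ∈ cycleEdges c → p ∈ hs) → ⊥) where

  open OnCycle C using (L; InC; onC; inC?)

  private V = Fin n

  HAdj : V → V → Set
  HAdj u v = norm u v ∈ hs

  HAdj-sym : ∀ {u v} → HAdj u v → HAdj v u
  HAdj-sym {u} {v} = subst (_∈ hs) (norm-comm u v)

  HAdj-adj : ∀ {u v} → HAdj u v → adj G u v ≡ true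
  HAdj-adj {u} {v} h with norm-cases u v
  ... | inj₁ eq = proj₁ (∈-edges⁻ G (subst (_∈ edges G) eq (hs⊆ h)))
  ... | inj₂ eq = trans (Graph.sym G u v) (proj₁ (∈-edges⁻ G (subst (_∈ edges G) eq (hs⊆ h))))

  data Reach : ℕ → V → V → Set where
    rest : ∀ {v} → Reach 0 v v
    move : ∀ {d v u r} → HAdj v u → Reach d u r → Reach (suc d) v r

  -- Vertices of C come first, so the component of a vertex of C is rooted on C.
  key : V → ℕ
  key v with inC? v
  ... | yes _ = toℕ v
  ... | no  _ = n + toℕ v

  key-injective : ∀ {u v} → key u ≡ key v → u ≡ v
  key-injective {u} {v} eq with inC? u | inC? v
  ... | yes _ | yes _ = FP.toℕ-injective eq
  ... | no  _ | no  _ = FP.toℕ-injective (+-cancelˡ-≡ n _ _ eq)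
  ... | yes _ | no  _ = ⊥-elim (<⇒≱ (FP.toℕ<n u) (≤-trans (m≤m+n n _) (≤-reflexive (sym eq))))
  ... | no  _ | yes _ = ⊥-elim (<⇒≱ (FP.toℕ<n v) (≤-trans (m≤m+n n _) (≤-reflexive eq)))

  key-C : ∀ {u v} → InC v → key u ≤ key v → InC u
  key-C {u} {v} cv le with inC? u | inC? v
  ... | yes cu | _      = cu
  ... | no _   | yes _  = ⊥-elim (<⇒≱ (FP.toℕ<n v) (≤-trans (m≤m+n n _) le))
  ... | no _   | no ¬cv = ⊥-elim (¬cv cv)

  -- The root is the vertex of least key in the component of `v`, and `dist` is the distance to it.
  -- Both minima range over the undecided relation `Reach`.
  record Info (v : V) : Set where
    field
      root     : V
      dist     : ℕ
      reach    : Reach dist v root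
      min-key  : ∀ d u → Reach d v u → key root ≤ key u
      min-dist : ∀ d → Reach d v root → dist ≤ d

  ¬¬-info : ∀ v → ¬ ¬ Info v
  ¬¬-info v k = ¬¬-least {P = λ x → ∃[ d ] ∃[ u ] (Reach d v u × key u ≡ x)} (key v) (0 , v , rest , refl)
    λ { (_ , (d , r , re , refl) , least) → ¬¬-least {P = λ d → Reach d v r} d re
      λ { (d₀ , re₀ , least′) → k record
        { root = r ; dist = d₀ ; reach = re₀ ; min-key = λ d u re → least (key u) (d , u , re , refl) ; min-dist = least′ } } }

  module Rooted (info : ∀ v → Info v) where

    root : V → V
    root v = Info.root (info v)

    dist : V → ℕ
    dist v = Info.dist (info v)

    root-adj≤ : ∀ {u v} → HAdj u v → key (root u) ≤ key (root v)
    root-adj≤ {u} {v} h = Info.min-key (info u) _ _ (move h (Info.reach (info v)))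

    root-adj : ∀ {u v} → HAdj u v → root u ≡ root v
    root-adj h = key-injective (≤-antisym (root-adj≤ h) (root-adj≤ (HAdj-sym h)))

    record Parent (v : V) : Set where
      field
        π     : V
        π-adj : 0 < dist v → HAdj v π
        π-dist : 0 < dist v → dist π < dist v

    parent : ∀ v → Parent v
    parent v = go (dist v) refl (Info.reach (info v))
      where
      go : ∀ d → d ≡ dist v → Reach d v (root v) → Parent v
      -- At a root the parent is a dummy value; the two properties are claimed only for positive
      -- distance.
      go zero    eq _ = record { π = v ; π-adj = λ lt → ⊥-elim (<⇒≢ lt eq) ; π-dist = λ lt → ⊥-elim (<⇒≢ lt eq) }
      go (suc d) eq (move {u = u} h re) = record { π = u ; π-adj = λ _ → h
        ; π-dist = λ _ → ≤-trans (s≤s (Info.min-dist (info u) d (subst (Reach d u) (root-adj h) re))) (≤-reflexive eq) }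

    NR : V → Set
    NR v = 0 < dist v

    π : V → V
    π v = Parent.π (parent v)

    π-adj : ∀ {v} → NR v → HAdj v (π v)
    π-adj {v} = Parent.π-adj (parent v)

    rank-π : ∀ {v} → NR v → dist (π v) < dist v
    rank-π {v} = Parent.π-dist (parent v)

    root-self : ∀ {v} → ¬ NR v → root v ≡ v
    root-self {v} ¬nr = go (dist v) (n≤0⇒n≡0 (≮⇒≥ ¬nr)) (Info.reach (info v))
      where
      go : ∀ d → d ≡ 0 → Reach d v (root v) → root v ≡ v
      go zero _ re = at-rest re
        where
        at-rest : ∀ {r} → Reach 0 v r → r ≡ v
        at-rest rest = refl

    Tree : V → Set
    Tree v = InC (root v)

    tree-π : ∀ {v} → Tree v → NR v → Tree (π v)
    tree-π t nr = subst InC (root-adj (π-adj nr)) t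

    tree-C : ∀ {v} → InC v → Tree v
    tree-C {v} cv = key-C cv (Info.min-key (info v) 0 v rest)

    tree-NR : ∀ {v} → Tree v → ¬ InC v → NR v
    tree-NR {v} t ¬c with 0 <? dist v
    ... | yes nr = nr
    ... | no ¬nr = ⊥-elim (¬c (subst InC (root-self ¬nr) t))

    open Walks InC HAdj NR π
    open Climbs InC HAdj NR π dist rank-π

    step-H : ∀ {x y} → Step x y → HAdj x y
    step-H (along h _)    = h
    step-H (up nr refl)   = π-adj nr
    step-H (down nr refl) = HAdj-sym (π-adj nr)

    open ToCycles G InC HAdj NR π (HAdj-adj ∘ step-H)

    no-closed : ∀ {x} (p : Walk x x) → Unique (verts p) → 3 ≤ length (verts p) → ⊥
    no-closed p u h with m≤n⇒∃[o]m+o≡n h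
    ... | k , len≡ = acyclic (T.cycle) (λ p∈ → let j , eq = T.∈-step p∈ in subst (_∈ hs) (sym eq) (step-H (stepAt p j)))
      where module T = ToCycle p len≡ u

    to-root : ∀ v → Climb v (root v)
    to-root v = go v (<-wellFounded (dist v))
      where
      go : ∀ v → Acc _<_ (dist v) → Climb v (root v)
      go v (acc rs) with 0 <? dist v
      ... | yes nr = subst (Climb v) (sym (root-adj (π-adj nr))) (step nr (go (π v) (rs (rank-π nr))))
      ... | no ¬nr = subst (Climb v) (sym (root-self ¬nr)) stop

    merge : ∀ {u v} → root u ≡ root v →
      ∃[ w ] Σ (Climb u w) λ c → Σ (Climb v w) λ d → ∀ {z} → z ∈ below c → z ∈ below d → ⊥
    merge {u} {v} same with split-first (λ z → any? (z FP.≟_) (below (to-root v))) (to-root u)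
    ... | inj₂ (w , w∈ , σ , free) = w , Split.lower σ , Split.lower τ , λ p q → free p (Split.lower⊆ τ q)
      where τ = split-at (to-root v) w∈
    ... | inj₁ free = root v , subst (Climb u) same (to-root u) , to-root v , λ p q → free (unsubst same p) q
      where
      unsubst : ∀ {r z} (eq : root u ≡ r) → z ∈ below (subst (Climb u) eq (to-root u)) → z ∈ below (to-root u)
      unsubst refl p = p

    -- Climb from both ends to the point where the two climbs merge. Unless one climb is a single
    -- step and the other empty, they close up with the edge to a cycle of at least three vertices
    -- inside `hs`.
    edge-is-parent : ∀ {u v} → HAdj u v → (NR u × π u ≡ v) ⊎ (NR v × π v ≡ u)
    edge-is-parent {u} {v} h with merge (root-adj h)
    ... | w , c , d , dis = cases c d dis
      where
      loop : ∀ {w} → Climb u w → Climb v w → Walk u u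
      loop c d = ascend c ⊕ (rev (ascend d) ⊕ (along (HAdj-sym h) h ▸ ∅))
      loop-verts : ∀ {w} (c : Climb u w) (d : Climb v w) → verts (loop c d) ≡ below c ++ reverse (below d ++ [ w ])
      loop-verts {w} c d = trans (verts-⊕ (ascend c) _) (cong₂ _++_ (verts-ascend c)
        (trans (verts-⊕ (rev (ascend d)) _) (trans (verts-rev (ascend d)) (cong (λ l → reverse (l ++ [ w ])) (verts-ascend d)))))
      big : ∀ {w} (c : Climb u w) (d : Climb v w) → (∀ {z} → z ∈ below c → z ∈ below d → ⊥) →
        2 ≤ length (below c) + length (below d) → ⊥
      big {w} c d dis two≤ = no-closed (loop c d)
        (subst Unique (sym (loop-verts c d)) (Unique-++ (below-unique c)
          (Unique-reverse (Unique-++ (below-unique d) ([] ∷ []) (λ { p (here refl) → <-irrefl refl (below-rank d p) })))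
          (λ p q → [ dis p , (λ { (here refl) → <-irrefl refl (below-rank c p) }) ]′ (∈-++⁻ (below d) (AnyP.reverse⁻ q)))))
        (≤-trans (s≤s two≤) (≤-reflexive (sym (trans (cong length (loop-verts c d)) (count (below c) (below d) w)))))
        where
        count : ∀ (xs ys : List V) w → length (xs ++ reverse (ys ++ [ w ])) ≡ suc (length xs + length ys)
        count xs ys w = begin
          length (xs ++ reverse (ys ++ [ w ]))     ≡⟨ length-++ xs ⟩
          length xs + length (reverse (ys ++ [ w ])) ≡⟨ cong (length xs +_) (trans (length-reverse (ys ++ [ w ])) (length-++ ys)) ⟩
          length xs + (length ys + 1)              ≡⟨ cong (length xs +_) (+-comm (length ys) 1) ⟩
          length xs + suc (length ys)              ≡⟨ +-suc (length xs) (length ys) ⟩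
          suc (length xs + length ys)              ∎
          where open ≡-Reasoning
      cases : ∀ {w} (c : Climb u w) (d : Climb v w) → (∀ {z} → z ∈ below c → z ∈ below d → ⊥) →
        (NR u × π u ≡ v) ⊎ (NR v × π v ≡ u)
      cases stop stop _ = ⊥-elim (adj⇒≢ G (HAdj-adj h) refl)
      cases (step nr stop) stop _ = inj₁ (nr , refl)
      cases stop (step nr stop) _ = inj₂ (nr , refl)
      cases c@(step _ (step _ _)) d dis = ⊥-elim (big c d dis (s≤s (s≤s z≤n)))
      cases c@(step _ c′) d@(step _ _) dis = ⊥-elim (big c d dis (s≤s (≤-trans (s≤s z≤n) (m≤n+m _ (length (below c′))))))
      cases c@stop d@(step _ (step _ _)) dis = ⊥-elim (big c d dis (s≤s (s≤s z≤n)))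

    child : Pair n → V
    child (i , j) with (0 <? dist i) ×-dec (π i FP.≟ j)
    ... | yes _ = i
    ... | no  _ = j

    child-spec : ∀ {p} → p ∈ hs → NR (child p) × norm (child p) (π (child p)) ≡ p
    child-spec {i , j} p∈ with (0 <? dist i) ×-dec (π i FP.≟ j) | norm-< (proj₂ (∈-edges⁻ G (hs⊆ p∈)))
    ... | yes (nr , refl) | eq = nr , eq
    ... | no ¬i | eq with edge-is-parent (subst (_∈ hs) (sym eq) p∈)
    ...   | inj₁ i-child = ⊥-elim (¬i i-child)
    ...   | inj₂ (nr , refl) = nr , trans (norm-comm j (π j)) eq

    children : List V
    children = map child hs

    children-unique : Unique children
    children-unique = Unique-map child hs-unique λ p∈ q∈ eq →
      trans (sym (proj₂ (child-spec p∈))) (trans (cong (λ v → norm v (π v)) eq) (proj₂ (child-spec q∈)))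

    units : List V
    units = filter inC? children

    units-unique : Unique units
    units-unique = Uniq.filter⁺ inC? children-unique

    units-spec : ∀ {v} → v ∈ units → InC v × NR v
    units-spec v∈ with ∈-filter⁻ inC? {xs = children} v∈
    ... | v∈′ , c with ∈-map⁻ child v∈′
    ...   | p , p∈ , refl = c , proj₁ (child-spec p∈)

    -- Each forest edge has its own lower end. At most n - L of these lie off C, and all the others
    -- are units.
    units-count : length hs + L ≤ length units + n
    units-count = begin
      length hs + L                        ≡⟨ cong (_+ L) (length-map child hs) ⟨
      length children + L                  ≤⟨ +-monoˡ-≤ L (length-filter-∉ inC? children-unique
                                                (λ _ ¬c → ∈-filter⁺ (¬? ∘ inC?) (∈-allFin _) ¬c)) ⟩
      length units + length others + L     ≡⟨ +-assoc (length units) _ L ⟩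
      length units + (length others + L)   ≤⟨ +-monoʳ-≤ (length units) others≤ ⟩
      length units + n                     ∎
      where
      open ≤-Reasoning
      others = filter (¬? ∘ inC?) (allFin n)
      on = map (vtx C) (allFin L)
      others≤ : length others + L ≤ n
      others≤ = begin
        length others + L              ≡⟨ cong (length others +_) (trans (length-map (vtx C) (allFin L)) (length-tabulate id)) ⟨
        length others + length on      ≡⟨ length-++ others ⟨
        length (others ++ on)          ≤⟨ length-⊆ (Unique-++ (Uniq.filter⁺ (¬? ∘ inC?) (Uniq.allFin⁺ n))
                                            (Uniq.map⁺ (distinct C) (Uniq.allFin⁺ L)) apart) (λ _ → ∈-allFin _) ⟩
        length (allFin n)              ≡⟨ length-tabulate id ⟩
        n                              ∎
        where
        apart : ∀ {v} → v ∈ others → v ∈ on → ⊥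
        apart v∈ v∈′ with ∈-map⁻ (vtx C) v∈′
        ... | i , _ , refl = proj₂ (∈-filter⁻ (¬? ∘ inC?) {xs = allFin n} v∈) (onC i refl)

-- The upper bound

_∈?_ : ∀ {n} (p : Pair n) ps → Dec (p ∈ ps)
p ∈? ps = any? (≡-dec FP._≟_ FP._≟_ p) ps

cycle-size : ∀ {n} {G : Graph n} {k} → Cycle G k → 3 + k ≤ n
cycle-size {n} {k = k} c = subst₂ _≤_ (trans (length-map (vtx c) (allFin (3 + k))) (length-allFin (3 + k))) (length-allFin n)
  (length-⊆ (Uniq.map⁺ (distinct c) (Uniq.allFin⁺ (3 + k))) (λ _ → ∈-allFin _))

module CycleCover {n} {G : Graph n} (distinctLengths : DistinctCycleLengths G) (es : List (Pair n)) (es-unique : Unique es) where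

  Inside : ∀ {k} → Cycle G k → Set
  Inside c = ∀ {p} → p ∈ cycleEdges c → p ∈ es

  HasCycle : Fin n → Set
  HasCycle i = Σ (Cycle G (toℕ i)) Inside

  -- Which cycle lengths occur inside `es` is assumed to be decided here; `¬¬-cycle-cover`
  -- discharges the assumption up to double negation.
  module Known (known : ∀ i → Dec (HasCycle i)) where

    I : Set
    I = Σ (Fin n) HasCycle

    hits : I → Pair n → Bool
    hits (i , c , _) p = ⌊ p ∈? cycleEdges c ⌋

    len : I → ℕ
    len (i , _) = 3 + toℕ i

    open Covering es hits

    collect : List (Fin n) → List I
    collect []       = []
    collect (i ∷ is) with known i
    ... | yes c = (i , c) ∷ collect is
    ... | no  _ = collect is

    collect-∈ : ∀ {xs j} → j ∈ collect xs → proj₁ j ∈ xs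
    collect-∈ {i ∷ xs} j∈ with known i
    collect-∈ {i ∷ xs} (here refl) | yes c = here refl
    collect-∈ {i ∷ xs} (there j∈)  | yes c = there (collect-∈ j∈)
    collect-∈ {i ∷ xs} j∈          | no _  = there (collect-∈ j∈)

    collect-all : ∀ {xs i} → i ∈ xs → HasCycle i → ∃[ c ] (i , c) ∈ collect xs
    collect-all {x ∷ xs} (here refl) c with known x
    ... | yes c′ = c′ , here refl
    ... | no ¬c  = ⊥-elim (¬c c)
    collect-all {x ∷ xs} (there i∈) c with known x | collect-all {xs} i∈ c
    ... | yes _ | c′ , j∈ = c′ , there j∈
    ... | no _  | c′ , j∈ = c′ , j∈

    collect-unique : ∀ {xs} → Unique xs → Unique (map len (collect xs))
    collect-unique {[]}     _        = []
    collect-unique {x ∷ xs} (x∉ ∷ u) with known x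
    ... | no _  = collect-unique u
    ... | yes c = All.tabulate fresh ∷ collect-unique u
      where
      fresh : ∀ {l} → l ∈ map len (collect xs) → 3 + toℕ x ≢ l
      fresh l∈ eq with ∈-map⁻ len l∈
      ... | (i , _) , j∈ , refl = All.lookup x∉ (collect-∈ j∈) (FP.toℕ-injective (+-cancelˡ-≡ 3 _ _ eq))

    size≥ : ∀ j → len j ≤ size j
    size≥ j@(i , c , inside) = begin
      3 + toℕ i                                       ≡⟨ length-cycleEdges c ⟨
      length (cycleEdges c)                           ≤⟨ length-⊆ (cycleEdges-unique c) (λ p∈ → ∈-filter⁺ (_∈? cycleEdges c) (inside p∈) p∈) ⟩
      length (filter (_∈? cycleEdges c) es)           ≡⟨ length-filter≡ (_∈? cycleEdges c) es ⟩
      size j                                          ∎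
      where open ≤-Reasoning

    hits-true : ∀ (j : I) {p} → hits j p ≡ true → p ∈ cycleEdges (proj₁ (proj₂ j))
    hits-true (i , c , _) {p} eq with p ∈? cycleEdges c
    ... | yes p∈ = p∈

    true-hits : ∀ (j : I) {p} → p ∈ cycleEdges (proj₁ (proj₂ j)) → hits j p ≡ true
    true-hits (i , c , _) {p} p∈ with p ∈? cycleEdges c
    ... | yes _  = refl
    ... | no p∉ = ⊥-elim (p∉ p∈)

    -- One representative for each length is enough, since every other cycle of that length has the
    -- same edges.
    cycle-cover : 0 < length es → ∀ t → ∃[ S ] ∃[ x ] (length S ≤ t + x × suc t * x ≤ length es ×
      (∀ {k} (c : Cycle G k) → Inside c → ∃[ p ] (p ∈ S × p ∈ cycleEdges c)))
    cycle-cover es>0 t with cover len (collect (allFin n)) es>0 (collect-unique (Uniq.allFin⁺ n))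
      (λ _ → s≤s z≤n) (λ {j} _ → size≥ j) (λ {j} _ → cycleEdge (proj₁ (proj₂ j)) F.zero , true-hits j (cycleEdge-∈ (proj₁ (proj₂ j)) F.zero)) t
    ... | S , x , S≤ , x≤ , hit = S , x , S≤ , x≤ , λ {k} c inside →
          meets (fromℕ< (≤-trans (m≤n+m (suc k) 2) (cycle-size c))) (FP.toℕ-fromℕ< _) c inside
      where
      meets : ∀ i {k} → toℕ i ≡ k → (c : Cycle G k) → Inside c → ∃[ p ] (p ∈ S × p ∈ cycleEdges c)
      meets i refl c inside with collect-all (∈-allFin i) (c , inside)
      ... | c′ , j∈ with any-witness (hits (i , c′)) {S} (hit j∈)
      ...   | p , p∈S , h = p , p∈S , transfer p (∈-cycleEdges⁻ (proj₁ c′) (hits-true (i , c′) h))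
        where
        transfer : ∀ p → ∃[ e ] p ≡ cycleEdge (proj₁ c′) e → p ∈ cycleEdges c
        transfer _ (e , refl) = subst (_∈ cycleEdges c) (sym (cycleEdge≡ (proj₁ c′) e)) (CycleEdge⇒∈ c
          (Equivalence.to (distinctLengths (toℕ i) (proj₁ c′) c _ _)
            (∈⇒CycleEdge (proj₁ c′) (subst (_∈ cycleEdges (proj₁ c′)) (cycleEdge≡ (proj₁ c′) e) (cycleEdge-∈ (proj₁ c′) e)))))

  ¬¬-cycle-cover : 0 < length es → ∀ t → ¬ ¬ (∃[ S ] ∃[ x ] (length S ≤ t + x × suc t * x ≤ length es ×
    (∀ {k} (c : Cycle G k) → Inside c → ∃[ p ] (p ∈ S × p ∈ cycleEdges c))))
  ¬¬-cycle-cover es>0 t k = ¬¬-Fin {P = λ i → Dec (HasCycle i)} (λ _ → ¬¬-excluded-middle)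
    (λ known → k (Known.cycle-cover known es>0 t))

SidonInequality : (n L w r k : ℕ) → Set
SidonInequality n L w r k = ∃[ X ] (r * X ≤ suc n × (∀ Y → 2 * X < suc Y * Y →
  (k * w) * (k * w) ≤ (L + w + w) * (k * w + (2 * (X * w) + w * suc w + 4 * (k * (k + n * Y))))))

module UpperBound {n} {G : Graph n} (distinctLengths : DistinctCycleLengths G) {m} (C : Cycle G m)
  (E t r w : ℕ) (0<E : 0 < E) (0<r : 0 < r) (E≤ : E + (3 + m) ≤ edgeCount G) where

  L : ℕ
  L = 3 + m

  chords : List (Pair n)
  chords = filter (λ p → ¬? (p ∈? cycleEdges C)) (edges G)

  chord? : ∀ p → Dec (p ∉ cycleEdges C)
  chord? p = ¬? (p ∈? cycleEdges C)

  chords-length : E ≤ length chords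
  chords-length = +-cancelʳ-≤ L E (length chords) (begin
    E + L                                  ≤⟨ E≤ ⟩
    edgeCount G                            ≡⟨ edgeCount≡ G ⟩
    length (edges G)                       ≤⟨ length-filter-∉ chord? (edges-unique G) (λ {p} _ → stable p) ⟩
    length chords + length (cycleEdges C)  ≡⟨ cong (length chords +_) (length-cycleEdges C) ⟩
    length chords + L                      ∎)
    where
    open ≤-Reasoning
    stable : ∀ p → ¬ (p ∉ cycleEdges C) → p ∈ cycleEdges C
    stable p ¬¬p with p ∈? cycleEdges C
    ... | yes p∈ = p∈
    ... | no p∉  = ⊥-elim (¬¬p p∉)

  -- `G` may have more chords. Keeping exactly `E` of them fixes the cost of the cover without any
  -- upper bound on the number of edges.
  es : List (Pair n)
  es = take E chords

  es-length : length es ≡ E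
  es-length = trans (length-take E chords) (m≤n⇒m⊓n≡m chords-length)

  es-unique : Unique es
  es-unique = Uniq.take⁺ E (Uniq.filter⁺ chord? (edges-unique G))

  es-spec : ∀ {p} → p ∈ es → p ∈ edges G × p ∉ cycleEdges C
  es-spec p∈ = ∈-filter⁻ chord? {xs = edges G} (∈-take E p∈)

  -- `x` counts the cycles missed by the `t` greedy choices, and `K` the branches of the remaining
  -- forest.
  Numbers : Set
  Numbers = ∃[ x ] ∃[ K ] (suc t * x ≤ E × E + L ≤ (t + x) + (K + n) × (∀ k → r + k ≤ K → SidonInequality n L w r k))

  numbers : ¬ ¬ Numbers
  numbers done = CycleCover.¬¬-cycle-cover distinctLengths es es-unique (subst (0 <_) (sym es-length) 0<E) t
    λ { (S , x , S≤ , x≤ , hit) → afterCover S x S≤ (subst (suc t * x ≤_) es-length x≤) hit }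
    where
    module AfterCover (S : List (Pair n)) (x : ℕ) (S≤ : length S ≤ t + x) (x≤ : suc t * x ≤ E)
      (hit : ∀ {k} (c : Cycle G k) → (∀ {p} → p ∈ cycleEdges c → p ∈ es) → ∃[ p ] (p ∈ S × p ∈ cycleEdges c)) where

      free? : ∀ p → Dec (p ∉ S)
      free? p = ¬? (p ∈? S)

      hs : List (Pair n)
      hs = filter free? es

      hs-spec : ∀ {p} → p ∈ hs → p ∈ es × p ∉ S
      hs-spec = ∈-filter⁻ free? {xs = es}

      hs-unique : Unique hs
      hs-unique = Uniq.filter⁺ free? es-unique

      hs-length : E ≤ length hs + (t + x)
      hs-length = begin
        E                      ≡⟨ es-length ⟨
        length es              ≤⟨ length-filter-∉ free? es-unique (λ {p} _ → stable p) ⟩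
        length hs + length S   ≤⟨ +-monoʳ-≤ (length hs) S≤ ⟩
        length hs + (t + x)    ∎
        where
        open ≤-Reasoning
        stable : ∀ p → ¬ (p ∉ S) → p ∈ S
        stable p ¬¬p with p ∈? S
        ... | yes p∈ = p∈
        ... | no p∉  = ⊥-elim (¬¬p p∉)

      acyclic : ∀ {k} (c : Cycle G k) → (∀ {p} → p ∈ cycleEdges c → p ∈ hs) → ⊥
      acyclic c inside with hit c (λ p∈ → proj₁ (hs-spec (inside p∈)))
      ... | p , p∈S , p∈c = proj₂ (hs-spec (inside p∈c)) p∈S

      open Forests C hs hs-unique (λ p∈ → proj₁ (es-spec (proj₁ (hs-spec p∈)))) acyclic

      conclude : (∀ v → Info v) → ⊥
      conclude info = done (x , length units , x≤ , total , bounds)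
        where
        open Rooted info
        total : E + L ≤ (t + x) + (length units + n)
        total = begin
          E + L                            ≤⟨ +-monoˡ-≤ L hs-length ⟩
          length hs + (t + x) + L          ≡⟨ cong (_+ L) (+-comm (length hs) (t + x)) ⟩
          (t + x) + length hs + L          ≡⟨ +-assoc (t + x) (length hs) L ⟩
          (t + x) + (length hs + L)        ≤⟨ +-monoʳ-≤ (t + x) units-count ⟩
          (t + x) + (length units + n)     ∎
          where open ≤-Reasoning
        bounds : ∀ k → r + k ≤ length units → SidonInequality n L w r k
        bounds k le = WithUnits.unit-bound r k 0<r (λ i → lookup units (inject≤ i le)) u-injective
          (λ i → units-spec (∈-lookup (inject≤ i le)))
          where
          open Counting distinctLengths C NR π dist rank-π Tree tree-π tree-C tree-NR (HAdj-adj ∘ π-adj)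
            (λ nr → proj₂ (es-spec (proj₁ (hs-spec (π-adj nr))))) w
          u-injective : ∀ {i j} → lookup units (inject≤ i le) ≡ lookup units (inject≤ j le) → i ≡ j
          u-injective {i} {j} e = FP.inject≤-injective le le i j (lookup-injective units-unique e)

    afterCover : ∀ S x → length S ≤ t + x → suc t * x ≤ E →
      (∀ {k} (c : Cycle G k) → (∀ {p} → p ∈ cycleEdges c → p ∈ es) → ∃[ p ] (p ∈ S × p ∈ cycleEdges c)) → ⊥
    afterCover S x S≤ x≤ hit = ¬¬-Fin ¬¬-info conclude
      where
      open AfterCover S x S≤ x≤ hit
      open Forests C hs hs-unique (λ p∈ → proj₁ (es-spec (proj₁ (hs-spec p∈)))) acyclic using (¬¬-info)

-- Sums of arm lengths

-- `cyc i` is a single cycle through the hub, made of two arms; `θ₀ i` and `θ₁ i` are spiders with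
-- three arms, whose ends are all glued to the hub.
data Block : Set where
  cyc θ₀ θ₁ : ℕ → Block

data Arm : Set where
  a₀ a₁ a₂ : Arm

_≟ᵃ_ : ∀ (a b : Arm) → Dec (a ≡ b)
a₀ ≟ᵃ a₀ = yes refl
a₀ ≟ᵃ a₁ = no λ ()
a₀ ≟ᵃ a₂ = no λ ()
a₁ ≟ᵃ a₀ = no λ ()
a₁ ≟ᵃ a₁ = yes refl
a₁ ≟ᵃ a₂ = no λ ()
a₂ ≟ᵃ a₀ = no λ ()
a₂ ≟ᵃ a₁ = no λ ()
a₂ ≟ᵃ a₂ = yes refl

_≟ᵇ_ : ∀ (a b : Block) → Dec (a ≡ b)
cyc i ≟ᵇ cyc j with i ≟ j
... | yes refl = yes refl
... | no i≢j   = no λ { refl → i≢j refl }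
θ₀ i ≟ᵇ θ₀ j with i ≟ j
... | yes refl = yes refl
... | no i≢j   = no λ { refl → i≢j refl }
θ₁ i ≟ᵇ θ₁ j with i ≟ j
... | yes refl = yes refl
... | no i≢j   = no λ { refl → i≢j refl }
cyc _ ≟ᵇ θ₀ _ = no λ ()
cyc _ ≟ᵇ θ₁ _ = no λ ()
θ₀ _ ≟ᵇ cyc _ = no λ ()
θ₀ _ ≟ᵇ θ₁ _ = no λ ()
θ₁ _ ≟ᵇ cyc _ = no λ ()
θ₁ _ ≟ᵇ θ₀ _ = no λ ()

-- An unordered pair of arms is named by the arm that it omits. Equal arms fall under the last
-- clause too, so `same-pair` has to exclude them.
third : Arm → Arm → Arm
third a₀ a₁ = a₂
third a₁ a₀ = a₂
third a₀ a₂ = a₁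
third a₂ a₀ = a₁
third _  _  = a₀

same-pair : ∀ a b c d → a ≢ b → c ≢ d → third a b ≡ third c d → (a ≡ c × b ≡ d) ⊎ (a ≡ d × b ≡ c)
same-pair a₀ a₀ _ _ n _ _ = ⊥-elim (n refl)
same-pair a₁ a₁ _ _ n _ _ = ⊥-elim (n refl)
same-pair a₂ a₂ _ _ n _ _ = ⊥-elim (n refl)
same-pair _ _ a₀ a₀ _ n _ = ⊥-elim (n refl)
same-pair _ _ a₁ a₁ _ n _ = ⊥-elim (n refl)
same-pair _ _ a₂ a₂ _ n _ = ⊥-elim (n refl)
same-pair a₀ a₁ a₀ a₁ _ _ _ = inj₁ (refl , refl)
same-pair a₀ a₁ a₁ a₀ _ _ _ = inj₂ (refl , refl)
same-pair a₁ a₀ a₀ a₁ _ _ _ = inj₂ (refl , refl)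
same-pair a₁ a₀ a₁ a₀ _ _ _ = inj₁ (refl , refl)
same-pair a₀ a₂ a₀ a₂ _ _ _ = inj₁ (refl , refl)
same-pair a₀ a₂ a₂ a₀ _ _ _ = inj₂ (refl , refl)
same-pair a₂ a₀ a₀ a₂ _ _ _ = inj₂ (refl , refl)
same-pair a₂ a₀ a₂ a₀ _ _ _ = inj₁ (refl , refl)
same-pair a₁ a₂ a₁ a₂ _ _ _ = inj₁ (refl , refl)
same-pair a₁ a₂ a₂ a₁ _ _ _ = inj₂ (refl , refl)
same-pair a₂ a₁ a₁ a₂ _ _ _ = inj₂ (refl , refl)
same-pair a₂ a₁ a₂ a₁ _ _ _ = inj₁ (refl , refl)

pick : {X : Set} → ℕ → ℕ → X → X → X
pick s t x y with s <? t
... | yes _ = x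
... | no  _ = y

pick-< : ∀ {X : Set} {s t} {x y : X} → s < t → pick s t x y ≡ x
pick-< {s = s} {t} s<t with s <? t
... | yes _  = refl
... | no s≮t = ⊥-elim (s≮t s<t)

pick-≥ : ∀ {X : Set} {s t} {x y : X} → t ≤ s → pick s t x y ≡ y
pick-≥ {s = s} {t} t≤s with s <? t
... | yes s<t = ⊥-elim (<⇒≱ s<t t≤s)
... | no _    = refl

next : Block × Arm → Block × Arm
next (cyc i , a) = cyc (suc i) , a
next (θ₀ i , a) = θ₀ (suc i) , a
next (θ₁ i , a) = θ₁ (suc i) , a

-- Decodes an offset above 12p: even offsets belong to `θ₀`, odd ones to `θ₁`, and in both cases the
-- long arm is the omitted one.
halve : ℕ → Block × Arm
halve zero          = θ₀ 0 , a₀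
halve (suc zero)    = θ₁ 0 , a₀
halve (suc (suc d)) = next (halve d)

halve-even : ∀ i → halve (i + i) ≡ (θ₀ i , a₀)
halve-even zero    = refl
halve-even (suc i) rewrite +-suc i i | halve-even i = refl

halve-odd : ∀ i → halve (suc (i + i)) ≡ (θ₁ i , a₀)
halve-odd zero    = refl
halve-odd (suc i) rewrite +-suc i i | halve-odd i = refl

module Lengths (p : ℕ) where

  -- A spider of total arm length s raises the excess of edges by two, while two separate cycles of
  -- its average cycle length 2s/3 would need about 4s/3 vertices. The sums are arranged as a
  -- tiling: two short arms grow together and give every second length, a fixed long arm plus a
  -- growing one gives an interval. With the single cycles, every length from 4 to 24p except 22p is
  -- used once. The third arm of `cyc i` is absent; its length 0 is excluded by the bound 2.
  len : Block → Arm → ℕ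
  len (cyc i) a₀ = 2 + i
  len (cyc i) a₁ = 2
  len (cyc i) a₂ = 0
  len (θ₀ i) a₀ = 11 * p
  len (θ₀ i) a₁ = 5 * p + i
  len (θ₀ i) a₂ = 7 * p + i
  len (θ₁ i) a₀ = 15 * p
  len (θ₁ i) a₁ = 5 * p + i
  len (θ₁ i) a₂ = 7 * p + 1 + i

  Ok : Block → Set
  Ok (cyc i) = 4 + i < 12 * p
  Ok (θ₀ i) = i < 2 * p
  Ok (θ₁ i) = i < 2 * p

  -- Sums below 12p come from cyc, those in [12p, 16p) from the two short arms of θ₀ (even offset) or θ₁
  -- (odd offset), and [16p, 18p), [18p, 20p), [20p, 22p), (22p, 24p] from the long arm of θ₀ or θ₁.
  decode : ℕ → Block × Arm
  decode s = pick s (12 * p) (cyc (s ∸ 4) , a₂) (pick s (16 * p) (halve (s ∸ 12 * p))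
    (pick s (18 * p) (θ₀ (s ∸ 16 * p) , a₂) (pick s (20 * p) (θ₀ (s ∸ 18 * p) , a₁)
    (pick s (22 * p) (θ₁ (s ∸ 20 * p) , a₂) (θ₁ (s ∸ (22 * p + 1)) , a₁)))))

  private
    ≤-lift : ∀ k j {i} → k * p ≤ (k + j) * p + i
    ≤-lift k j = ≤-trans (*-monoˡ-≤ p (m≤m+n k j)) (m≤m+n _ _)

    <-lift : ∀ k {i} → i < 2 * p → k * p + i < (k + 2) * p
    <-lift k {i} i< = <-≤-trans (+-monoʳ-< (k * p) i<) (≤-reflexive (sym (*-distribʳ-+ p k 2)))

    double : ∀ {i} → i < 2 * p → suc (i + i) < 4 * p
    double {i} i< = ≤-trans (≤-reflexive (cong suc (sym (+-suc i i)))) (≤-trans (+-mono-≤ i< i<) (≤-reflexive (eq p)))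
      where
      eq : ∀ p → 2 * p + 2 * p ≡ 4 * p
      eq = solve-∀

    mid : ∀ {d} → d < 4 * p → 12 * p + d < 16 * p
    mid {d} d< = <-≤-trans (+-monoʳ-< (12 * p) d<) (≤-reflexive (sym (*-distribʳ-+ p 12 4)))

    decode-mid : ∀ d → d < 4 * p → decode (12 * p + d) ≡ halve d
    decode-mid d d< = trans (pick-≥ (m≤m+n (12 * p) d)) (trans (pick-< (mid d<)) (cong halve (m+n∸m≡n (12 * p) d)))

    decode-16 : ∀ i → i < 2 * p → decode (16 * p + i) ≡ (θ₀ i , a₂)
    decode-16 i i< = trans (pick-≥ (≤-lift 12 4)) (trans (pick-≥ (≤-lift 16 0)) (trans (pick-< (<-lift 16 i<))
      (cong (λ x → θ₀ x , a₂) (m+n∸m≡n (16 * p) i))))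

    decode-18 : ∀ i → i < 2 * p → decode (18 * p + i) ≡ (θ₀ i , a₁)
    decode-18 i i< = trans (pick-≥ (≤-lift 12 6)) (trans (pick-≥ (≤-lift 16 2)) (trans (pick-≥ (≤-lift 18 0))
      (trans (pick-< (<-lift 18 i<)) (cong (λ x → θ₀ x , a₁) (m+n∸m≡n (18 * p) i)))))

    decode-20 : ∀ i → i < 2 * p → decode (20 * p + i) ≡ (θ₁ i , a₂)
    decode-20 i i< = trans (pick-≥ (≤-lift 12 8)) (trans (pick-≥ (≤-lift 16 4)) (trans (pick-≥ (≤-lift 18 2))
      (trans (pick-≥ (≤-lift 20 0)) (trans (pick-< (<-lift 20 i<)) (cong (λ x → θ₁ x , a₂) (m+n∸m≡n (20 * p) i))))))

    decode-22 : ∀ i → decode (22 * p + (1 + i)) ≡ (θ₁ i , a₁)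
    decode-22 i = trans (pick-≥ (≤-lift 12 10)) (trans (pick-≥ (≤-lift 16 6)) (trans (pick-≥ (≤-lift 18 4))
      (trans (pick-≥ (≤-lift 20 2)) (trans (pick-≥ (≤-lift 22 0)) (cong (λ x → θ₁ x , a₁)
        (trans (cong (_∸ (22 * p + 1)) (sym (+-assoc (22 * p) 1 i))) (m+n∸m≡n (22 * p + 1) i)))))))

    ordered : ∀ b → Ok b → (2 ≤ len b a₀ → 2 ≤ len b a₁ → decode (len b a₀ + len b a₁) ≡ (b , a₂))
      × (2 ≤ len b a₀ → 2 ≤ len b a₂ → decode (len b a₀ + len b a₂) ≡ (b , a₁))
      × (2 ≤ len b a₁ → 2 ≤ len b a₂ → decode (len b a₁ + len b a₂) ≡ (b , a₀))
    ordered (cyc i) ok = (λ _ _ → trans (cong decode (e₁ i)) (pick-< ok)) , (λ _ ()) , (λ _ ())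
      where
      e₁ : ∀ i → 2 + i + 2 ≡ 4 + i
      e₁ = solve-∀
    ordered (θ₀ i) ok = (λ _ _ → trans (cong decode (e₁ p i)) (decode-16 i ok))
      , (λ _ _ → trans (cong decode (e₂ p i)) (decode-18 i ok))
      , (λ _ _ → trans (cong decode (e₃ p i)) (trans (decode-mid (i + i) (<-trans ≤-refl (double ok))) (halve-even i)))
      where
      e₁ : ∀ p i → 11 * p + (5 * p + i) ≡ 16 * p + i
      e₁ = solve-∀
      e₂ : ∀ p i → 11 * p + (7 * p + i) ≡ 18 * p + i
      e₂ = solve-∀
      e₃ : ∀ p i → 5 * p + i + (7 * p + i) ≡ 12 * p + (i + i)
      e₃ = solve-∀
    ordered (θ₁ i) ok = (λ _ _ → trans (cong decode (e₁ p i)) (decode-20 i ok))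
      , (λ _ _ → trans (cong decode (e₂ p i)) (decode-22 i))
      , (λ _ _ → trans (cong decode (e₃ p i)) (trans (decode-mid (suc (i + i)) (double ok)) (halve-odd i)))
      where
      e₁ : ∀ p i → 15 * p + (5 * p + i) ≡ 20 * p + i
      e₁ = solve-∀
      e₂ : ∀ p i → 15 * p + (7 * p + 1 + i) ≡ 22 * p + (1 + i)
      e₂ = solve-∀
      e₃ : ∀ p i → 5 * p + i + (7 * p + 1 + i) ≡ 12 * p + suc (i + i)
      e₃ = solve-∀

  decode-sum : ∀ b a c → Ok b → a ≢ c → 2 ≤ len b a → 2 ≤ len b c → decode (len b a + len b c) ≡ (b , third a c)
  decode-sum b a₀ a₀ ok n _ _ = ⊥-elim (n refl)
  decode-sum b a₁ a₁ ok n _ _ = ⊥-elim (n refl)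
  decode-sum b a₂ a₂ ok n _ _ = ⊥-elim (n refl)
  decode-sum b a₀ a₁ ok _ x y = proj₁ (ordered b ok) x y
  decode-sum b a₀ a₂ ok _ x y = proj₁ (proj₂ (ordered b ok)) x y
  decode-sum b a₁ a₂ ok _ x y = proj₂ (proj₂ (ordered b ok)) x y
  decode-sum b a₁ a₀ ok _ x y = trans (cong decode (+-comm (len b a₁) _)) (proj₁ (ordered b ok) y x)
  decode-sum b a₂ a₀ ok _ x y = trans (cong decode (+-comm (len b a₂) _)) (proj₁ (proj₂ (ordered b ok)) y x)
  decode-sum b a₂ a₁ ok _ x y = trans (cong decode (+-comm (len b a₂) _)) (proj₂ (proj₂ (ordered b ok)) y x)

  opaque
    -- `decode` recovers the block and the omitted arm from the sum, so no pairwise comparison of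
    -- the kinds of sums is needed.
    sum-injective : ∀ {b a c b′ a′ c′} → Ok b → a ≢ c → 2 ≤ len b a → 2 ≤ len b c →
      Ok b′ → a′ ≢ c′ → 2 ≤ len b′ a′ → 2 ≤ len b′ c′ → len b a + len b c ≡ len b′ a′ + len b′ c′ →
      b ≡ b′ × ((a ≡ a′ × c ≡ c′) ⊎ (a ≡ c′ × c ≡ a′))
    sum-injective {b} {a} {c} {b′} {a′} {c′} ok ne x y ok′ ne′ x′ y′ eq =
      cong proj₁ same , same-pair a c a′ c′ ne ne′ (cong proj₂ same)
      where
      same : (b , third a c) ≡ (b′ , third a′ c′)
      same = trans (sym (decode-sum b a c ok ne x y)) (trans (cong decode eq) (decode-sum b′ a′ c′ ok′ ne′ x′ y′))

-- Cycles through a hub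

Fin-maximum : ∀ {k} (f : Fin (suc k) → ℕ) → ∃[ i ] (∀ j → f j ≤ f i)
Fin-maximum {zero}  f = F.zero , λ { F.zero → ≤-refl }
Fin-maximum {suc k} f with Fin-maximum (f ∘ F.suc)
... | i , max with f F.zero ≤? f (F.suc i)
...   | yes le = F.suc i , λ { F.zero → le ; (F.suc j) → max j }
...   | no ¬le = F.zero , λ { F.zero → ≤-refl ; (F.suc j) → ≤-trans (max j) (<⇒≤ (≰⇒> ¬le)) }

-- `int b a h` lies at distance `h + 1` from the centre `cen b`; at distance `len b a` the arm ends
-- in the hub. The vertices `pend j` are leaves at the hub.
data Vertex : Set where
  hub  : Vertex
  cen  : Block → Vertex
  int  : Block → Arm → ℕ → Vertex
  pend : ℕ → Vertex

module HubGraph (p : ℕ) where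

  open Lengths p

  -- Below v u: v is one step further from the centre than u on some arm; the hub is the common far end of all arms.
  data Below : Vertex → Vertex → Set where
    start : ∀ {b a} → Below (int b a 0) (cen b)
    along : ∀ {b a h} → Below (int b a (suc h)) (int b a h)
    final : ∀ {b a h} → suc (suc h) ≡ len b a → Below hub (int b a h)
    leaf  : ∀ {j} → Below hub (pend j)

  below? : ∀ u v → Dec (Below u v)
  below? (int b a zero) (cen b′) with b ≟ᵇ b′
  ... | yes refl = yes start
  ... | no  b≢   = no λ { start → b≢ refl }
  below? (int b a (suc h)) (int b′ a′ h′) with b ≟ᵇ b′ | a ≟ᵃ a′ | h ≟ h′
  ... | yes refl | yes refl | yes refl = yes along
  ... | no n     | _        | _        = no λ { along → n refl }
  ... | yes _    | no n     | _        = no λ { along → n refl }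
  ... | yes _    | yes _    | no n     = no λ { along → n refl }
  below? hub (int b a h) with suc (suc h) ≟ len b a
  ... | yes eq = yes (final eq)
  ... | no  n  = no λ { (final eq) → n eq }
  below? hub (pend j) = yes leaf
  below? (int b a (suc h)) (cen _) = no λ ()
  below? (int b a zero) (int _ _ _) = no λ ()
  below? (int b a h) hub = no λ ()
  below? (int b a h) (pend _) = no λ ()
  below? hub hub = no λ ()
  below? hub (cen _) = no λ ()
  below? (cen _) _ = no λ ()
  below? (pend _) _ = no λ ()

  Adj : Vertex → Vertex → Set
  Adj u v = Below u v ⊎ Below v u

  adj? : ∀ u v → Dec (Adj u v)
  adj? u v = below? u v ⊎-dec below? v u

  Below-irrefl : ∀ {v} → ¬ Below v v
  Below-irrefl ()

  ⌊⌋-true : ∀ {P : Set} (d : Dec P) → ⌊ d ⌋ ≡ true → P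
  ⌊⌋-true (yes p) _ = p

  ⌊⌋-true⁺ : ∀ {P : Set} (d : Dec P) → P → ⌊ d ⌋ ≡ true
  ⌊⌋-true⁺ (yes _) _ = refl
  ⌊⌋-true⁺ (no ¬p) p = ⊥-elim (¬p p)

  ⌊⌋-false : ∀ {P : Set} (d : Dec P) → ¬ P → ⌊ d ⌋ ≡ false
  ⌊⌋-false (yes p) ¬p = ⊥-elim (¬p p)
  ⌊⌋-false (no _)  _  = refl

  ⌊⌋-cong : ∀ {P Q : Set} (d : Dec P) (e : Dec Q) → (P → Q) → (Q → P) → ⌊ d ⌋ ≡ ⌊ e ⌋
  ⌊⌋-cong (yes _) (yes _) f g = refl
  ⌊⌋-cong (yes p) (no ¬q) f g = ⊥-elim (¬q (f p))
  ⌊⌋-cong (no ¬p) (yes q) f g = ⊥-elim (¬p (g q))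
  ⌊⌋-cong (no _)  (no _)  f g = refl

  module OnFin {n} (φ : Fin n → Vertex) (φ-injective : ∀ {i j} → φ i ≡ φ j → i ≡ j)
    (φ-valid : ∀ i {b a h} → φ i ≡ int b a h → Ok b × suc (suc h) ≤ len b a) where

    graph : Graph n
    graph = record
      { adj = λ i j → ⌊ adj? (φ i) (φ j) ⌋
      ; sym = λ i j → ⌊⌋-cong (adj? (φ i) (φ j)) (adj? (φ j) (φ i)) swap swap
      ; irrefl = λ i → ⌊⌋-false (adj? (φ i) (φ i)) [ Below-irrefl , Below-irrefl ]′ }

    adj⇒Adj : ∀ {i j} → adj graph i j ≡ true → Adj (φ i) (φ j)
    adj⇒Adj {i} {j} = ⌊⌋-true (adj? (φ i) (φ j))

    Adj⇒adj : ∀ {i j} → Adj (φ i) (φ j) → adj graph i j ≡ true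
    Adj⇒adj {i} {j} a = ⌊⌋-true⁺ (adj? (φ i) (φ j)) a

    -- The point at distance h from the centre, 0 ≤ h ≤ len b a.
    point : Block → Arm → ℕ → Vertex
    point b a zero    = cen b
    point b a (suc h) with suc h ≟ len b a
    ... | yes _ = hub
    ... | no  _ = int b a h

    module CycleShape {m} (c : Cycle graph m) where

      open OnCycle c using (L; after; after-L; after-injective; after-surjective)

      module From (s : Fin L) where

        y : ℕ → Vertex
        y j = φ (vtx c (after s j))

        y-adj : ∀ j → Adj (y j) (y (suc j))
        y-adj j = adj⇒Adj (closed c (after s j))

        y-turn : ∀ j → y (suc (suc j)) ≢ y j
        y-turn j eq = cnext-cnext-≢ (after s j) (distinct c (φ-injective eq))

        y-injective : ∀ {i j} → i < L → j < L → y i ≡ y j → i ≡ j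
        y-injective i< j< eq = after-injective s i< j< (distinct c (φ-injective eq))

      height : Vertex → ℕ
      height (int b a h) = suc h
      height _           = 0

      -- Without the hub the graph is a forest: a highest vertex of the cycle has no neighbour on it
      -- that is higher, and at most one neighbour that is lower.
      hub-on-cycle : ¬ (∀ i → φ (vtx c i) ≢ hub)
      hub-on-cycle noHub with Fin-maximum (λ i → height (φ (vtx c i)))
      ... | i , max with after-surjective i i
      ...   | _ = top (y-adj 0) (y-adj 1) (y-turn 0) (noHub _) (noHub _) (noHub _) (max′ 0) (max′ 2)
        where
        -- The predecessor of `i`, as `L` is `3 + m`; so `y 1` is the highest vertex, between its
        -- neighbours `y 0` and `y 2`.
        before : Fin L
        before = after i (2 + m)
        open From before
        at-1 : after before 1 ≡ i
        at-1 = after-L i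
        max′ : ∀ j → height (y j) ≤ height (y 1)
        max′ j = subst (λ t → height (y j) ≤ height (φ (vtx c t))) (sym at-1) (max (after before j))
        top : ∀ {u v w} → Adj u v → Adj v w → w ≢ u → u ≢ hub → v ≢ hub → w ≢ hub → height u ≤ height v → height w ≤ height v → ⊥
        top (inj₁ start) _ _ _ _ _ () _
        top (inj₁ along) _ _ _ _ _ le _ = 1+n≰n le
        top (inj₁ (final _)) _ _ n _ _ _ _ = n refl
        top (inj₁ leaf) _ _ n _ _ _ _ = n refl
        top (inj₂ _) (inj₂ start) _ _ _ _ _ ()
        top (inj₂ _) (inj₂ along) _ _ _ _ _ le = 1+n≰n le
        top (inj₂ _) (inj₂ (final _)) _ _ _ n _ _ = n refl
        top (inj₂ _) (inj₂ leaf) _ _ _ n _ _ = n refl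
        top (inj₂ start) (inj₁ start) ne _ _ _ _ _ = ne refl
        top (inj₂ along) (inj₁ along) ne _ _ _ _ _ = ne refl
        top (inj₂ (final _)) _ _ _ n _ _ _ = n refl
        top (inj₂ leaf) _ _ _ n _ _ _ = n refl

      -- A cycle read from the hub: inwards along the arm `a` to the centre of a block, outwards
      -- along another arm `a′` of the same block. Its length is therefore one of the sums of arm
      -- lengths.
      record Shape : Set where
        field
          s       : Fin L
          b       : Block
          a a′    : Arm
          ok      : Ok b
          long    : 2 ≤ len b a
          long′   : 2 ≤ len b a′
          a≢a′    : a ≢ a′
          L≡      : L ≡ len b a + len b a′
          inward  : ∀ j → j ≤ len b a → From.y s j ≡ point b a (len b a ∸ j)
          outward : ∀ j → j ≤ len b a′ → From.y s (len b a + j) ≡ point b a′ j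

      point-int : ∀ {b a h} → suc (suc h) ≤ len b a → point b a (suc h) ≡ int b a h
      point-int {b} {a} {h} h< with suc h ≟ len b a
      ... | yes eq = ⊥-elim (<⇒≢ h< eq)
      ... | no _   = refl

      point-end : ∀ {b a h} → suc h ≡ len b a → point b a (suc h) ≡ hub
      point-end {b} {a} {h} eq with suc h ≟ len b a
      ... | yes _ = refl
      ... | no n  = ⊥-elim (n eq)

      inner : ∀ {b a h u} → suc h ≤ len b a → Below (int b a h) u → u ≡ point b a h
      inner _ start = refl
      inner h< along = sym (point-int h<)

      module Walk (s : Fin L) (at-hub : φ (vtx c s) ≡ hub) where

        open From s

        valid : ∀ j {b a h} → y j ≡ int b a h → Ok b × suc (suc h) ≤ len b a
        valid j = φ-valid (vtx c (after s j))

        -- An interior vertex of an arm has a unique neighbour on the side of the hub. A cycle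
        -- arriving from there cannot turn back and must continue to the centre.
        down : ∀ {b a} h j → y (suc j) ≡ int b a h → Below (y j) (y (suc j)) →
          ∀ i → i ≤ suc h → y (suc j + i) ≡ point b a (suc h ∸ i)
        down {b} {a} h j eq _ zero _ = trans (cong y (+-identityʳ (suc j))) (trans eq (sym (point-int (proj₂ (valid (suc j) eq)))))
        down {b} {a} h j eq above (suc i) (s≤s i≤) = trans (cong y (+-suc (suc j) i)) (continue h eq i i≤ toward)
          where
          toward : Below (y (suc j)) (y (suc (suc j)))
          toward with y-adj (suc j)
          ... | inj₁ t = t
          ... | inj₂ t = ⊥-elim (y-turn j (unique (subst (Below (y (suc (suc j)))) eq t) (subst (Below (y j)) eq above) refl refl))
            where
            unique : ∀ {x z} → Below x (int b a h) → Below z (int b a h) → y (suc (suc j)) ≡ x → y j ≡ z → x ≡ z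
            unique along along _ _ = refl
            unique (final _) (final _) _ _ = refl
            unique along (final e) q _ = ⊥-elim (<⇒≢ (proj₂ (valid (suc (suc j)) q)) e)
            unique (final e) along _ q = ⊥-elim (<⇒≢ (proj₂ (valid j q)) e)
          continue : ∀ h → y (suc j) ≡ int b a h → ∀ i → i ≤ h → Below (y (suc j)) (y (suc (suc j))) →
            y (suc (suc j) + i) ≡ point b a (h ∸ i)
          continue zero    eq zero _ t = trans (cong y (+-identityʳ (suc (suc j)))) (inner (<⇒≤ (proj₂ (valid (suc j) eq))) (subst (λ z → Below z (y (suc (suc j)))) eq t))
          continue (suc h) eq i  i≤ t = down h (suc j)
            (trans (inner (<⇒≤ (proj₂ (valid (suc j) eq))) (subst (λ z → Below z (y (suc (suc j)))) eq t)) (point-int (<⇒≤ (proj₂ (valid (suc j) eq))))) t i i≤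

        up : ∀ {b a} d h j → suc (suc h) + d ≡ len b a → y (suc j) ≡ int b a h → Below (y (suc j)) (y j) →
          ∀ i → i ≤ suc d → y (suc j + i) ≡ point b a (suc h + i)
        up {b} {a} d h j _ eq _ zero _ = trans (cong y (+-identityʳ (suc j)))
          (trans eq (trans (sym (point-int (proj₂ (valid (suc j) eq)))) (cong (point b a) (sym (+-identityʳ (suc h))))))
        up {b} {a} d h j len≡ eq under (suc i) (s≤s i≤) = trans (cong y (+-suc (suc j) i))
          (trans (continue d len≡ away refl i i≤) (cong (point b a) (sym (+-suc (suc h) i))))
          where
          away : Below (y (suc (suc j))) (int b a h)
          away with y-adj (suc j)
          ... | inj₂ t = subst (Below (y (suc (suc j)))) eq t
          ... | inj₁ t = ⊥-elim (y-turn j (trans (inner h< (subst (λ z → Below z (y (suc (suc j)))) eq t)) (sym (inner h< (subst (λ z → Below z (y j)) eq under)))))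
            where h< = <⇒≤ (proj₂ (valid (suc j) eq))
          continue : ∀ {z} d → suc (suc h) + d ≡ len b a → Below z (int b a h) → y (suc (suc j)) ≡ z → ∀ i → i ≤ d →
            y (suc (suc j) + i) ≡ point b a (suc (suc h) + i)
          continue zero    e (final _) q zero _ = trans (cong y (+-identityʳ (suc (suc j)))) (trans q
            (sym (trans (cong (point b a) (+-identityʳ (suc (suc h)))) (point-end (trans (sym (+-identityʳ _)) e)))))
          continue zero    e along q i _ = ⊥-elim (<⇒≢ (proj₂ (valid (suc (suc j)) q)) (trans (sym (+-identityʳ _)) e))
          continue (suc d) e (final e′) q i _ = ⊥-elim (m+1+n≢m (suc (suc h)) (trans e (sym e′)))
          continue (suc d) e along q i i≤ = up d (suc h) (suc j) (trans (sym (+-suc (suc (suc h)) d)) e) q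
            (subst₂ Below (sym q) (sym eq) along) i i≤

        leave : ∃[ b ] ∃[ a ] ∃[ h ] (y 1 ≡ int b a h × suc (suc h) ≡ len b a)
        leave = go (y-adj 0) (y-adj 1) (y-turn 0) at-hub refl
          where
          go : ∀ {x z w} → Adj x z → Adj z w → w ≢ x → x ≡ hub → y 1 ≡ z → ∃[ b ] ∃[ a ] ∃[ h ] (y 1 ≡ int b a h × suc (suc h) ≡ len b a)
          go (inj₁ (final e)) _ _ _ q = _ , _ , _ , q , e
          go (inj₁ leaf) (inj₂ leaf) n _ _ = ⊥-elim (n refl)
          go (inj₁ leaf) (inj₁ ())
          go (inj₁ start) _ _ ()
          go (inj₁ along) _ _ ()
          go (inj₂ start) _ _ ()
          go (inj₂ along) _ _ ()
          go (inj₂ (final _)) _ _ ()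
          go (inj₂ leaf) _ _ ()

        shape : Shape
        shape with leave
        ... | b , a , h , q , len≡ = finish (y-adj (suc (suc h)))
          where
          start-above : Below (y 0) (y 1)
          start-above = subst₂ Below (sym at-hub) (sym q) (final len≡)
          first : ∀ i → i ≤ suc h → y (suc i) ≡ point b a (suc h ∸ i)
          first = down h 0 q start-above
          inward : ∀ j → j ≤ len b a → y j ≡ point b a (len b a ∸ j)
          inward zero    _  = trans at-hub (sym (trans (cong (point b a) (sym len≡)) (point-end len≡)))
          inward (suc j) j≤ = trans (first j (s≤s⁻¹ (≤-trans j≤ (≤-reflexive (sym len≡))))) (cong (λ l → point b a (l ∸ suc j)) len≡)
          at-centre : y (suc (suc h)) ≡ cen b
          at-centre = trans (first (suc h) ≤-refl) (cong (point b a) (n∸n≡0 (suc h)))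
          before-centre : y (suc h) ≡ int b a 0
          before-centre = trans (first h (n≤1+n h)) (trans (cong (point b a) (m+n∸n≡m 1 h))
            (point-int (≤-trans (s≤s (s≤s z≤n)) (≤-reflexive len≡))))
          finish : Adj (y (suc (suc h))) (y (suc (suc (suc h)))) → Shape
          finish (inj₁ t) with subst (λ z → Below z (y (suc (suc (suc h))))) at-centre t
          ... | ()
          finish (inj₂ t) = out (subst (Below (y (suc (suc (suc h))))) at-centre t) refl
            where
            out : ∀ {z} → Below z (cen b) → y (suc (suc (suc h))) ≡ z → Shape
            out (start {a = a′}) q′ = record
              { s = s ; b = b ; a = a ; a′ = a′ ; ok = proj₁ (valid 1 q) ; long = long ; long′ = long′ ; a≢a′ = a≢a′
              ; L≡ = ≤-antisym L≤ L≥ ; inward = inward ; outward = outward }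
              where
              long : 2 ≤ len b a
              long = ≤-trans (s≤s (s≤s z≤n)) (≤-reflexive len≡)
              long′ : 2 ≤ len b a′
              long′ = proj₂ (valid (suc (suc (suc h))) q′)
              a≢a′ : a ≢ a′
              a≢a′ refl = y-turn (suc h) (trans q′ (sym before-centre))
              d≡ = m≤n⇒∃[o]m+o≡n long′
              second : ∀ i → i ≤ suc (proj₁ d≡) → y (suc (suc (suc h)) + i) ≡ point b a′ (1 + i)
              second = up (proj₁ d≡) 0 (suc (suc h)) (proj₂ d≡) q′ t
              outward : ∀ j → j ≤ len b a′ → y (len b a + j) ≡ point b a′ j
              outward zero _ = trans (cong y (trans (+-identityʳ _) (sym len≡))) at-centre
              outward (suc j) j≤ = trans (cong y (trans (+-suc (len b a) j) (cong (λ l → suc l + j) (sym len≡))))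
                (second j (s≤s⁻¹ (≤-trans j≤ (≤-reflexive (sym (proj₂ d≡))))))
              end-hub : y (len b a + len b a′) ≡ hub
              end-hub = trans (outward (len b a′) ≤-refl) (hub-end (len b a′) refl (<⇒≤ long′))
                where
                hub-end : ∀ l → l ≡ len b a′ → 1 ≤ l → point b a′ l ≡ hub
                hub-end (suc l) e _ = point-end e
              point≢hub : ∀ {x l} → l < len b x → point b x l ≢ hub
              point≢hub {l = zero} _ ()
              point≢hub {x} {suc l} l< e with trans (sym (point-int {b} {x} {l} l<)) e
              ... | ()
              y≢hub : ∀ j → 0 < j → j < len b a + len b a′ → y j ≢ hub
              y≢hub j 0<j j< e with j ≤? len b a
              ... | yes j≤ = point≢hub (∸-monoʳ-< {len b a} {j} {0} 0<j j≤) (trans (sym (inward j j≤)) e)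
              ... | no j≰ with m≤n⇒∃[o]m+o≡n (<⇒≤ (≰⇒> j≰))
              ...   | i , refl = point≢hub i< (trans (sym (outward i (<⇒≤ i<))) e)
                where i< = +-cancelˡ-< (len b a) i (len b a′) j<
              -- The walk is at the hub at `L` and at the sum of the two arm lengths, and at no
              -- positive time before that sum; a smaller sum would repeat a vertex before `L`.
              L≥ : len b a + len b a′ ≤ L
              L≥ = ≮⇒≥ (λ L< → y≢hub L (s≤s z≤n) L< (trans (cong (φ ∘ vtx c) (after-L s)) at-hub))
              L≤ : L ≤ len b a + len b a′
              L≤ = ≮⇒≥ (λ l< → <⇒≢ (≤-trans (s≤s z≤n) (≤-trans long (m≤m+n (len b a) (len b a′))))
                (sym (y-injective l< (s≤s z≤n) (trans end-hub (sym at-hub)))))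

      opaque
        shape : Shape
        shape with FP.any? (λ i → isHub (φ (vtx c i)))
          where
          isHub : ∀ v → Dec (v ≡ hub)
          isHub hub         = yes refl
          isHub (cen _)     = no λ ()
          isHub (int _ _ _) = no λ ()
          isHub (pend _)    = no λ ()
        ... | yes (s , e) = Walk.shape s e
        ... | no none     = ⊥-elim (hub-on-cycle (λ i e → none (i , e)))

      open Shape shape public

      OnArm : Arm → Fin n → Fin n → Set
      OnArm α u v = ∃[ h ] (h < len b α × ((φ u ≡ point b α h × φ v ≡ point b α (suc h))
                                         ⊎ (φ v ≡ point b α h × φ u ≡ point b α (suc h))))

      edge⇒arm : ∀ i → OnArm a (vtx c i) (vtx c (cnext i)) ⊎ OnArm a′ (vtx c i) (vtx c (cnext i))
      edge⇒arm i with after-surjective s i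
      ... | j , j< , refl with suc j ≤? len b a
      ...   | yes j≤ = inj₁ (len b a ∸ suc j , ∸-monoʳ-< {len b a} {suc j} {0} (s≤s z≤n) j≤ ,
                inj₂ (inward (suc j) j≤ , trans (inward j (<⇒≤ j≤)) (cong (point b a) (+-∸-assoc 1 j≤))))
      ...   | no j≰ with m≤n⇒∃[o]m+o≡n (s≤s⁻¹ (≰⇒> j≰))
      ...     | k , refl = inj₂ (k , k< , inj₁ (outward k (<⇒≤ k<) , trans (cong (From.y s) (sym (+-suc (len b a) k))) (outward (suc k) k<)))
        where k< = +-cancelˡ-< (len b a) k (len b a′) (subst (len b a + k <_) L≡ j<)

      CycleEdge-swap : ∀ {u v} → CycleEdge c u v → CycleEdge c v u
      CycleEdge-swap (i , e) = i , swap e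

      arm⇒edge : ∀ {u v} → OnArm a u v → CycleEdge c u v
      arm⇒edge {u} {v} (h , h< , e) = [ go , (λ e → CycleEdge-swap (go e)) ]′ e
        where
        k = len b a ∸ suc h
        back : suc k ≡ len b a ∸ h
        back = sym (+-∸-assoc 1 h<)
        go : ∀ {u v} → φ u ≡ point b a h × φ v ≡ point b a (suc h) → CycleEdge c u v
        go (p , q) = after s k , inj₂
          ( φ-injective (trans (inward k (m∸n≤m (len b a) (suc h))) (trans (cong (point b a) (m∸[m∸n]≡n h<)) (sym q)))
          , φ-injective (trans (inward (suc k) (≤-trans (≤-reflexive back) (m∸n≤m (len b a) h)))
              (trans (cong (point b a) (trans (cong (len b a ∸_) back) (m∸[m∸n]≡n (<⇒≤ h<)))) (sym p))) )

      arm′⇒edge : ∀ {u v} → OnArm a′ u v → CycleEdge c u v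
      arm′⇒edge {u} {v} (h , h< , e) = [ go , (λ e → CycleEdge-swap (go e)) ]′ e
        where
        go : ∀ {u v} → φ u ≡ point b a′ h × φ v ≡ point b a′ (suc h) → CycleEdge c u v
        go (p , q) = after s (len b a + h) , inj₁
          ( φ-injective (trans (outward h (<⇒≤ h<)) (sym p))
          , φ-injective (trans (cong (From.y s) (sym (+-suc (len b a) h))) (trans (outward (suc h) h<) (sym q))) )

    distinctLengths : DistinctCycleLengths graph
    distinctLengths m c d u v = mk⇔ (transfer c d) (transfer d c)
      where
      transfer : ∀ (c d : Cycle graph m) → CycleEdge c u v → CycleEdge d u v
      transfer c d (i , e) with sum-injective C.ok C.a≢a′ C.long C.long′ D.ok D.a≢a′ D.long D.long′ (trans (sym C.L≡) D.L≡)
        where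
        module C = CycleShape c
        module D = CycleShape d
      ... | same = go same (C.edge⇒arm i) e
        where
        module C = CycleShape c
        module D = CycleShape d
        convert : ∀ {α u v} → C.b ≡ D.b → C.OnArm α u v → D.OnArm α u v
        convert eq (h , h< , e) = h , subst (λ b → h < len b _) eq h< ,
          subst (λ b → (φ _ ≡ point b _ h × φ _ ≡ point b _ (suc h)) ⊎ (φ _ ≡ point b _ h × φ _ ≡ point b _ (suc h))) eq e
        place : C.b ≡ D.b × ((C.a ≡ D.a × C.a′ ≡ D.a′) ⊎ (C.a ≡ D.a′ × C.a′ ≡ D.a)) →
          ∀ {u v} → C.OnArm C.a u v ⊎ C.OnArm C.a′ u v → CycleEdge d u v
        place (eq , inj₁ (p , q)) {u} {v} (inj₁ o) = D.arm⇒edge (subst (λ α → D.OnArm α u v) p (convert eq o))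
        place (eq , inj₁ (p , q)) {u} {v} (inj₂ o) = D.arm′⇒edge (subst (λ α → D.OnArm α u v) q (convert eq o))
        place (eq , inj₂ (p , q)) {u} {v} (inj₁ o) = D.arm′⇒edge (subst (λ α → D.OnArm α u v) p (convert eq o))
        place (eq , inj₂ (p , q)) {u} {v} (inj₂ o) = D.arm⇒edge (subst (λ α → D.OnArm α u v) q (convert eq o))
        go : C.b ≡ D.b × ((C.a ≡ D.a × C.a′ ≡ D.a′) ⊎ (C.a ≡ D.a′ × C.a′ ≡ D.a)) →
          C.OnArm C.a (vtx c i) (vtx c (cnext i)) ⊎ C.OnArm C.a′ (vtx c i) (vtx c (cnext i)) →
          (vtx c i ≡ u × vtx c (cnext i) ≡ v) ⊎ (vtx c i ≡ v × vtx c (cnext i) ≡ u) → CycleEdge d u v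
        go same o (inj₁ (refl , refl)) = place same o
        go same o (inj₂ (refl , refl)) = D.CycleEdge-swap (place same o)

-- The lower bound

<-∸⇒+< : ∀ {m} n o → m < n ∸ o → o + m < n
<-∸⇒+< n       zero    m< = m<
<-∸⇒+< (suc n) (suc o) m< = s≤s (<-∸⇒+< n o m<)

gauss : ∀ m → 2 * sumOf id (upTo m) + m ≡ m * m
gauss zero    = refl
gauss (suc m) = begin
  2 * sumOf id (upTo (suc m)) + suc m             ≡⟨ cong (λ s → 2 * s + suc m) (sumOf-upTo-suc id m) ⟩
  2 * (sumOf id (upTo m) + m) + suc m             ≡⟨ e₁ (sumOf id (upTo m)) m ⟩
  (2 * sumOf id (upTo m) + m) + suc (m + m)       ≡⟨ cong (_+ suc (m + m)) (gauss m) ⟩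
  m * m + suc (m + m)                             ≡⟨ e₂ m ⟩
  suc m * suc m                                   ∎
  where
  open ≡-Reasoning
  e₁ : ∀ s m → 2 * (s + m) + suc m ≡ (2 * s + m) + suc (m + m)
  e₁ = solve-∀
  e₂ : ∀ m → m * m + suc (m + m) ≡ suc m * suc m
  e₂ = solve-∀

module Layout (p : ℕ) (0<p : 0 < p) where

  open Lengths p
  open HubGraph p

  -- `cyc i` has length 4 + i, so `i < M` gives the lengths from 4 to 12p - 1. Length 3 is absent
  -- because every arm has an interior vertex.
  M : ℕ
  M = 12 * p ∸ 4

  M+4≡ : M + 4 ≡ 12 * p
  M+4≡ = m∸n+n≡m (≤-trans (s≤s (s≤s (s≤s (s≤s (z≤n {8}))))) (*-monoʳ-≤ 12 0<p))

  thetas blocks : List Block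
  thetas = map θ₀ (upTo (2 * p)) ++ map θ₁ (upTo (2 * p))
  blocks = map cyc (upTo M) ++ thetas

  thetas⊆ : ∀ {b} → b ∈ thetas → b ∈ blocks
  thetas⊆ = ∈-++⁺ʳ (map cyc (upTo M))

  thetas-cases : ∀ {b} → b ∈ thetas → ∃[ i ] (i < 2 * p × (b ≡ θ₀ i ⊎ b ≡ θ₁ i))
  thetas-cases b∈ with ∈-++⁻ (map θ₀ (upTo (2 * p))) b∈
  ... | inj₁ q = let i , i∈ , e = ∈-map⁻ θ₀ q in i , ∈-upTo⁻ i∈ , inj₁ e
  ... | inj₂ q = let i , i∈ , e = ∈-map⁻ θ₁ q in i , ∈-upTo⁻ i∈ , inj₂ e

  blocks-cases : ∀ {b} → b ∈ blocks → (∃[ i ] (i < M × b ≡ cyc i)) ⊎ b ∈ thetas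
  blocks-cases b∈ with ∈-++⁻ (map cyc (upTo M)) b∈
  ... | inj₁ q = let i , i∈ , e = ∈-map⁻ cyc q in inj₁ (i , ∈-upTo⁻ i∈ , e)
  ... | inj₂ q = inj₂ q

  thetas-unique : Unique thetas
  thetas-unique = Unique-++ (Uniq.map⁺ (λ { refl → refl }) (Uniq.upTo⁺ (2 * p))) (Uniq.map⁺ (λ { refl → refl }) (Uniq.upTo⁺ (2 * p))) apart
    where
    apart : ∀ {b} → b ∈ map θ₀ (upTo (2 * p)) → b ∈ map θ₁ (upTo (2 * p)) → ⊥
    apart x y with ∈-map⁻ θ₀ x | ∈-map⁻ θ₁ y
    ... | _ , _ , refl | _ , _ , ()

  blocks-unique : Unique blocks
  blocks-unique = Unique-++ (Uniq.map⁺ (λ { refl → refl }) (Uniq.upTo⁺ M)) thetas-unique apart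
    where
    apart : ∀ {b} → b ∈ map cyc (upTo M) → b ∈ thetas → ⊥
    apart x y with ∈-map⁻ cyc x | thetas-cases y
    ... | _ , _ , refl | _ , _ , inj₁ ()
    ... | _ , _ , refl | _ , _ , inj₂ ()

  blocks-ok : ∀ {b} → b ∈ blocks → Ok b
  blocks-ok b∈ with blocks-cases b∈
  ... | inj₁ (i , i< , refl) = <-∸⇒+< (12 * p) 4 i<
  ... | inj₂ t with thetas-cases t
  ...   | i , i< , inj₁ refl = i<
  ...   | i , i< , inj₂ refl = i<

  arms₀ arms₁ arms₂ arms : List (Block × Arm)
  arms₀ = map (_, a₀) blocks
  arms₁ = map (_, a₁) blocks
  arms₂ = map (_, a₂) thetas
  arms = arms₀ ++ (arms₁ ++ arms₂)

  arms-cases : ∀ {x} → x ∈ arms → ∃[ b ] (b ∈ blocks × (x ≡ (b , a₀) ⊎ x ≡ (b , a₁) ⊎ (x ≡ (b , a₂) × b ∈ thetas)))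
  arms-cases x∈ with ∈-++⁻ arms₀ x∈
  ... | inj₁ y = let b , b∈ , e = ∈-map⁻ (_, a₀) y in b , b∈ , inj₁ e
  ... | inj₂ y with ∈-++⁻ arms₁ y
  ...   | inj₁ z = let b , b∈ , e = ∈-map⁻ (_, a₁) z in b , b∈ , inj₂ (inj₁ e)
  ...   | inj₂ z = let b , b∈ , e = ∈-map⁻ (_, a₂) z in b , thetas⊆ b∈ , inj₂ (inj₂ (e , b∈))

  arms-unique : Unique arms
  arms-unique = Unique-++ (Uniq.map⁺ (λ { refl → refl }) blocks-unique)
    (Unique-++ (Uniq.map⁺ (λ { refl → refl }) blocks-unique) (Uniq.map⁺ (λ { refl → refl }) thetas-unique) apart′) apart
    where
    apart′ : ∀ {x} → x ∈ arms₁ → x ∈ arms₂ → ⊥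
    apart′ x y with ∈-map⁻ (_, a₁) x | ∈-map⁻ (_, a₂) y
    ... | _ , _ , refl | _ , _ , ()
    apart : ∀ {x} → x ∈ arms₀ → x ∈ arms₁ ++ arms₂ → ⊥
    apart x y with ∈-map⁻ (_, a₀) x | ∈-++⁻ arms₁ y
    ... | _ , _ , refl | inj₁ z with ∈-map⁻ (_, a₁) z
    ...   | _ , _ , ()
    apart x y | _ , _ , refl | inj₂ z with ∈-map⁻ (_, a₂) z
    ...   | _ , _ , ()

  two≤ : ∀ k {i} → 2 ≤ k → 2 ≤ k * p + i
  two≤ k 2≤k = ≤-trans 2≤k (≤-trans (≤-trans (≤-reflexive (sym (*-identityʳ k))) (*-monoʳ-≤ k 0<p)) (m≤m+n (k * p) _))

  arms-ok : ∀ {b a} → (b , a) ∈ arms → b ∈ blocks × 2 ≤ len b a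
  arms-ok x∈ with arms-cases x∈
  ... | b , b∈ , e = subst (_∈ blocks) (first e) b∈ , long b∈ e
    where
    two : ∀ {k} → 2 ≤ 2 + k
    two = s≤s (s≤s z≤n)
    first : ∀ {b′ a} → (b′ , a) ≡ (b , a₀) ⊎ (b′ , a) ≡ (b , a₁) ⊎ ((b′ , a) ≡ (b , a₂) × b ∈ thetas) → b ≡ b′
    first (inj₁ refl) = refl
    first (inj₂ (inj₁ refl)) = refl
    first (inj₂ (inj₂ (refl , _))) = refl
    long : ∀ {b b′ a} → b ∈ blocks → (b′ , a) ≡ (b , a₀) ⊎ (b′ , a) ≡ (b , a₁) ⊎ ((b′ , a) ≡ (b , a₂) × b ∈ thetas) → 2 ≤ len b′ a
    long {cyc i} _ (inj₁ refl) = two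
    long {θ₀ i} _ (inj₁ refl) = ≤-trans (two≤ 11 {0} two) (≤-reflexive (+-identityʳ _))
    long {θ₁ i} _ (inj₁ refl) = ≤-trans (two≤ 15 {0} two) (≤-reflexive (+-identityʳ _))
    long {cyc i} _ (inj₂ (inj₁ refl)) = ≤-refl
    long {θ₀ i} _ (inj₂ (inj₁ refl)) = two≤ 5 two
    long {θ₁ i} _ (inj₂ (inj₁ refl)) = two≤ 5 two
    long {cyc i} _ (inj₂ (inj₂ (refl , t))) with thetas-cases t
    ... | _ , _ , inj₁ ()
    ... | _ , _ , inj₂ ()
    long {θ₀ i} _ (inj₂ (inj₂ (refl , _))) = two≤ 7 two
    long {θ₁ i} _ (inj₂ (inj₂ (refl , _))) = ≤-trans (two≤ 7 {1} two) (m≤m+n _ i)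

  armInts : Block × Arm → List Vertex
  armInts (b , a) = map (int b a) (upTo (len b a ∸ 1))

  intsOf : List (Block × Arm) → List Vertex
  intsOf []       = []
  intsOf (x ∷ xs) = armInts x ++ intsOf xs

  intsOf-∈ : ∀ {xs v} → v ∈ intsOf xs → ∃[ b ] ∃[ a ] ∃[ h ] (v ≡ int b a h × (b , a) ∈ xs × h < len b a ∸ 1)
  intsOf-∈ {(b , a) ∷ xs} v∈ with ∈-++⁻ (armInts (b , a)) v∈
  ... | inj₁ y = let h , h∈ , e = ∈-map⁻ (int b a) y in b , a , h , e , here refl , ∈-upTo⁻ h∈
  ... | inj₂ y = let b′ , a′ , h , e , x∈ , h< = intsOf-∈ {xs} y in b′ , a′ , h , e , there x∈ , h<

  ∈-intsOf : ∀ {xs b a h} → (b , a) ∈ xs → h < len b a ∸ 1 → int b a h ∈ intsOf xs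
  ∈-intsOf {x ∷ xs} (here refl) h< = ∈-++⁺ˡ (∈-map⁺ (int _ _) (∈-upTo⁺ h<))
  ∈-intsOf {x ∷ xs} (there x∈)  h< = ∈-++⁺ʳ (armInts x) (∈-intsOf x∈ h<)

  intsOf-unique : ∀ {xs} → Unique xs → Unique (intsOf xs)
  intsOf-unique {[]}           _        = []
  intsOf-unique {(b , a) ∷ xs} (x∉ ∷ u) = Unique-++ (Uniq.map⁺ (λ { refl → refl }) (Uniq.upTo⁺ (len b a ∸ 1))) (intsOf-unique u) apart
    where
    apart : ∀ {v} → v ∈ armInts (b , a) → v ∈ intsOf xs → ⊥
    apart y z with ∈-map⁻ (int b a) y | intsOf-∈ {xs} z
    ... | _ , _ , refl | _ , _ , _ , refl , x∈ , _ = All.lookup x∉ x∈ refl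

  intsOf-length : ∀ xs → length (intsOf xs) ≤ sumOf (λ x → len (proj₁ x) (proj₂ x)) xs
  intsOf-length []             = z≤n
  intsOf-length ((b , a) ∷ xs) = begin
    length (armInts (b , a) ++ intsOf xs)       ≡⟨ length-++ (armInts (b , a)) ⟩
    length (armInts (b , a)) + length (intsOf xs) ≤⟨ +-mono-≤ (≤-trans (≤-reflexive (trans (length-map (int b a) (upTo (len b a ∸ 1))) (length-upTo (len b a ∸ 1)))) (m∸n≤m (len b a) 1)) (intsOf-length xs) ⟩
    len b a + sumOf (λ x → len (proj₁ x) (proj₂ x)) xs ∎
    where open ≤-Reasoning

  ints : List Vertex
  ints = intsOf arms

  length-thetas : length thetas ≡ 4 * p
  length-thetas = trans (length-++ (map θ₀ (upTo (2 * p)))) (trans (cong₂ _+_ (len-map θ₀) (len-map θ₁)) (e p))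
    where
    len-map : ∀ (f : ℕ → Block) → length (map f (upTo (2 * p))) ≡ 2 * p
    len-map f = trans (length-map f (upTo (2 * p))) (length-upTo (2 * p))
    e : ∀ p → 2 * p + 2 * p ≡ 4 * p
    e = solve-∀

  length-blocks : length blocks ≡ M + 4 * p
  length-blocks = trans (length-++ (map cyc (upTo M))) (cong₂ _+_ (trans (length-map cyc (upTo M)) (length-upTo M)) length-thetas)

  -- The arms of the spiders have total length about 108p², those of the single cycles about 72p².
  -- The excess of edges will be about 20p, which explains √(20n/9) for n = 180p².
  size-bound : suc (length blocks + length ints) ≤ 180 * (p * p) + 8 * p
  size-bound = *-cancelˡ-≤ 2 (begin
    2 * suc (length blocks + length ints)  ≤⟨ *-monoʳ-≤ 2 (s≤s (+-mono-≤ (≤-reflexive length-blocks) (≤-trans (intsOf-length arms) (≤-reflexive total)))) ⟩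
    2 * suc (M + 4 * p + Σlen)             ≤⟨ ≤-from-excess {P = 0} 18 z≤n closed-form ⟩
    2 * (180 * (p * p) + 8 * p)            ∎)
    where
    open ≤-Reasoning
    T₁ = sumOf id (upTo M)
    T₂ = sumOf id (upTo (2 * p))
    Σlen = (M * 2 + T₁ + (2 * p * (11 * p) + 2 * p * (15 * p)))
         + ((M * 2 + ((2 * p * (5 * p) + T₂) + (2 * p * (5 * p) + T₂))) + ((2 * p * (7 * p) + T₂) + (2 * p * (7 * p + 1) + T₂)))
    affine : ∀ c m → sumOf (λ i → c + i) (upTo m) ≡ m * c + sumOf id (upTo m)
    affine c m = trans (sumOf-+ (λ _ → c) id (upTo m)) (cong (_+ sumOf id (upTo m))
      (trans (sumOf-const c (upTo m)) (cong (_* c) (length-upTo m))))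
    constant : ∀ c m → sumOf (λ _ → c) (upTo m) ≡ m * c
    constant c m = trans (sumOf-const c (upTo m)) (cong (_* c) (length-upTo m))
    lens : Block × Arm → ℕ
    lens x = len (proj₁ x) (proj₂ x)
    over-thetas : ∀ a → sumOf lens (map (_, a) thetas) ≡ sumOf (λ i → len (θ₀ i) a) (upTo (2 * p)) + sumOf (λ i → len (θ₁ i) a) (upTo (2 * p))
    over-thetas a = trans (sumOf-map lens (_, a) thetas) (trans (sumOf-++ (λ b → len b a) (map θ₀ (upTo (2 * p))) _)
      (cong₂ _+_ (sumOf-map (λ b → len b a) θ₀ (upTo (2 * p))) (sumOf-map (λ b → len b a) θ₁ (upTo (2 * p)))))
    over-blocks : ∀ a → sumOf lens (map (_, a) blocks) ≡ sumOf (λ i → len (cyc i) a) (upTo M)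
      + (sumOf (λ i → len (θ₀ i) a) (upTo (2 * p)) + sumOf (λ i → len (θ₁ i) a) (upTo (2 * p)))
    over-blocks a = trans (sumOf-map lens (_, a) blocks) (trans (sumOf-++ (λ b → len b a) (map cyc (upTo M)) thetas)
      (cong₂ _+_ (sumOf-map (λ b → len b a) cyc (upTo M)) (trans (sym (sumOf-map lens (_, a) thetas)) (over-thetas a))))
    total : sumOf lens arms ≡ Σlen
    total = trans (sumOf-++ lens arms₀ _) (cong₂ _+_
      (trans (over-blocks a₀) (cong₂ _+_ (affine 2 M) (cong₂ _+_ (constant (11 * p) (2 * p)) (constant (15 * p) (2 * p)))))
      (trans (sumOf-++ lens arms₁ arms₂) (cong₂ _+_
        (trans (over-blocks a₁) (cong₂ _+_ (constant 2 M) (cong₂ _+_ (affine (5 * p) (2 * p)) (affine (5 * p) (2 * p)))))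
        (trans (over-thetas a₂) (cong₂ _+_ (affine (7 * p) (2 * p)) (affine (7 * p + 1) (2 * p)))))))
    closed-form : 2 * suc (M + 4 * p + Σlen) + 0 + 18 ≡ 2 * (180 * (p * p) + 8 * p) + 0
    -- The added term completes `2 * T₁` and the four copies of `2 * T₂` to the left-hand sides of
    -- `gauss`.
    closed-form = +-cancelʳ-≡ (M + 8 * p) _ _ (trans (e₁ M p T₁ T₂) (trans
      (cong₂ (λ x y → 20 + 10 * M + 12 * p + x + 200 * (p * p) + 4 * y) (gauss M) (gauss (2 * p)))
      (trans (e₂ M p) (trans (cong (λ t → t * t + t + M + 12 * p + 216 * (p * p)) M+4≡) (e₃ M p)))))
      where
      e₁ : ∀ M p T₁ T₂ → 2 * suc (M + 4 * p + ((M * 2 + T₁ + (2 * p * (11 * p) + 2 * p * (15 * p)))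
         + ((M * 2 + ((2 * p * (5 * p) + T₂) + (2 * p * (5 * p) + T₂))) + ((2 * p * (7 * p) + T₂) + (2 * p * (7 * p + 1) + T₂))))) + 0 + 18 + (M + 8 * p)
         ≡ 20 + 10 * M + 12 * p + (2 * T₁ + M) + 200 * (p * p) + 4 * (2 * T₂ + 2 * p)
      e₁ = solve-∀
      e₂ : ∀ M p → 20 + 10 * M + 12 * p + M * M + 200 * (p * p) + 4 * (2 * p * (2 * p)) ≡ (M + 4) * (M + 4) + (M + 4) + M + 12 * p + 216 * (p * p)
      e₂ = solve-∀
      e₃ : ∀ M p → 12 * p * (12 * p) + 12 * p + M + 12 * p + 216 * (p * p) ≡ 2 * (180 * (p * p) + 8 * p) + 0 + (M + 8 * p)
      e₃ = solve-∀

  -- A pendant vertex adds one vertex and one edge and no cycle, so `q` of them adjust the order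
  -- without changing the excess.
  module Padded (q : ℕ) where

    pends children rest layout : List Vertex
    pends = map pend (upTo q)
    children = ints ++ pends
    rest = map cen blocks ++ children
    layout = hub ∷ rest

    data InLayout : Vertex → Set where
      isHub  : InLayout hub
      isCen  : ∀ {b} → b ∈ blocks → InLayout (cen b)
      isInt  : ∀ {b a h} → (b , a) ∈ arms → h < len b a ∸ 1 → InLayout (int b a h)
      isPend : ∀ {j} → InLayout (pend j)

    children-view : ∀ {v} → v ∈ children → (∃[ b ] ∃[ a ] ∃[ h ] (v ≡ int b a h × (b , a) ∈ arms × h < len b a ∸ 1)) ⊎ (∃[ j ] v ≡ pend j)
    children-view v∈ with ∈-++⁻ ints v∈
    ... | inj₁ y = inj₁ (intsOf-∈ {arms} y)
    ... | inj₂ y = let j , _ , e = ∈-map⁻ pend y in inj₂ (j , e)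

    view : ∀ {v} → v ∈ layout → InLayout v
    view (here refl) = isHub
    view (there v∈) with ∈-++⁻ (map cen blocks) v∈
    ... | inj₁ y with ∈-map⁻ cen y
    ...   | _ , b∈ , refl = isCen b∈
    view (there v∈) | inj₂ y with children-view y
    ...   | inj₁ (_ , _ , _ , refl , x∈ , h<) = isInt x∈ h<
    ...   | inj₂ (_ , refl) = isPend

    children-unique : Unique children
    children-unique = Unique-++ (intsOf-unique arms-unique) (Uniq.map⁺ (λ { refl → refl }) (Uniq.upTo⁺ q)) apart
      where
      apart : ∀ {v} → v ∈ ints → v ∈ pends → ⊥
      apart y z with intsOf-∈ {arms} y | ∈-map⁻ pend z
      ... | _ , _ , _ , refl , _ | _ , _ , ()

    layout-unique : Unique layout
    layout-unique = All.tabulate (λ v∈ e → no-hub v∈ (sym e)) ∷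
      Unique-++ (Uniq.map⁺ (λ { refl → refl }) blocks-unique) children-unique apart
      where
      apart : ∀ {v} → v ∈ map cen blocks → v ∈ children → ⊥
      apart y z with ∈-map⁻ cen y | children-view z
      ... | _ , _ , refl | inj₁ (_ , _ , _ , () , _)
      ... | _ , _ , refl | inj₂ (_ , ())
      no-hub : ∀ {v} → v ∈ rest → v ≢ hub
      no-hub v∈ refl with ∈-++⁻ (map cen blocks) v∈
      ... | inj₁ y with ∈-map⁻ cen y
      ...   | _ , _ , ()
      no-hub v∈ refl | inj₂ y with children-view y
      ...   | inj₁ (_ , _ , _ , () , _)
      ...   | inj₂ (_ , ())

    φ : Fin (length layout) → Vertex
    φ = lookup layout

    φ-valid : ∀ i {b a h} → φ i ≡ int b a h → Ok b × suc (suc h) ≤ len b a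
    φ-valid i {b} {a} {h} eq with subst InLayout eq (view (∈-lookup i))
    ... | isInt x∈ h< = blocks-ok (proj₁ (arms-ok x∈)) , <-∸⇒+< (len b a) 1 h<

    open OnFin φ (lookup-injective layout-unique) φ-valid public

    -- A name for each edge, for counting edges from below: an interior vertex names its edge
    -- towards the centre, a pendant vertex its only edge, and an arm its last edge at the hub. On
    -- adjacent vertices `tokenOf` is symmetric; elsewhere its value is arbitrary.
    Token : Set
    Token = Vertex ⊎ (Block × Arm)

    tokens : List Token
    tokens = map inj₁ children ++ map inj₂ arms

    tokens-unique : Unique tokens
    tokens-unique = Unique-++ (Uniq.map⁺ (λ { refl → refl }) children-unique) (Uniq.map⁺ (λ { refl → refl }) arms-unique) apart
      where
      apart : ∀ {t} → t ∈ map inj₁ children → t ∈ map inj₂ arms → ⊥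
      apart y z with ∈-map⁻ inj₁ y | ∈-map⁻ inj₂ z
      ... | _ , _ , refl | _ , _ , ()

    tokenOf : Vertex → Vertex → Token
    tokenOf hub (int b a _) = inj₂ (b , a)
    tokenOf (int b a _) hub = inj₂ (b , a)
    tokenOf (pend j) _ = inj₁ (pend j)
    tokenOf _ (pend j) = inj₁ (pend j)
    tokenOf (cen _) v = inj₁ v
    tokenOf v (cen _) = inj₁ v
    tokenOf (int b a h) (int b′ a′ h′) = pick h h′ (inj₁ (int b′ a′ h′)) (inj₁ (int b a h))
    tokenOf u _ = inj₁ u

    hub∈ : hub ∈ layout
    hub∈ = here refl

    cen∈ : ∀ {b} → b ∈ blocks → cen b ∈ layout
    cen∈ b∈ = there (∈-++⁺ˡ (∈-map⁺ cen b∈))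

    child∈ : ∀ {v} → v ∈ children → v ∈ layout
    child∈ v∈ = there (∈-++⁺ʳ (map cen blocks) v∈)

    int∈ : ∀ {b a h} → (b , a) ∈ arms → h < len b a ∸ 1 → int b a h ∈ layout
    int∈ x∈ h< = child∈ (∈-++⁺ˡ (∈-intsOf x∈ h<))

    Realised : Token → Set
    Realised t = ∃[ u ] ∃[ v ] (u ∈ layout × v ∈ layout × Adj u v × tokenOf u v ≡ t × tokenOf v u ≡ t)

    realise : ∀ {t} → t ∈ tokens → Realised t
    realise t∈ with ∈-++⁻ (map inj₁ children) t∈
    ... | inj₂ y with ∈-map⁻ inj₂ y
    ...   | (b , a) , x∈ , refl with m≤n⇒∃[o]m+o≡n (proj₂ (arms-ok x∈))
    ...     | d , eq = hub , int b a d , hub∈ , int∈ x∈ (≤-reflexive (cong (_∸ 1) eq)) , inj₁ (final eq) , refl , refl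
    realise t∈ | inj₁ y with ∈-map⁻ inj₁ y
    ...   | v , v∈ , refl with children-view v∈
    ...     | inj₂ (j , refl) = hub , pend j , hub∈ , child∈ v∈ , inj₁ leaf , refl , refl
    ...     | inj₁ (b , a , zero , refl , x∈ , h<) =
      cen b , int b a 0 , cen∈ (proj₁ (arms-ok x∈)) , child∈ v∈ , inj₂ start , refl , refl
    ...     | inj₁ (b , a , suc h , refl , x∈ , h<) =
      int b a h , int b a (suc h) , int∈ x∈ (<⇒≤ h<) , child∈ v∈ , inj₂ along , pick-< {s = h} ≤-refl , pick-≥ {s = suc h} {h} (n≤1+n h)

    edgeToken : Pair (length layout) → Token
    edgeToken (i , j) = tokenOf (φ i) (φ j)

    tokens⊆ : ∀ {t} → t ∈ tokens → t ∈ map edgeToken (edges graph)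
    tokens⊆ {t} t∈ with realise t∈
    ... | u , v , u∈ , v∈ , a , e₁ , e₂ = subst (_∈ map edgeToken (edges graph)) named
        (∈-map⁺ edgeToken (norm-∈-edges graph {i} {j} (Adj⇒adj {i} {j} (subst₂ Adj pu pv a))))
      where
      i = index u∈
      j = index v∈
      pu : u ≡ φ i
      pu = AnyP.lookup-index u∈
      pv : v ≡ φ j
      pv = AnyP.lookup-index v∈
      named : edgeToken (norm i j) ≡ t
      named with norm-cases i j
      ... | inj₁ eq = trans (cong edgeToken eq) (trans (sym (cong₂ tokenOf pu pv)) e₁)
      ... | inj₂ eq = trans (cong edgeToken eq) (trans (sym (cong₂ tokenOf pv pu)) e₂)

    length-layout : length layout ≡ suc (length blocks + (length ints + q))
    length-layout = cong suc (trans (length-++ (map cen blocks)) (cong₂ _+_ (length-map cen blocks)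
      (trans (length-++ ints) (cong (length ints +_) (trans (length-map pend (upTo q)) (length-upTo q))))))

    -- The excess is the number of arms minus the number of blocks, minus one for the hub: M + 8p -
    -- 1 = 20p - 5.
    edges-many : length layout + 20 * p ≤ edgeCount graph + 5
    edges-many = begin
      length layout + 20 * p                                  ≡⟨ cong (_+ 20 * p) length-layout ⟩
      suc (length blocks + (length ints + q)) + 20 * p        ≡⟨ cong (λ x → suc (x + (length ints + q)) + 20 * p) length-blocks ⟩
      suc (M + 4 * p + (length ints + q)) + 20 * p            ≡⟨ count (length ints + q) ⟩
      ((length ints + q) + ((M + 4 * p) + ((M + 4 * p) + 4 * p))) + 5 ≡⟨ cong (_+ 5) tokens-length ⟨
      length tokens + 5                                       ≤⟨ +-monoˡ-≤ 5 (length-⊆ tokens-unique tokens⊆) ⟩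
      length (map edgeToken (edges graph)) + 5                ≡⟨ cong (_+ 5) (length-map edgeToken (edges graph)) ⟩
      length (edges graph) + 5                                ≡⟨ cong (_+ 5) (edgeCount≡ graph) ⟨
      edgeCount graph + 5                                     ∎
      where
      open ≤-Reasoning
      tokens-length : length tokens ≡ (length ints + q) + ((M + 4 * p) + ((M + 4 * p) + 4 * p))
      tokens-length = trans (length-++ (map inj₁ children)) (cong₂ _+_
        (trans (length-map inj₁ children) (trans (length-++ ints) (cong (length ints +_) (trans (length-map pend (upTo q)) (length-upTo q)))))
        (trans (length-map inj₂ arms) (trans (length-++ arms₀) (cong₂ _+_ (trans (length-map (_, a₀) blocks) length-blocks)
          (trans (length-++ arms₁) (cong₂ _+_ (trans (length-map (_, a₁) blocks) length-blocks) (trans (length-map (_, a₂) thetas) length-thetas)))))))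
      count : ∀ x → suc (M + 4 * p + x) + 20 * p ≡ (x + ((M + 4 * p) + ((M + 4 * p) + 4 * p))) + 5
      count x = trans (e₁ M p x) (trans (cong (λ t → suc (M + 4 * p + x) + (8 * p + t)) (sym M+4≡)) (e₂ M p x))
        where
        e₁ : ∀ M p x → suc (M + 4 * p + x) + 20 * p ≡ suc (M + 4 * p + x) + (8 * p + 12 * p)
        e₁ = solve-∀
        e₂ : ∀ M p x → suc (M + 4 * p + x) + (8 * p + (M + 4)) ≡ (x + ((M + 4 * p) + ((M + 4 * p) + 4 * p))) + 5
        e₂ = solve-∀

    padded : ∀ {n} → suc (length blocks + (length ints + q)) ≡ n →
      ∃[ H ] (DistinctCycleLengths {n} H × n + 20 * p ≤ edgeCount H + 5)
    padded eq = subst (λ n → ∃[ H ] (DistinctCycleLengths {n} H × n + 20 * p ≤ edgeCount H + 5))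
      (trans length-layout eq) (graph , distinctLengths , edges-many)

lower-bound : ∀ p n → 0 < p → 180 * (p * p) + 8 * p ≤ n →
  ∃[ H ] (DistinctCycleLengths {n} H × n + 20 * p ≤ edgeCount H + 5)
lower-bound p n 0<p big = fill (m≤n⇒∃[o]m+o≡n (≤-trans size-bound big))
  where
  open Layout p 0<p
  fill : ∃[ q ] suc (length blocks + length ints) + q ≡ n → ∃[ H ] (DistinctCycleLengths {n} H × n + 20 * p ≤ edgeCount H + 5)
  fill (q , eq) = Padded.padded q (trans (cong suc (sym (+-assoc (length blocks) (length ints) q))) eq)

-- Arithmetic and the main theorem

bracket : ∀ (F : ℕ → ℕ) → (∀ u → u ≤ F u) → ∀ u₀ n → F u₀ ≤ n → ∃[ u ] (u₀ ≤ u × F u ≤ n × n < F (suc u))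
bracket F grow u₀ n F≤ = go (n ∸ u₀) u₀ ≤-refl F≤ ≤-refl
  where
  go : ∀ fuel u → u₀ ≤ u → F u ≤ n → n ∸ u ≤ fuel → ∃[ u ] (u₀ ≤ u × F u ≤ n × n < F (suc u))
  go fuel u u₀≤ F≤ fuel≥ with F (suc u) ≤? n
  ... | no  F≰ = u , u₀≤ , F≤ , ≰⇒> F≰
  ... | yes F≤′ with fuel
  ...   | zero = ⊥-elim (<⇒≱ (≤-trans (grow (suc u)) F≤′) (m∸n≡0⇒m≤n (n≤0⇒n≡0 fuel≥)))
  ...   | suc f = go f (suc u) (m≤n⇒m≤1+n u₀≤) F≤′ (≤-trans (≤-reflexive (sym (∸-+-assoc′ n u))) (∸-monoˡ-≤ 1 fuel≥))
    where
    ∸-+-assoc′ : ∀ n u → n ∸ u ∸ 1 ≡ n ∸ suc u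
    ∸-+-assoc′ n u = trans (∸-+-assoc n u 1) (cong (n ∸_) (+-comm u 1))

-- `a` is the scale, `z` counts the vertices off C, and `u`, a tiny fraction of `a`, will bound the
-- number of hairs through a vertex.
module Arithmetic (a u n L z : ℕ) (a≡ : u * 100000 ≡ a) (a≥ : 1000 ≤ a) (n≤ : n ≤ (a * a) * 103744)
  (L+z : L + z ≡ n) (z≤ : z * 16 ≤ n) where

  open ≤-Reasoning

  -- As z is at most n/16, z / (80a) is at most 103744a / 1280, about 81.05a; the remaining 6 is
  -- absorbed in rounding up to 82a.
  few-covers : ∀ x → a * 80 * x ≤ z + a * 480 → x ≤ a * 82
  few-covers x h = ≮⇒≥ λ big → <⇒≱ (contra big) (begin
    a * 1280 * x               ≡⟨ e₁ a x ⟩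
    (a * 80 * x) * 16          ≤⟨ *-monoˡ-≤ 16 h ⟩
    (z + a * 480) * 16         ≡⟨ e₂ a z ⟩
    z * 16 + a * 7680          ≤⟨ +-monoˡ-≤ (a * 7680) (≤-trans z≤ n≤) ⟩
    (a * a) * 103744 + a * 7680 ∎)
    where
    e₁ : ∀ a x → a * 1280 * x ≡ (a * 80 * x) * 16
    e₁ = solve-∀
    e₂ : ∀ a z → (z + a * 480) * 16 ≡ z * 16 + a * 7680
    e₂ = solve-∀
    contra : a * 82 < x → (a * a) * 103744 + a * 7680 < a * 1280 * x
    contra big = begin-strict
      (a * a) * 103744 + a * 7680      ≤⟨ +-monoʳ-≤ ((a * a) * 103744) (≤-trans (≤-reflexive (split a)) (+-monoʳ-≤ (a * 1280) (*-monoˡ-≤ 16 (*-monoʳ-≤ a (≤-trans 400≤1000 a≥))))) ⟩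
      (a * a) * 103744 + (a * 1280 + (a * a) * 16) <⟨ m<m+n _ {(a * a) * 1200} pos ⟩
      (a * a) * 103744 + (a * 1280 + (a * a) * 16) + (a * a) * 1200 ≡⟨ e₃ a ⟩
      a * 1280 * (1 + a * 82)          ≤⟨ *-monoʳ-≤ (a * 1280) big ⟩
      a * 1280 * x                     ∎
      where
      e₃ : ∀ a → (a * a) * 103744 + (a * 1280 + (a * a) * 16) + (a * a) * 1200 ≡ a * 1280 * (1 + a * 82)
      e₃ = solve-∀
      400≤1000 : 400 ≤ 1000
      400≤1000 = ≤ᵇ⇒≤ 400 1000 tt
      split : ∀ a → a * 7680 ≡ a * 1280 + (a * 400) * 16
      split = solve-∀
      a>0 : 0 < a
      a>0 = ≤-trans (≤ᵇ⇒≤ 1 1000 tt) a≥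
      pos : 0 < (a * a) * 1200
      pos = *-mono-≤ {1} {a * a} {1} {1200} (*-mono-≤ {1} {a} {1} {a} a>0 a>0) (≤ᵇ⇒≤ 1 1200 tt)

  u≤a : u ≤ a
  u≤a = ≤-trans (m≤m*n u 100000) (≤-reflexive a≡)

  private
    q : ℕ
    q = a * (a * (a * a))

  -- With n ≈ 103680 a², k ≈ 317 a and w = 640 a², all terms other than w² are of lower order.
  error-small : ∀ k X → k ≤ a * 399 → 2 * X ≤ u * u → ∀ w → w ≡ (a * a) * 640 →
    (k * w + (2 * (X * w) + w * suc w + 4 * (k * (k + n * u)))) * 100 ≤ (w * w) * 101
  error-small k X k≤ X≤ w refl = begin
    (k * w + (2 * (X * w) + w * suc w + 4 * (k * (k + n * u)))) * 100
      ≡⟨ expand k w X n u ⟩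
    (w * w) * 100 + ((k * w) * 100 + (2 * X * w) * 100 + w * 100 + (k * k) * 400 + (k * (n * u)) * 400)
      ≤⟨ +-monoʳ-≤ ((w * w) * 100) (+-mono-≤ (+-mono-≤ (+-mono-≤ (+-mono-≤ kw Xw) just-w) kk) knu) ⟩
    -- The allowance `w * w` equals 409600 q, while the five errors total 318857 q. The largest is
    -- the hair term with k n u, kept small by u = a / 100000.
    (w * w) * 100 + (q * 25536 + q * 64000 + q * 64 + q * 63681 + q * 165576)
      ≤⟨ ≤-from-excess {P = 0} (q * 90743) z≤n (collect a) ⟩
    (w * w) * 101 ∎
    where
    expand : ∀ k w X n u → (k * w + (2 * (X * w) + w * suc w + 4 * (k * (k + n * u)))) * 100
      ≡ (w * w) * 100 + ((k * w) * 100 + (2 * X * w) * 100 + w * 100 + (k * k) * 400 + (k * (n * u)) * 400)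
    expand = solve-∀
    collect : ∀ a → let w = (a * a) * 640 ; q = a * (a * (a * a)) in
      (w * w) * 100 + (q * 25536 + q * 64000 + q * 64 + q * 63681 + q * 165576) + 0 + q * 90743 ≡ (w * w) * 101 + 0
    collect = solve-∀
    kw : (k * w) * 100 ≤ q * 25536
    kw = begin
      (k * w) * 100                       ≤⟨ *-monoˡ-≤ 100 (*-monoˡ-≤ w k≤) ⟩
      (a * 399 * ((a * a) * 640)) * 100   ≡⟨ e a ⟩
      (a * (a * a)) * 25536 * 1000        ≤⟨ *-monoʳ-≤ ((a * (a * a)) * 25536) a≥ ⟩
      (a * (a * a)) * 25536 * a           ≡⟨ e′ a ⟩
      q * 25536                           ∎
      where
      e : ∀ a → (a * 399 * ((a * a) * 640)) * 100 ≡ (a * (a * a)) * 25536 * 1000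
      e = solve-∀
      e′ : ∀ a → (a * (a * a)) * 25536 * a ≡ (a * (a * (a * a))) * 25536
      e′ = solve-∀
    Xw : (2 * X * w) * 100 ≤ q * 64000
    Xw = begin
      (2 * X * w) * 100                   ≤⟨ *-monoˡ-≤ 100 (*-monoˡ-≤ w (≤-trans X≤ (*-mono-≤ u≤a u≤a))) ⟩
      (a * a * ((a * a) * 640)) * 100     ≡⟨ e a ⟩
      q * 64000                           ∎
      where
      e : ∀ a → (a * a * ((a * a) * 640)) * 100 ≡ (a * (a * (a * a))) * 64000
      e = solve-∀
    square : 1000 * 1000 ≤ a * a
    square = *-mono-≤ a≥ a≥
    just-w : w * 100 ≤ q * 64
    just-w = begin
      ((a * a) * 640) * 100               ≤⟨ m≤m*n (((a * a) * 640) * 100) 1000 ⟩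
      (((a * a) * 640) * 100) * 1000      ≡⟨ e a ⟩
      (a * a) * 64 * (1000 * 1000)        ≤⟨ *-monoʳ-≤ ((a * a) * 64) square ⟩
      (a * a) * 64 * (a * a)              ≡⟨ e′ a ⟩
      q * 64                              ∎
      where
      e : ∀ a → (((a * a) * 640) * 100) * 1000 ≡ (a * a) * 64 * (1000 * 1000)
      e = solve-∀
      e′ : ∀ a → (a * a) * 64 * (a * a) ≡ (a * (a * (a * a))) * 64
      e′ = solve-∀
    kk : (k * k) * 400 ≤ q * 63681
    kk = begin
      (k * k) * 400                       ≤⟨ *-monoˡ-≤ 400 (*-mono-≤ k≤ k≤) ⟩
      (a * 399 * (a * 399)) * 400         ≤⟨ m≤m+n _ ((a * a) * 63617319600) ⟩
      (a * 399 * (a * 399)) * 400 + (a * a) * 63617319600 ≡⟨ e a ⟩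
      (a * a) * 63681 * (1000 * 1000)     ≤⟨ *-monoʳ-≤ ((a * a) * 63681) square ⟩
      (a * a) * 63681 * (a * a)           ≡⟨ e′ a ⟩
      q * 63681                           ∎
      where
      e : ∀ a → (a * 399 * (a * 399)) * 400 + (a * a) * 63617319600 ≡ (a * a) * 63681 * (1000 * 1000)
      e = solve-∀
      e′ : ∀ a → (a * a) * 63681 * (a * a) ≡ (a * (a * (a * a))) * 63681
      e′ = solve-∀
    knu : (k * (n * u)) * 400 ≤ q * 165576
    knu = begin
      (k * (n * u)) * 400                                 ≤⟨ *-monoˡ-≤ 400 (*-mono-≤ k≤ (*-monoˡ-≤ u n≤)) ⟩
      (a * 399 * ((a * a) * 103744 * u)) * 400            ≤⟨ m≤m+n _ ((a * (a * a) * u) * 57600) ⟩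
      (a * 399 * ((a * a) * 103744 * u)) * 400 + (a * (a * a) * u) * 57600 ≡⟨ e a u ⟩
      (a * (a * a)) * 165576 * (u * 100000)               ≡⟨ cong ((a * (a * a)) * 165576 *_) a≡ ⟩
      (a * (a * a)) * 165576 * a                          ≡⟨ e′ a ⟩
      q * 165576                                          ∎
      where
      e : ∀ a u → (a * 399 * ((a * a) * 103744 * u)) * 400 + (a * (a * a) * u) * 57600 ≡ (a * (a * a)) * 165576 * (u * 100000)
      e = solve-∀
      e′ : ∀ a → (a * (a * a)) * 165576 * a ≡ (a * (a * (a * a))) * 165576
      e′ = solve-∀

  -- Writing x = 82a - b expresses both sides in `a` and `b`. Up to a term linear in `a`, the bound
  -- 1.01 (L + 2w) is at most 99449 a² + 81ab, while k² is at least 100489 a² + 634ab. Both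
  -- coefficients favour k, so a smaller cover only helps.
  contradiction : ∀ x b k Q w → x + b ≡ a * 82 → k ≡ a * 317 + b → w ≡ (a * a) * 640 → a * 80 * x ≤ z + a * 480 →
    (k * w) * (k * w) ≤ (L + w + w) * Q → Q * 100 ≤ (w * w) * 101 → ⊥
  contradiction x b k Q w x+b refl w≡ cover sidon small = <⇒≱ large (*-cancelʳ-≤ _ _ (w * w) {{>-nonZero w²>0}} (begin
    (k * k) * 100 * (w * w)           ≡⟨ e₁ k w ⟩
    ((k * w) * (k * w)) * 100         ≤⟨ *-monoˡ-≤ 100 sidon ⟩
    ((L + w + w) * Q) * 100           ≡⟨ e₂ (L + w + w) Q ⟩
    (L + w + w) * (Q * 100)           ≤⟨ *-monoʳ-≤ (L + w + w) small ⟩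
    (L + w + w) * ((w * w) * 101)     ≡⟨ e₃ (L + w + w) (w * w) ⟩
    (L + w + w) * 101 * (w * w)       ∎))
    where
    a>0 : 0 < a
    a>0 = ≤-trans (≤ᵇ⇒≤ 1 1000 tt) a≥
    w>0 : 0 < w
    w>0 = subst (0 <_) (sym w≡) (*-mono-≤ {1} {a * a} {1} {640} (*-mono-≤ {1} {a} {1} {a} a>0 a>0) (≤ᵇ⇒≤ 1 640 tt))
    w²>0 : 0 < w * w
    w²>0 = *-mono-≤ {1} {w} {1} {w} w>0 w>0
    e₁ : ∀ k w → (k * k) * 100 * (w * w) ≡ ((k * w) * (k * w)) * 100
    e₁ = solve-∀
    e₂ : ∀ l Q → (l * Q) * 100 ≡ l * (Q * 100)
    e₂ = solve-∀
    e₃ : ∀ l s → l * (s * 101) ≡ l * 101 * s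
    e₃ = solve-∀
    -- z ≥ 80ax - 480a, so L = n - z is small when x is large.
    L≤ : L + a * 80 * x ≤ (a * a) * 103744 + a * 480
    L≤ = begin
      L + a * 80 * x                ≤⟨ +-monoʳ-≤ L cover ⟩
      L + (z + a * 480)             ≡⟨ +-assoc L z _ ⟨
      L + z + a * 480               ≡⟨ cong (_+ a * 480) L+z ⟩
      n + a * 480                   ≤⟨ +-monoˡ-≤ (a * 480) n≤ ⟩
      (a * a) * 103744 + a * 480    ∎
    L≤′ : L ≤ (a * a) * 97184 + (a * b) * 80 + a * 480
    L≤′ = ≤-from-excess 0 L≤ (trans (e₄ L a) (trans
      (cong (λ t → L + ((a * a) * 97184 + a * 480) + (a * t) * 80) (sym x+b)) (e₅ L a x b)))
      where
      e₄ : ∀ L a → L + ((a * a) * 103744 + a * 480) + 0 ≡ L + ((a * a) * 97184 + a * 480) + (a * (a * 82)) * 80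
      e₄ = solve-∀
      e₅ : ∀ L a x b → L + ((a * a) * 97184 + a * 480) + (a * (x + b)) * 80 ≡ (a * a) * 97184 + (a * b) * 80 + a * 480 + (L + a * 80 * x)
      e₅ = solve-∀
    large : (L + w + w) * 101 < (k * k) * 100
    large = begin-strict
      (L + w + w) * 101                                                        ≡⟨ cong (λ w → (L + w + w) * 101) w≡ ⟩
      (L + (a * a) * 640 + (a * a) * 640) * 101                                ≤⟨ *-monoˡ-≤ 101 (+-monoˡ-≤ ((a * a) * 640) (+-monoˡ-≤ ((a * a) * 640) L≤′)) ⟩
      ((a * a) * 97184 + (a * b) * 80 + a * 480 + (a * a) * 640 + (a * a) * 640) * 101 ≡⟨ e₆ a b ⟩
      (a * a) * 9944864 + (a * b) * 8080 + a * 48480                           <⟨ +-monoʳ-< ((a * a) * 9944864 + (a * b) * 8080) (*-monoʳ-< a {{>-nonZero a>0}} (≤ᵇ⇒≤ 48481 48481 tt)) ⟩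
      (a * a) * 9944864 + (a * b) * 8080 + a * 48481                           ≤⟨ +-monoʳ-≤ ((a * a) * 9944864 + (a * b) * 8080) (*-monoʳ-≤ a (≤-trans (≤ᵇ⇒≤ 48481 104000 tt) (*-monoˡ-≤ 104 a≥))) ⟩
      (a * a) * 9944864 + (a * b) * 8080 + a * (a * 104)                       ≤⟨ ≤-from-excess {P = 0} ((a * a) * 103932 + (a * b) * 55320 + (b * b) * 100) z≤n (e₇ a b) ⟩
      (k * k) * 100                                                            ∎
      where
      e₆ : ∀ a b → ((a * a) * 97184 + (a * b) * 80 + a * 480 + (a * a) * 640 + (a * a) * 640) * 101 ≡ (a * a) * 9944864 + (a * b) * 8080 + a * 48480
      e₆ = solve-∀
      e₇ : ∀ a b → (a * a) * 9944864 + (a * b) * 8080 + a * (a * 104) + 0 + ((a * a) * 103932 + (a * b) * 55320 + (b * b) * 100) ≡ ((a * 317 + b) * (a * 317 + b)) * 100 + 0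
      e₇ = solve-∀

module Core {n} (G : Graph n) (D : DistinctCycleLengths G) {m} (C : Cycle G m)
  (u a ρ : ℕ) (0<u : 0 < u) (a≡ : u * 100000 ≡ a) (a≥ : 1000 ≤ a) (n≤ : n ≤ (a * a) * 103744) (0<ρ : 0 < ρ)
  (ρ+ρ+5≤a : ρ + ρ + 5 ≤ a) (n<ρu² : suc n ≤ ρ * (u * u)) (many : n + a * 480 ≤ edgeCount G + 5)
  (long : 15 * n ≤ 16 * (3 + m)) where

  -- `r` is the number of bases: r X ≤ n + 1 ≤ ρ u² makes 2X at most u². `t` is close to √(n/16),
  -- about 80.5a, which balances the two parts of the cover. `w` is below one per cent of `n`, so
  -- that L + 2w stays near L, and yet w² dominates the errors.
  L z r t w : ℕ
  L = 3 + m
  z = n ∸ L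
  r = ρ + ρ
  t = a * 80
  w = (a * a) * 640

  L+z : L + z ≡ n
  L+z = m+[n∸m]≡n (cycle-size C)

  z≤ : z * 16 ≤ n
  z≤ = ≤-from-excess 0 long (trans (e₁ z L) (trans (cong (16 *_) L+z) (e₂ n)))
    where
    e₁ : ∀ z L → z * 16 + 16 * L + 0 ≡ 16 * (L + z)
    e₁ = solve-∀
    e₂ : ∀ n → 16 * n ≡ n + 15 * n
    e₂ = solve-∀

  open Arithmetic a u n L z a≡ a≥ n≤ L+z z≤

  a≤480 : a ≤ a * 480
  a≤480 = m≤m*n a 480

  -- The 5 is the defect of the construction; the sixth unit keeps `E` positive.
  E+5 : ∃[ E ] 6 + E ≡ z + a * 480
  E+5 = m≤n⇒∃[o]m+o≡n (≤-trans (≤-trans (≤ᵇ⇒≤ 6 1000 tt) a≥) (≤-trans a≤480 (m≤n+m (a * 480) z)))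

  E : ℕ
  E = suc (proj₁ E+5)

  E≡ : 5 + E ≡ z + a * 480
  E≡ = proj₂ E+5

  E≤ : E + L ≤ edgeCount G
  E≤ = +-cancelʳ-≤ 5 _ _ (≤-trans (≤-reflexive total) many)
    where
    e₁ : ∀ E L → E + L + 5 ≡ 5 + E + L
    e₁ = solve-∀
    e₂ : ∀ z L x → z + x + L ≡ L + z + x
    e₂ = solve-∀
    total : E + L + 5 ≡ n + a * 480
    total = trans (e₁ E L) (trans (cong (_+ L) E≡) (trans (e₂ z L (a * 480)) (cong (_+ a * 480) L+z)))

  absurd : ⊥
  absurd = UpperBound.numbers D C E t r w (s≤s z≤n) (≤-trans 0<ρ (m≤m+n ρ ρ)) E≤ λ { (x , K , cover , total , sidon) →
    finish x K cover total sidon }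
    where
    finish : ∀ x K → suc t * x ≤ E → E + L ≤ (t + x) + (K + n) → (∀ k → r + k ≤ K → SidonInequality n L w r k) → ⊥
    finish x K cover total sidon = conclude (m≤n⇒∃[o]m+o≡n (few-covers x cover′))
      where
      cover′ : a * 80 * x ≤ z + a * 480
      cover′ = ≤-trans (m≤n+m (t * x) x) (≤-trans cover (≤-trans (m≤n+m E 5) (≤-reflexive E≡)))
      conclude : ∃[ b ] x + b ≡ a * 82 → ⊥
      conclude (b , x+b) = use (sidon k r+k≤K)
        where
        k : ℕ
        k = a * 317 + b
        r+k≤K : r + k ≤ K
        r+k≤K = ≤-from-excess 0 (+-mono-≤ total ρ+ρ+5≤a) (trans (e₁ r a b x K n) (trans
          (cong₂ (λ p q → r + a * 398 + p + (K + q)) x+b (sym L+z))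
          (trans (e₂ r a K L z) (trans (cong (λ y → K + (y + L + r)) (sym E≡)) (e₃ K E L r)))))
          where
          e₁ : ∀ r a b x K n → r + (a * 317 + b) + ((a * 80 + x) + (K + n) + a) + 0 ≡ r + a * 398 + (x + b) + (K + n)
          e₁ = solve-∀
          e₂ : ∀ r a K L z → r + a * 398 + a * 82 + (K + (L + z)) ≡ K + (z + a * 480 + L + r)
          e₂ = solve-∀
          e₃ : ∀ K E L r → K + (5 + E + L + r) ≡ K + (E + L + (r + 5))
          e₃ = solve-∀
        k≤ : k ≤ a * 399
        k≤ = ≤-trans (+-monoʳ-≤ (a * 317) (≤-trans (m≤n+m b x) (≤-reflexive x+b))) (≤-reflexive (e a))
          where
          e : ∀ a → a * 317 + a * 82 ≡ a * 399
          e = solve-∀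
        use : SidonInequality n L w r k → ⊥
        use (X , rX≤ , bound) = contradiction x b k (k * w + (2 * (X * w) + w * suc w + 4 * (k * (k + n * u)))) w x+b refl refl cover′ (bound u 2X<) (error-small k X k≤ 2X≤ w refl)
          where
          2X≤ : 2 * X ≤ u * u
          2X≤ = *-cancelˡ-≤ ρ {{>-nonZero 0<ρ}} (≤-trans (≤-reflexive (e ρ X)) (≤-trans rX≤ n<ρu²))
            where
            e : ∀ ρ X → ρ * (2 * X) ≡ (ρ + ρ) * X
            e = solve-∀
          2X< : 2 * X < suc u * u
          2X< = ≤-<-trans 2X≤ (m<n+m (u * u) 0<u)

-- Scaling of n and the choice of constants.

suc-*ʳ : ∀ c u → suc u * c ≡ u * c + c
suc-*ʳ c u = +-comm c (u * c)

opaque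
  scale : ℕ → ℕ
  scale u = u * 100000

  scale≡ : ∀ u → u * 100000 ≡ scale u
  scale≡ u = refl

  scale-suc : ∀ u → scale u + 100000 ≡ scale (suc u)
  scale-suc u = sym (suc-*ʳ 100000 u)

  scale-mono : ∀ {u v} → u ≤ v → scale u ≤ scale v
  scale-mono = *-monoˡ-≤ 100000

  u≤scale : ∀ u → u ≤ scale u
  u≤scale u = m≤m*n u 100000

  scale-4000 : 400000000 ≤ scale 4000
  scale-4000 = ≤ᵇ⇒≤ 400000000 400000000 tt

-- The order required by the construction for p = 24a: 180p² + 8p. Its excess 20p is then 480a.
needed : ℕ → ℕ
needed a = (a * a) * 103680 + a * 192

threshold : ℕ → ℕ
threshold u = needed (scale u)

threshold-grows : ∀ u → u ≤ threshold u
threshold-grows u = ≤-trans (u≤scale u) (≤-trans (m≤m*n (scale u) 192) (m≤n+m _ ((scale u * scale u) * 103680)))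

-- Only multiples of 100000 are used for `a`. Passing to the next one raises the required order by a
-- term linear in `a`, and the bound 4 · 10^8 is where 64a² absorbs it.
needed-step : ∀ a → 400000000 ≤ a → needed (a + 100000) ≤ (a * a) * 103744
needed-step a a≥ = begin
  needed (a + 100000)                                         ≡⟨ e₁ a ⟩
  (a * a) * 103680 + (a * 20736000192 + 1036800019200000)     ≤⟨ +-monoʳ-≤ ((a * a) * 103680) (+-monoʳ-≤ (a * 20736000192)
                                                                   (≤-trans (≤ᵇ⇒≤ 1036800019200000 1945599923200000000 tt) (*-monoˡ-≤ 4863999808 a≥))) ⟩
  (a * a) * 103680 + (a * 20736000192 + a * 4863999808)       ≡⟨ e₂ a ⟩
  (a * a) * 103680 + a * 25600000000                          ≤⟨ +-monoʳ-≤ ((a * a) * 103680) (*-monoʳ-≤ a (*-monoˡ-≤ 64 a≥)) ⟩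
  (a * a) * 103680 + a * (a * 64)                             ≡⟨ e₃ a ⟩
  (a * a) * 103744                                            ∎
  where
  open ≤-Reasoning
  e₁ : ∀ a → ((a + 100000) * (a + 100000)) * 103680 + (a + 100000) * 192 ≡ (a * a) * 103680 + (a * 20736000192 + 1036800019200000)
  e₁ = solve-∀
  e₂ : ∀ a → (a * a) * 103680 + (a * 20736000192 + a * 4863999808) ≡ (a * a) * 103680 + a * 25600000000
  e₂ = solve-∀
  e₃ : ∀ a → (a * a) * 103680 + a * (a * 64) ≡ (a * a) * 103744
  e₃ = solve-∀

threshold-step : ∀ u → 4000 ≤ u → threshold (suc u) ≤ (scale u * scale u) * 103744
threshold-step u 4000≤u = subst (λ a → needed a ≤ (scale u * scale u) * 103744) (scale-suc u)
  (needed-step (scale u) (≤-trans scale-4000 (scale-mono 4000≤u)))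

opaque
  unfolding scale

  -- `ρ` is 103744 · 10^10 + 1, so n + 1 is at most ρ u²: a² is 10^10 u², and the added 1 covers the
  -- successor. `u₀` is large enough for the 2ρ bases and the defect 5 to cost at most one `a`.
  u₀ ρ : ℕ
  u₀ = 30000000000
  ρ = 1037440000000001

  4000≤u₀ : 4000 ≤ u₀
  4000≤u₀ = ≤ᵇ⇒≤ 4000 30000000000 tt

  0<ρ : 0 < ρ
  0<ρ = ≤ᵇ⇒≤ 1 1037440000000001 tt

  ρ+ρ+5≤ : ρ + ρ + 5 ≤ scale u₀
  ρ+ρ+5≤ = ≤ᵇ⇒≤ 2074880000000007 3000000000000000 tt

  ρ≡ : ∀ x → x * 1037440000000001 ≡ ρ * x
  ρ≡ x = *-comm x ρ

mainTheorem1 : ∃[ N ] (∀ n → N ≤ n → ∀ L → IsMC n L → 16 * L ≤ 15 * n)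
mainTheorem1 = threshold u₀ , λ n N≤n L mc → bounded n N≤n L (proj₂ mc)
  where
  bounded : ∀ n → threshold u₀ ≤ n → ∀ L → L ≡ 0 ⊎ ∃[ G ] (InM {n} G × ∃[ m ] (Cycle G m × 3 + m ≡ L)) → 16 * L ≤ 15 * n
  bounded n _ L (inj₁ refl) = z≤n
  -- A comparison of numbers is decidable, so its negation may be assumed; the goal becomes empty,
  -- and the double negations of the upper bound can be used.
  bounded n N≤n L (inj₂ (G , (D , optimal) , m , C , refl)) = decidable-stable (16 * (3 + m) ≤? 15 * n)
    λ long → refute (<⇒≤ (≰⇒> long)) (bracket threshold threshold-grows u₀ n N≤n)
    where
    refute : 15 * n ≤ 16 * (3 + m) → ∃[ u ] (u₀ ≤ u × threshold u ≤ n × n < threshold (suc u)) → ⊥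
    refute long (u , u₀≤u , lower , upper) = against (lower-bound (scale u * 24) n 0<p (≤-trans (≤-reflexive (e₁ (scale u))) lower))
      where
      a : ℕ
      a = scale u
      4000≤u : 4000 ≤ u
      4000≤u = ≤-trans 4000≤u₀ u₀≤u
      0<u : 0 < u
      0<u = ≤-trans (≤ᵇ⇒≤ 1 4000 tt) 4000≤u
      0<p : 0 < a * 24
      0<p = *-mono-≤ {1} {a} {1} {24} (≤-trans 0<u (u≤scale u)) (≤ᵇ⇒≤ 1 24 tt)
      e₁ : ∀ a → 180 * (a * 24 * (a * 24)) + 8 * (a * 24) ≡ (a * a) * 103680 + a * 192
      e₁ = solve-∀
      n≤ : n ≤ (a * a) * 103744
      n≤ = ≤-trans (<⇒≤ upper) (threshold-step u 4000≤u)
      a≥ : 1000 ≤ a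
      a≥ = ≤-trans (≤-trans (≤ᵇ⇒≤ 1000 4000 tt) 4000≤u) (u≤scale u)
      n<ρu² : suc n ≤ ρ * (u * u)
      n<ρu² = ≤-trans (+-mono-≤ (*-mono-≤ {1} {u} {1} {u} 0<u 0<u) n≤) (≤-reflexive (trans (cong (λ a → u * u + (a * a) * 103744) (sym (scale≡ u))) (trans (e₂ u) (ρ≡ (u * u)))))
        where
        e₂ : ∀ u → u * u + (u * 100000 * (u * 100000)) * 103744 ≡ (u * u) * 1037440000000001
        e₂ = solve-∀
      against : ∃[ H ] (DistinctCycleLengths {n} H × n + 20 * (a * 24) ≤ edgeCount H + 5) → ⊥
      against (H , H-distinct , H-edges) = Core.absurd G D C u a ρ 0<u (scale≡ u)
        a≥ n≤ 0<ρ (≤-trans ρ+ρ+5≤ (scale-mono u₀≤u)) n<ρu²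
        (≤-trans (≤-reflexive (cong (n +_) (e₃ a))) (≤-trans H-edges (+-monoˡ-≤ 5 (proj₂ optimal H H-distinct)))) long
        where
        e₃ : ∀ a → a * 480 ≡ 20 * (a * 24)
        e₃ = solve-∀
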